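{- Let $N > 1$ be an odd integer not divisible by $3$. For each divisor $d > 1$ of $N$ let $k_d = \operatorname{ord}_d(2)$, and let $K_N = \sum_{d \mid N,\, d > 1} \frac{\phi(d)}{k_d}$. Then the determinant of the adjacency matrix $M_N$ of the modular Conway amusical graph satisfies $\det M_N = 0$ if $k_p$ is even for at least one prime $p \mid N$; $\det M_N = 3 \cdot 2^{K_N}$ if $k_p$ is odd for all primes $p \mid N$ and $N \equiv \pm 1, \pm 5 \pmod{24}$; $\det M_N = -3 \cdot 2^{K_N}$ if $k_p$ is odd for all primes $p \mid N$ and $N \equiv \pm 7, \pm 11 \pmod{24}$.
   Context: Conway's amusical function $U : \mathbb{N} \to \mathbb{N}$ is $U(n) = 3n/2$ if $n$ is even, $U(n) = (3n+1)/4$ if $n \equiv 1 \pmod 4$, and $U(n) = (3n-1)/4$ if $n \equiv -1 \pmod 4$. For $N \in \mathbb{N}$ the modular Conway amusical graph has vertex set $\mathbb{Z}_N = \{0,\ldots,N-1\}$ with an edge $a \to b$ iff some $n \in \mathbb{N}$ has $n \equiv a \pmod N$ and $U(n) \equiv b \pmod N$. Its adjacency matrix $M_N = (m_{a,b})$ (rows and columns indexed $0,\ldots,N-1$) has $m_{a,b}$ equal to the number of the three rules (the rule for even $n$, for $n \equiv 1 \pmod 4$, for $n \equiv -1 \pmod 4$) for which some $n \in \mathbb{N}$ with $n \equiv a \pmod N$ satisfying that rule's condition has $U(n) \equiv b \pmod N$; so a double edge gives entry $2$. For odd $N$ coprime to $3$ this means $m_{a,b} = [b \equiv 2^{ -1}3a]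 + [b \equiv 4^{ -1}(3a+1)] + [b \equiv 4^{ -1}(3a-1)]$ modulo $N$. $\operatorname{ord}_d(2)$ is the multiplicative order of $2$ modulo $d$ and $\phi$ is Euler's totient function. -}

module Defs where

open import Data.Nat using (ℕ; zero; suc; _+_; _*_; _^_; _<ᵇ_; ∣_-_∣; _/_)
open import Data.Nat.Divisibility using (_∣_; _∣?_)
open import Data.Nat.GCD using (gcd)
open import Data.Nat.Properties using (_≟_)
open import Data.Bool using (Bool; true; false; if_then_else_; _∧_)
open import Data.Fin using (Fin; toℕ; punchIn) renaming (zero to fzero; suc to fsuc)
open import Data.List using (List; upTo; map)
open import Data.Nat.ListAction using (sum)
open import Data.Integer as ℤ using (ℤ; -_)
open import Relation.Nullary using (Dec; yes; no)
open import Relation.Nullary.Decidable using (⌊_⌋)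

infix 4 _≡?_[mod_]
_≡?_[mod_] : ℕ → ℕ → ℕ → Bool
x ≡? y [mod N ] = ⌊ N ∣? ∣ x - y ∣ ⌋

[_] : Bool → ℤ
[ true ]  = ℤ.1ℤ
[ false ] = ℤ.0ℤ

-- Adjacency matrix M_N of the modular Conway amusical graph, vertices 0..N-1,
-- in the form stated for odd N coprime to 3:
--   m_{a,b} = [b ≡ 2⁻¹·3a] + [b ≡ 4⁻¹(3a+1)] + [b ≡ 4⁻¹(3a-1)]   (mod N)
-- written without inverses (2, 4 invertible mod N):
--   [2b ≡ 3a] + [4b ≡ 3a+1] + [4b+1 ≡ 3a]                         (mod N)
conwayMatrix : (N : ℕ) → Fin N → Fin N → ℤ
conwayMatrix N a b =
  [ (2 * toℕ b ≡? 3 * toℕ a [mod N ]) ] ℤ.+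
  [ (4 * toℕ b ≡? 3 * toℕ a + 1 [mod N ]) ] ℤ.+
  [ (4 * toℕ b + 1 ≡? 3 * toℕ a [mod N ]) ]

sumFin : (n : ℕ) → (Fin n → ℤ) → ℤ
sumFin zero    f = ℤ.0ℤ
sumFin (suc n) f = f fzero ℤ.+ sumFin n (λ i → f (fsuc i))

sign : ℕ → ℤ
sign zero    = ℤ.1ℤ
sign (suc k) = - sign k

det : (n : ℕ) → (Fin n → Fin n → ℤ) → ℤ
det zero    A = ℤ.1ℤ
det (suc n) A =
  sumFin (suc n) (λ j → sign (toℕ j) ℤ.* A fzero j ℤ.* det n (λ i k → A (fsuc i) (punchIn j k)))

φ : ℕ → ℕ
φ d = sum (map (λ k → if ⌊ gcd k d ≟ 1 ⌋ then 1 else 0) (upTo d))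

-- multiplicative order of 2 modulo d: least k ≥ 1 with 2^k ≡ 1 (mod d),
-- searched for k = 1,…,d (always found when d is odd, since ord_d(2) ≤ φ(d));
-- returns 0 if not found (only when gcd(2,d) ≠ 1, never used then).
ordAux : ℕ → ℕ → ℕ → ℕ
ordAux d zero     k = 0
ordAux d (suc f)  k = if (2 ^ k ≡? 1 [mod d ]) then k else ordAux d f (suc k)

ord2 : ℕ → ℕ
ord2 d = ordAux d d 1

-- exact division (k ∣ m in all uses); returns 0 when k = 0
_div0_ : ℕ → ℕ → ℕ
m div0 zero  = 0
m div0 suc k = m / suc k

K : ℕ → ℕ
K N = sum (map (λ d → if (1 <ᵇ d) ∧ ⌊ d ∣? N ⌋ then φ d div0 ord2 d else 0) (upTo (suc N)))

{-# OPTIONS --safe #-}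
module Submission where

-- In ℤ[x]/(x^N − 1) let D be the operator f(x) ↦ f(x²).  Relabelling the rows by
-- a ↦ 3a and the columns by b ↦ 4b turns M_N into D + (x + x⁻¹); this costs the
-- sign of multiplication by 3, since multiplication by 4 is the square of a
-- permutation.  With g = x − x⁻¹ one has (x + x⁻¹) g = D g, so on multiples of g
-- the operator is D g · (D + 1), while at x = 1 it has the eigenvalue 3 where
-- D + 1 has 2.  Hence 2 det (D + x + x⁻¹) = 3 det (D + 1), and det (D + 1) is the
-- product over the orbits of doubling on ℤ/N of 1 − (−1)^length.  The residues c
-- with N = d gcd(c, N) form φ(d)/ord_d(2) orbits of length ord_d(2), so there are
-- 1 + K_N orbits.  Signs of permutations are found by counting inversions; if all
-- orders are odd, multiplication by 2 is an even permutation, which rules out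
-- N ≡ ±3 (mod 8).

open import Defs
open import Data.Nat as ℕ using (ℕ; zero; suc; s≤s; z≤n; _<_; _≤_; _<ᵇ_; _^_; _%_; ∣_-_∣)
import Data.Nat.Properties as ℕₚ
open import Data.Nat.DivMod using (m%n<n; %-distribˡ-+; %-distribˡ-*; [m+kn]%n≡m%n; m<n⇒m%n≡m; m%n%n≡m%n; m≡m%n+[m/n]*n; m*n/n≡m)
open import Data.Nat.Divisibility using (_∣_; _∣?_; divides; ∣-refl; ∣-trans; ∣-antisym; ∣⇒≤; ∣n⇒∣m*n; ∣m+n∣m⇒∣n; m∣m*n; n∣m*n; *-cancelʳ-∣; *-cancelˡ-∣; m%n≡0⇒n∣m; ∣n∣m%n⇒∣m; %-presˡ-∣)
open import Data.Nat.GCD using (gcd; gcd[m,n]∣m; gcd[m,n]∣n; gcd-greatest; gcd-comm; c*gcd[m,n]≡gcd[cm,cn]; gcd[m,n]≢0)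
open import Data.Nat.Coprimality using (gcd≡1⇒coprime; coprime-divisor)
open import Data.Nat.Induction using (<-wellFounded)
open import Data.Nat.ListAction using (sum; product)
open import Data.Nat.Primality using (Prime; prime[2]; euclidsLemma)
open import Data.Nat.Primality.Factorisation using (factorise; PrimeFactorisation)
import Data.Nat.Tactic.RingSolver as ℕ-Solver
open import Data.Integer as ℤ using (ℤ; -_; _+_; _*_; 0ℤ; 1ℤ)
import Data.Integer.Properties as ℤₚ
open import Data.Integer.Tactic.RingSolver using (solve-∀)
open import Data.Fin as Fin using (Fin; zero; suc; toℕ; punchIn; punchOut)
import Data.Fin.Properties as Finₚ
open import Data.Bool using (Bool; true; false; if_then_else_; _∧_)
open import Data.Empty using (⊥-elim)
open import Data.List using ([]; _∷_; upTo; map; applyUpTo)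
open import Data.List.Relation.Unary.All using (All; []; _∷_)
open import Data.Product using (_×_; _,_; ∃; proj₁; proj₂)
open import Data.Sum using (_⊎_; inj₁; inj₂)
open import Function using (_∘_)
open import Function.Bundles using (mk⇔)
open import Induction.WellFounded using (Acc; acc)
open import Relation.Binary.Definitions using (tri<; tri≈; tri>)
open import Relation.Binary.PropositionalEquality using (_≡_; _≢_; refl; sym; trans; cong; cong₂; subst; subst₂; module ≡-Reasoning)
open import Relation.Nullary using (Dec; yes; no; ¬_)
open import Relation.Nullary.Decidable using (does; dec-true; dec-false; does-⇔; ⌊_⌋; isYes≗does)


-- Finite sums over Fin

-- The reduction rests on a difference of squares, (x + x⁻¹)(x - x⁻¹) = x² - x⁻². As D is a ring
-- homomorphism, (D + x + x⁻¹)(g f) = D g · (D f + f). Multiplication by D g is conjugate under D to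
-- multiplication by g, so both would drop out of the determinants if g were invertible. It is not,
-- since g vanishes at x = 1. For odd N no other N-th root of unity satisfies x² = 1, so adding the
-- all-ones row to every row repairs exactly the defective component. Projecting onto that component
-- would need the denominator N; to stay inside ℤ, D + 1 is multiplied by N instead, and the surplus
-- powers of N, like the determinant of the repaired g, are cancelled from equations between
-- integers. This needs only that they do not vanish. The orbits of doubling are not sorted into
-- cycles either. Rows are combined by matrices that are unitriangular for a rank function on the
-- residues, so the order of the basis never changes.

sum-cong : ∀ n {f g : Fin n → ℤ} → (∀ i → f i ≡ g i) → sumFin n f ≡ sumFin n g
sum-cong zero    e = refl
sum-cong (suc n) e = cong₂ _+_ (e zero) (sum-cong n (e ∘ suc))

sum-lin : ∀ n {f g h : Fin n → ℤ} a b → (∀ i → f i ≡ a * g i + b * h i) →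
          sumFin n f ≡ a * sumFin n g + b * sumFin n h
sum-lin zero    a b e = lem a b
  where lem : ∀ a b → 0ℤ ≡ a * 0ℤ + b * 0ℤ
        lem = solve-∀
sum-lin (suc n) {f} {g} {h} a b e =
  trans (cong₂ _+_ (e zero) (sum-lin n {f ∘ suc} {g ∘ suc} {h ∘ suc} a b (e ∘ suc)))
        (lem a b (g zero) (h zero) (sumFin n (g ∘ suc)) (sumFin n (h ∘ suc)))
  where lem : ∀ a b x y s t → (a * x + b * y) + (a * s + b * t) ≡ a * (x + s) + b * (y + t)
        lem = solve-∀

sum-0 : ∀ n {f : Fin n → ℤ} → (∀ i → f i ≡ 0ℤ) → sumFin n f ≡ 0ℤ
sum-0 zero    e = refl
sum-0 (suc n) e = cong₂ _+_ (e zero) (sum-0 n (e ∘ suc))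

sum-+ : ∀ n (f g : Fin n → ℤ) → sumFin n (λ i → f i + g i) ≡ sumFin n f + sumFin n g
sum-+ n f g = trans (sum-lin n {_} {f} {g} 1ℤ 1ℤ (λ i → lem (f i) (g i)))
                    (sym (lem (sumFin n f) (sumFin n g)))
  where lem : ∀ a b → a + b ≡ 1ℤ * a + 1ℤ * b
        lem = solve-∀

sum-*ˡ : ∀ n a (f : Fin n → ℤ) → sumFin n (λ i → a * f i) ≡ a * sumFin n f
sum-*ˡ n a f = trans (sum-lin n {_} {f} {f} a 0ℤ (λ i → lem a (f i))) (sym (lem a (sumFin n f)))
  where lem : ∀ a x → a * x ≡ a * x + 0ℤ * x
        lem = solve-∀

sum-swap : ∀ m n (f : Fin m → Fin n → ℤ) →
           sumFin m (λ i → sumFin n (f i)) ≡ sumFin n (λ j → sumFin m (λ i → f i j))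
sum-swap zero    n f = sym (sum-0 n (λ _ → refl))
sum-swap (suc m) n f = trans (cong (sumFin n (f zero) +_) (sum-swap m n (f ∘ suc)))
                             (sym (sum-+ n _ _))

sum-punchIn : ∀ n (j : Fin (suc n)) (f : Fin (suc n) → ℤ) →
              sumFin (suc n) f ≡ f j + sumFin n (f ∘ punchIn j)
sum-punchIn n       zero    f = refl
sum-punchIn (suc n) (suc j) f =
  trans (cong (_+_ (f zero)) (sum-punchIn n j (f ∘ suc))) (lem (f zero) (f (suc j)) _)
  where lem : ∀ a b c → a + (b + c) ≡ b + (a + c)
        lem = solve-∀

sum-single : ∀ n (j : Fin n) {f : Fin n → ℤ} → (∀ i → i ≢ j → f i ≡ 0ℤ) → sumFin n f ≡ f j
sum-single (suc n) j {f} e =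
  trans (sum-punchIn n j f)
        (trans (cong (f j +_) (sum-0 n (λ i → e _ (Finₚ.punchInᵢ≢i j i)))) (ℤₚ.+-identityʳ _))

-- Alternating multilinear functions of rows

Rows : ℕ → ℕ → Set
Rows n p = Fin n → Fin p → ℤ

infix 4 _≈_
_≈_ : ∀ {n p} → Rows n p → Rows n p → Set
r ≈ s = ∀ i k → r i k ≡ s i k

infixr 5 _◁_
_◁_ : ∀ {n p} → (Fin p → ℤ) → Rows n p → Rows (suc n) p
(x ◁ r) zero    = x
(x ◁ r) (suc i) = r i

infixl 7 _⊗_
_⊗_ : ∀ {n m p} → Rows n m → Rows m p → Rows n p
_⊗_ {m = m} C w i k = sumFin m (λ j → C i j * w j k)

-- The number `n` of rows and their width `p` are independent, so a row can be frozen and an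
-- induction continued on fewer rows of the same width. Respect for pointwise equality is a field
-- because rows are functions and extensionality is not assumed.
record Alternating {n p} (F : Rows n p → ℤ) : Set where
  field
    ≈-resp : ∀ {r s} → r ≈ s → F r ≡ F s
    lin  : ∀ {r} s t i a b → (∀ k → k ≢ i → ∀ j → r k j ≡ s k j) →
           (∀ k → k ≢ i → ∀ j → r k j ≡ t k j) →
           (∀ j → r i j ≡ a * s i j + b * t i j) → F r ≡ a * F s + b * F t
    alt  : ∀ {r} i j → i ≢ j → (∀ k → r i k ≡ r j k) → F r ≡ 0ℤ
open Alternating

tail-alternating : ∀ {n p} {F : Rows (suc n) p → ℤ} → Alternating F → ∀ x →
                   Alternating (λ r → F (x ◁ r))
tail-alternating A x .≈-resp e = A .≈-resp λ { zero k → refl ; (suc i) k → e i k }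
tail-alternating A x .lin s t i a b e f g =
  A .lin (x ◁ s) (x ◁ t) (suc i) a b
    (λ { zero _ _ → refl ; (suc k) k≢i → e k (k≢i ∘ cong suc) })
    (λ { zero _ _ → refl ; (suc k) k≢i → f k (k≢i ∘ cong suc) }) g
tail-alternating A x .alt i j i≢j e = A .alt (suc i) (suc j) (i≢j ∘ Finₚ.suc-injective) e

cons-lin : ∀ {n p} {F : Rows (suc n) p → ℤ} → Alternating F → ∀ {x} y z (r : Rows n p) a b →
           (∀ k → x k ≡ a * y k + b * z k) → F (x ◁ r) ≡ a * F (y ◁ r) + b * F (z ◁ r)
cons-lin A y z r a b e = A .lin (y ◁ r) (z ◁ r) zero a b
  (λ { zero n → ⊥-elim (n refl) ; (suc k) _ _ → refl })
  (λ { zero n → ⊥-elim (n refl) ; (suc k) _ _ → refl }) e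

cons-sum : ∀ {n p} {F : Rows (suc n) p → ℤ} → Alternating F → ∀ m (c : Fin m → ℤ)
           (v : Rows m p) (r : Rows n p) →
           F ((λ k → sumFin m (λ j → c j * v j k)) ◁ r) ≡ sumFin m (λ j → c j * F (v j ◁ r))
cons-sum A zero c v r = trans (cons-lin A (λ _ → 0ℤ) (λ _ → 0ℤ) r 0ℤ 0ℤ (λ _ → refl)) refl
cons-sum {F = F} A (suc m) c v r =
  trans (cons-lin A (v zero) (λ k → sumFin m (λ j → c (suc j) * v (suc j) k)) r (c zero) 1ℤ
          (λ k → lem (c zero * v zero k) _))
        (trans (cong (λ z → c zero * F (v zero ◁ r) + 1ℤ * z) (cons-sum A m (c ∘ suc) (v ∘ suc) r))
               (sym (lem (c zero * F (v zero ◁ r)) (sumFin m (λ j → c (suc j) * F (v (suc j) ◁ r))))))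
  where lem : ∀ x y → x + y ≡ x + 1ℤ * y
        lem = solve-∀

-- `kill` is what alternation becomes once `x` has been frozen as an earlier row. Splitting the
-- multiple of `x` off one row at a time leaves only terms that `kill` annihilates.
absorb : ∀ n {p} {F : Rows n p → ℤ} → Alternating F → ∀ (x : Fin p → ℤ) →
         (∀ r i → (∀ k → r i k ≡ x k) → F r ≡ 0ℤ) →
         ∀ (r : Rows n p) (c : Fin n → ℤ) → F (λ i k → r i k + c i * x k) ≡ F r
absorb zero A x kill r c = A .≈-resp λ ()
absorb (suc n) {F = F} A x kill r c = begin
  F r′                                              ≡⟨ A .≈-resp (λ { zero k → refl ; (suc i) k → refl }) ⟩
  F (r′ zero ◁ r′ ∘ suc)                            ≡⟨ cons-lin A (r zero) x (r′ ∘ suc) 1ℤ (c zero) (λ k → cong (_+ c zero * x k) (sym (ℤₚ.*-identityˡ (r zero k)))) ⟩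
  1ℤ * F (r zero ◁ r′ ∘ suc) + c zero * F (x ◁ r′ ∘ suc)
    ≡⟨ cong (λ z → 1ℤ * F (r zero ◁ r′ ∘ suc) + c zero * z) (kill _ zero (λ _ → refl)) ⟩
  1ℤ * F (r zero ◁ r′ ∘ suc) + c zero * 0ℤ          ≡⟨ lem (F (r zero ◁ r′ ∘ suc)) (c zero) ⟩
  F (r zero ◁ r′ ∘ suc)                             ≡⟨ absorb n (tail-alternating A (r zero)) x (λ s i → kill (r zero ◁ s) (suc i)) (r ∘ suc) (c ∘ suc) ⟩
  F (r zero ◁ r ∘ suc)                              ≡⟨ A .≈-resp (λ { zero k → refl ; (suc i) k → refl }) ⟩
  F r                                               ∎
  where
  open ≡-Reasoning
  r′ = λ i k → r i k + c i * x k
  lem : ∀ a b → 1ℤ * a + b * 0ℤ ≡ a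
  lem = solve-∀

-- Polarisation: the value with x + y in both of the first two rows is zero, and so are the two
-- diagonal terms of its expansion.
cons-swap : ∀ {n p} {F : Rows (suc (suc n)) p → ℤ} → Alternating F → ∀ x y (r : Rows n p) →
            F (x ◁ y ◁ r) ≡ - F (y ◁ x ◁ r)
cons-swap {F = F} A x y r =
  trans (lem (F (x ◁ y ◁ r)) (F (y ◁ x ◁ r)))
        (trans (cong (_+ (- F (y ◁ x ◁ r))) (trans (sym e) (A .alt zero (suc zero) (λ ()) (λ _ → refl))))
               (ℤₚ.+-identityˡ _))
  where
  z = λ k → x k + y k
  split : ∀ k → z k ≡ 1ℤ * x k + 1ℤ * y k
  split k = lem₁ (x k) (y k)
    where lem₁ : ∀ a b → a + b ≡ 1ℤ * a + 1ℤ * b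
          lem₁ = solve-∀
  lem : ∀ a b → a ≡ (a + b) + (- b)
  lem = solve-∀
  lem₂ : ∀ a b → 1ℤ * (1ℤ * 0ℤ + 1ℤ * a) + 1ℤ * (1ℤ * b + 1ℤ * 0ℤ) ≡ a + b
  lem₂ = solve-∀
  vanish : ∀ x → F (x ◁ x ◁ r) ≡ 0ℤ
  vanish x = A .alt zero (suc zero) (λ ()) (λ _ → refl)
  e : F (z ◁ z ◁ r) ≡ F (x ◁ y ◁ r) + F (y ◁ x ◁ r)
  e = trans (cons-lin A x y (z ◁ r) 1ℤ 1ℤ split)
     (trans (cong₂ (λ a b → 1ℤ * a + 1ℤ * b)
              (trans (cons-lin (tail-alternating A x) x y r 1ℤ 1ℤ split) (cong (λ a → 1ℤ * a + 1ℤ * F (x ◁ y ◁ r)) (vanish x)))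
              (trans (cons-lin (tail-alternating A y) x y r 1ℤ 1ℤ split) (cong (λ a → 1ℤ * F (y ◁ x ◁ r) + 1ℤ * a) (vanish y))))
            (lem₂ (F (x ◁ y ◁ r)) (F (y ◁ x ◁ r))))

-- Row `j` reaches the top by `j` adjacent exchanges; the resulting sign is the one in the
-- definition of `det`.
cons-punchIn : ∀ {n p} {F : Rows (suc n) p → ℤ} → Alternating F → ∀ (w : Rows (suc n) p) j →
               F (w j ◁ w ∘ punchIn j) ≡ sign (toℕ j) * F w
cons-punchIn {F = F} A w zero =
  trans (A .≈-resp (λ { zero k → refl ; (suc i) k → refl })) (sym (ℤₚ.*-identityˡ _))
cons-punchIn {suc n} {F = F} A w (suc j) = begin
  F (w (suc j) ◁ w ∘ punchIn (suc j))
    ≡⟨ A .≈-resp (λ { zero k → refl ; (suc zero) k → refl ; (suc (suc i)) k → refl }) ⟩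
  F (w (suc j) ◁ w zero ◁ w ∘ suc ∘ punchIn j)
    ≡⟨ cons-swap A (w (suc j)) (w zero) _ ⟩
  - F (w zero ◁ w (suc j) ◁ w ∘ suc ∘ punchIn j)
    ≡⟨ cong -_ (cons-punchIn (tail-alternating A (w zero)) (w ∘ suc) j) ⟩
  - (sign (toℕ j) * F (w zero ◁ w ∘ suc))
    ≡⟨ ℤₚ.neg-distribˡ-* (sign (toℕ j)) _ ⟩
  - sign (toℕ j) * F (w zero ◁ w ∘ suc)
    ≡⟨ cong (- sign (toℕ j) *_) (A .≈-resp (λ { zero k → refl ; (suc i) k → refl })) ⟩
  - sign (toℕ j) * F w ∎
  where open ≡-Reasoning

-- Uniqueness of alternating forms, for arbitrary `F` so that the induction can pass to `F` with a
-- frozen row. Once the first row of `C ⊗ w` is expanded, `w j` on top absorbs the multiples of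
-- `w j` in the other rows, and what remains is a product with the minor that `det` itself uses.
alternating-⊗ : ∀ n {p} {F : Rows n p → ℤ} → Alternating F → ∀ (C : Rows n n) (w : Rows n p) →
                F (C ⊗ w) ≡ det n C * F w
alternating-⊗ zero A C w = trans (A .≈-resp (λ ())) (sym (ℤₚ.*-identityˡ _))
alternating-⊗ (suc n) {F = F} A C w = begin
  F (C ⊗ w)
    ≡⟨ A .≈-resp (λ { zero k → refl ; (suc i) k → refl }) ⟩
  F ((C ⊗ w) zero ◁ (C ⊗ w) ∘ suc)
    ≡⟨ cons-sum A (suc n) (C zero) w _ ⟩
  sumFin (suc n) (λ j → C zero j * F (w j ◁ (C ⊗ w) ∘ suc))
    ≡⟨ sum-cong (suc n) term ⟩
  sumFin (suc n) (λ j → F w * (sign (toℕ j) * C zero j * det n (minor j)))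
    ≡⟨ sum-*ˡ (suc n) (F w) (λ j → sign (toℕ j) * C zero j * det n (minor j)) ⟩
  F w * det (suc n) C
    ≡⟨ ℤₚ.*-comm (F w) _ ⟩
  det (suc n) C * F w ∎
  where
  open ≡-Reasoning
  minor : ∀ j → Rows n n
  minor j i k = C (suc i) (punchIn j k)
  lem : ∀ a s m f → a * (m * (s * f)) ≡ f * (s * a * m)
  lem = solve-∀
  term : ∀ j → C zero j * F (w j ◁ (C ⊗ w) ∘ suc) ≡ F w * (sign (toℕ j) * C zero j * det n (minor j))
  term j = trans (cong (C zero j *_) (begin
    F (w j ◁ (C ⊗ w) ∘ suc)
      ≡⟨ tail-alternating A (w j) .≈-resp (λ i k → trans (sum-punchIn n j (λ l → C (suc i) l * w l k)) (ℤₚ.+-comm (C (suc i) j * w j k) ((minor j ⊗ w ∘ punchIn j) i k))) ⟩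
    F (w j ◁ (λ i k → (minor j ⊗ w ∘ punchIn j) i k + C (suc i) j * w j k))
      ≡⟨ absorb n (tail-alternating A (w j)) (w j) (λ r i e → A .alt zero (suc i) (λ ()) (λ k → sym (e k))) (minor j ⊗ w ∘ punchIn j) (λ i → C (suc i) j) ⟩
    F (w j ◁ (minor j ⊗ w ∘ punchIn j))
      ≡⟨ alternating-⊗ n (tail-alternating A (w j)) (minor j) (w ∘ punchIn j) ⟩
    det n (minor j) * F (w j ◁ w ∘ punchIn j)
      ≡⟨ cong (det n (minor j) *_) (cons-punchIn A w j) ⟩
    det n (minor j) * (sign (toℕ j) * F w) ∎)) (lem (C zero j) (sign (toℕ j)) _ (F w))

-- The determinant is alternating

det-cong : ∀ n {A B : Rows n n} → A ≈ B → det n A ≡ det n B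
det-cong zero    e = refl
det-cong (suc n) e = sum-cong (suc n) λ j →
  cong₂ _*_ (cong (sign (toℕ j) *_) (e zero j)) (det-cong n (λ i k → e (suc i) (punchIn j k)))

det-lin : ∀ n {r : Rows n n} s t i a b → (∀ k → k ≢ i → ∀ j → r k j ≡ s k j) →
          (∀ k → k ≢ i → ∀ j → r k j ≡ t k j) →
          (∀ j → r i j ≡ a * s i j + b * t i j) → det n r ≡ a * det n s + b * det n t
det-lin (suc n) {r} s t zero a b e f g = sum-lin (suc n) a b λ j → begin
  sign (toℕ j) * r zero j * det n (λ i k → r (suc i) (punchIn j k))
    ≡⟨ cong (λ z → sign (toℕ j) * z * det n (λ i k → r (suc i) (punchIn j k))) (g j) ⟩
  sign (toℕ j) * (a * s zero j + b * t zero j) * det n (λ i k → r (suc i) (punchIn j k))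
    ≡⟨ lem (sign (toℕ j)) a b (s zero j) (t zero j) _ ⟩
  a * (sign (toℕ j) * s zero j * det n (λ i k → r (suc i) (punchIn j k))) +
  b * (sign (toℕ j) * t zero j * det n (λ i k → r (suc i) (punchIn j k)))
    ≡⟨ cong₂ (λ x y → a * (sign (toℕ j) * s zero j * x) + b * (sign (toℕ j) * t zero j * y))
         (det-cong n (λ i k → e (suc i) (λ ()) (punchIn j k)))
         (det-cong n (λ i k → f (suc i) (λ ()) (punchIn j k))) ⟩
  _ ∎
  where
  open ≡-Reasoning
  lem : ∀ σ a b x y m → σ * (a * x + b * y) * m ≡ a * (σ * x * m) + b * (σ * y * m)
  lem = solve-∀
det-lin (suc n) {r} s t (suc i) a b e f g = sum-lin (suc n) a b λ j → begin
  sign (toℕ j) * r zero j * det n (λ i k → r (suc i) (punchIn j k))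
    ≡⟨ cong (sign (toℕ j) * r zero j *_)
         (det-lin n (λ i k → s (suc i) (punchIn j k)) (λ i k → t (suc i) (punchIn j k)) i a b
           (λ k k≢i l → e (suc k) (k≢i ∘ Finₚ.suc-injective) (punchIn j l))
           (λ k k≢i l → f (suc k) (k≢i ∘ Finₚ.suc-injective) (punchIn j l))
           (λ l → g (punchIn j l))) ⟩
  sign (toℕ j) * r zero j * (a * det n (λ i k → s (suc i) (punchIn j k)) + b * det n (λ i k → t (suc i) (punchIn j k)))
    ≡⟨ lem (sign (toℕ j)) (r zero j) a b _ _ ⟩
  a * (sign (toℕ j) * r zero j * det n (λ i k → s (suc i) (punchIn j k))) +
  b * (sign (toℕ j) * r zero j * det n (λ i k → t (suc i) (punchIn j k)))
    ≡⟨ cong₂ (λ x y → a * (sign (toℕ j) * x * det n (λ i k → s (suc i) (punchIn j k))) +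
                      b * (sign (toℕ j) * y * det n (λ i k → t (suc i) (punchIn j k))))
         (e zero (λ ()) j) (f zero (λ ()) j) ⟩
  _ ∎
  where
  open ≡-Reasoning
  lem : ∀ σ x a b m l → σ * x * (a * m + b * l) ≡ a * (σ * x * m) + b * (σ * x * l)
  lem = solve-∀

punchIn-punchOut-comm : ∀ {n} {a b : Fin (suc (suc n))} (p : a ≢ b) (q : b ≢ a) (l : Fin n) →
  punchIn a (punchIn (punchOut p) l) ≡ punchIn b (punchIn (punchOut q) l)
punchIn-punchOut-comm {a = zero}  {zero}  p q l = ⊥-elim (p refl)
punchIn-punchOut-comm {a = zero}  {suc b} p q l = refl
punchIn-punchOut-comm {a = suc a} {zero}  p q l = refl
punchIn-punchOut-comm {suc n} {suc a} {suc b} p q zero    = refl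
punchIn-punchOut-comm {suc n} {suc a} {suc b} p q (suc l) =
  cong suc (punchIn-punchOut-comm (p ∘ cong suc) (q ∘ cong suc) l)

-- The larger of the two columns loses one when the smaller is removed, while the smaller keeps its
-- index. So the two orders of choosing them have exponents that differ by one.
sign-punchOut-anti : ∀ {n} {a b : Fin (suc (suc n))} (p : a ≢ b) (q : b ≢ a) →
  sign (toℕ a) * sign (toℕ (punchOut p)) ≡ - (sign (toℕ b) * sign (toℕ (punchOut q)))
sign-punchOut-anti {a = zero}  {zero}  p q = ⊥-elim (p refl)
sign-punchOut-anti {a = zero}  {suc b} p q = lem (sign (toℕ b))
  where lem : ∀ x → 1ℤ * x ≡ - (- x * 1ℤ)
        lem = solve-∀
sign-punchOut-anti {a = suc a} {zero}  p q = lem (sign (toℕ a))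
  where lem : ∀ x → - x * 1ℤ ≡ - (1ℤ * x)
        lem = solve-∀
sign-punchOut-anti {zero}  {suc zero} {suc zero} p q = ⊥-elim (p refl)
sign-punchOut-anti {suc n} {suc a} {suc b} p q =
  trans (lem (sign (toℕ a)) _)
        (trans (sign-punchOut-anti (p ∘ cong suc) (q ∘ cong suc)) (cong -_ (sym (lem (sign (toℕ b)) _))))
  where lem : ∀ x y → - x * - y ≡ x * y
        lem = solve-∀

self-neg⇒0 : ∀ {x : ℤ} → x ≡ - x → x ≡ 0ℤ
self-neg⇒0 {ℤ.+ zero} e = refl
self-neg⇒0 {ℤ.+ suc n} ()
self-neg⇒0 {ℤ.-[1+ n ]} ()

-- Expanding along the first two rows gives a sum over pairs of columns whose
-- coefficients are antisymmetric.
det-alt₀₁ : ∀ n (A : Rows (suc (suc n)) (suc (suc n))) → (∀ k → A zero k ≡ A (suc zero) k) →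
            det (suc (suc n)) A ≡ 0ℤ
det-alt₀₁ n A e = trans expand (self-neg⇒0 S-anti)
  where
  open ≡-Reasoning
  N = suc (suc n)
  u = A zero
  m : Fin N → Fin (suc n) → ℤ
  m a k = det n (λ i l → A (suc (suc i)) (punchIn a (punchIn k l)))
  -- Extending the coefficients by zero to the diagonal turns the double expansion into a sum over
  -- all pairs of columns, on which exchanging `a` and `b` acts.
  c : Fin N → Fin N → ℤ
  c a b with a Fin.≟ b
  ... | yes _ = 0ℤ
  ... | no p  = sign (toℕ a) * sign (toℕ (punchOut p)) * m a (punchOut p)
  c-diag : ∀ a → c a a ≡ 0ℤ
  c-diag a with a Fin.≟ a
  ... | yes _ = refl
  ... | no p  = ⊥-elim (p refl)
  c-punchIn : ∀ a k → c a (punchIn a k) ≡ sign (toℕ a) * sign (toℕ k) * m a k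
  c-punchIn a k with a Fin.≟ punchIn a k
  ... | yes q = ⊥-elim (Finₚ.punchInᵢ≢i a k (sym q))
  ... | no p  = cong (λ z → sign (toℕ a) * sign (toℕ z) * m a z)
                  (trans (Finₚ.punchOut-cong a {i≢j = p} {i≢k = λ q → Finₚ.punchInᵢ≢i a k (sym q)} refl)
                         (Finₚ.punchOut-punchIn a))
  c-anti : ∀ a b → c a b ≡ - c b a
  c-anti a b with a Fin.≟ b | b Fin.≟ a
  ... | yes _ | yes _ = refl
  ... | yes p | no q  = ⊥-elim (q (sym p))
  ... | no p  | yes q = ⊥-elim (p (sym q))
  ... | no p  | no q  = begin
    sign (toℕ a) * sign (toℕ (punchOut p)) * m a (punchOut p)
      ≡⟨ cong₂ _*_ (sign-punchOut-anti p q)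
           (det-cong n (λ i l → cong (A (suc (suc i))) (punchIn-punchOut-comm p q l))) ⟩
    - (sign (toℕ b) * sign (toℕ (punchOut q))) * m b (punchOut q)
      ≡⟨ sym (ℤₚ.neg-distribˡ-* (sign (toℕ b) * sign (toℕ (punchOut q))) _) ⟩
    - (sign (toℕ b) * sign (toℕ (punchOut q)) * m b (punchOut q)) ∎
  S = sumFin N (λ a → sumFin N (λ b → u a * u b * c a b))
  lem₀ : ∀ x y → x * y * 0ℤ ≡ 0ℤ
  lem₀ = solve-∀
  lem₁ : ∀ s x t y m → (s * x) * (t * y * m) ≡ x * y * (s * t * m)
  lem₁ = solve-∀
  expand : det N A ≡ S
  expand = sum-cong N λ a → begin
    sign (toℕ a) * u a * sumFin (suc n) (λ k → sign (toℕ k) * A (suc zero) (punchIn a k) * m a k)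
      ≡⟨ sym (sum-*ˡ (suc n) (sign (toℕ a) * u a) (λ k → sign (toℕ k) * A (suc zero) (punchIn a k) * m a k)) ⟩
    sumFin (suc n) (λ k → sign (toℕ a) * u a * (sign (toℕ k) * A (suc zero) (punchIn a k) * m a k))
      ≡⟨ sum-cong (suc n) (λ k → trans (lem₁ (sign (toℕ a)) (u a) (sign (toℕ k)) _ (m a k))
           (cong₂ (λ x y → u a * x * y) (sym (e (punchIn a k))) (sym (c-punchIn a k)))) ⟩
    sumFin (suc n) (λ k → u a * u (punchIn a k) * c a (punchIn a k))
      ≡⟨ sym (ℤₚ.+-identityˡ _) ⟩
    0ℤ + sumFin (suc n) (λ k → u a * u (punchIn a k) * c a (punchIn a k))
      ≡⟨ cong (_+ sumFin (suc n) (λ k → u a * u (punchIn a k) * c a (punchIn a k)))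
           (sym (trans (cong (u a * u a *_) (c-diag a)) (lem₀ (u a) (u a)))) ⟩
    u a * u a * c a a + sumFin (suc n) (λ k → u a * u (punchIn a k) * c a (punchIn a k))
      ≡⟨ sym (sum-punchIn (suc n) a (λ b → u a * u b * c a b)) ⟩
    sumFin N (λ b → u a * u b * c a b) ∎
  lem₂ : ∀ x y z → x * y * - z ≡ ℤ.-1ℤ * (y * x * z)
  lem₂ = solve-∀
  S-anti : S ≡ - S
  S-anti = begin
    S ≡⟨ sum-cong N (λ a → trans (sum-cong N (λ b → trans (cong (u a * u b *_) (c-anti a b)) (lem₂ (u a) (u b) (c b a))))
                                 (sum-*ˡ N ℤ.-1ℤ (λ b → u b * u a * c b a))) ⟩
    sumFin N (λ a → ℤ.-1ℤ * sumFin N (λ b → u b * u a * c b a)) ≡⟨ sum-*ˡ N ℤ.-1ℤ (λ a → sumFin N (λ b → u b * u a * c b a)) ⟩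
    ℤ.-1ℤ * sumFin N (λ a → sumFin N (λ b → u b * u a * c b a)) ≡⟨ cong (ℤ.-1ℤ *_) (sum-swap N N (λ a b → u b * u a * c b a)) ⟩
    ℤ.-1ℤ * S ≡⟨ ℤₚ.-1*i≡-i S ⟩
    - S ∎

infix 6 _[_≔_]
_[_≔_] : ∀ {n p} → Rows n p → Fin n → (Fin p → ℤ) → Rows n p
(A [ i ≔ v ]) k = if does (k Fin.≟ i) then v else A k

≔-at : ∀ {n p} (A : Rows n p) i v → (A [ i ≔ v ]) i ≡ v
≔-at A i v rewrite dec-true (i Fin.≟ i) refl = refl

≔-off : ∀ {n p} (A : Rows n p) i v k → k ≢ i → (A [ i ≔ v ]) k ≡ A k
≔-off A i v k k≢i rewrite dec-false (k Fin.≟ i) k≢i = refl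

DetAlt : ℕ → Set
DetAlt n = ∀ (r : Rows n n) i j → i ≢ j → (∀ k → r i k ≡ r j k) → det n r ≡ 0ℤ

det-altₛ : ∀ n → DetAlt n → ∀ (r : Rows (suc n) (suc n)) i j → i ≢ j →
           (∀ k → r (suc i) k ≡ r (suc j) k) → det (suc n) r ≡ 0ℤ
det-altₛ n ih r i j i≢j e = sum-0 (suc n) λ l →
  trans (cong (sign (toℕ l) * r zero l *_)
          (ih (λ i k → r (suc i) (punchIn l k)) i j i≢j (λ k → e (punchIn l k))))
        (ℤₚ.*-zeroʳ (sign (toℕ l) * r zero l))

det-alt₀ : ∀ n → DetAlt n → ∀ (r : Rows (suc n) (suc n)) j → (∀ k → r zero k ≡ r (suc j) k) →
           det (suc n) r ≡ 0ℤ
det-alt₀ (suc n) ih r zero    e = det-alt₀₁ n r e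
-- With x in rows 0 and j and y in row 1: replacing both rows 1 and j by x + y
-- gives 0, and three of the four terms of the expansion vanish.
det-alt₀ (suc n) ih r (suc j) e = begin
  D r                                ≡⟨ det-cong _ r≈ ⟩
  D (R y x)                          ≡⟨ lem (D (R y x)) ⟩
  1ℤ * (1ℤ * D (R y x) + 1ℤ * 0ℤ) + 1ℤ * 0ℤ
    ≡⟨ cong₂ (λ a b → 1ℤ * (1ℤ * D (R y x) + 1ℤ * a) + 1ℤ * b) (sym (alt₁ⱼ y)) (sym (det-alt₀₁ n (R x z) (λ _ → refl))) ⟩
  1ℤ * (1ℤ * D (R y x) + 1ℤ * D (R y y)) + 1ℤ * D (R x z)
    ≡⟨ cong (λ a → 1ℤ * a + 1ℤ * D (R x z)) (sym (det-lin _ (R y x) (R y y) j′ 1ℤ 1ℤ (offⱼ z x) (offⱼ z y)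
         (λ k → trans (atⱼ y z k) (trans (split′ k) (cong₂ (λ a b → 1ℤ * a + 1ℤ * b) (sym (atⱼ y x k)) (sym (atⱼ y y k))))))) ⟩
  1ℤ * D (R y z) + 1ℤ * D (R x z)
    ≡⟨ sym (det-lin _ (R y z) (R x z) (suc zero) 1ℤ 1ℤ off₁ off₁ split) ⟩
  D (R z z)                          ≡⟨ alt₁ⱼ z ⟩
  0ℤ ∎
  where
  open ≡-Reasoning
  D = det (suc (suc n))
  j′ = suc (suc j)
  x = r zero
  y = r (suc zero)
  z = λ k → y k + x k
  R : (a b : Fin (suc (suc n)) → ℤ) → Rows (suc (suc n)) (suc (suc n))
  R a b = x ◁ a ◁ ((λ i → r (suc (suc i))) [ j ≔ b ])
  lem : ∀ a → a ≡ 1ℤ * (1ℤ * a + 1ℤ * 0ℤ) + 1ℤ * 0ℤ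
  lem = solve-∀
  split : ∀ k → y k + x k ≡ 1ℤ * y k + 1ℤ * x k
  split k = lem₁ (y k) (x k)
    where lem₁ : ∀ a b → a + b ≡ 1ℤ * a + 1ℤ * b
          lem₁ = solve-∀
  split′ : ∀ k → z k ≡ 1ℤ * x k + 1ℤ * y k
  split′ k = lem₁ (y k) (x k)
    where lem₁ : ∀ a b → a + b ≡ 1ℤ * b + 1ℤ * a
          lem₁ = solve-∀
  atⱼ : ∀ a b k → R a b j′ k ≡ b k
  atⱼ a b k = cong (λ f → f k) (≔-at (λ i → r (suc (suc i))) j b)
  alt₁ⱼ : ∀ a → D (R a a) ≡ 0ℤ
  alt₁ⱼ a = det-altₛ (suc n) ih (R a a) zero (suc j) (λ ()) (λ k → sym (atⱼ a a k))
  off₁ : ∀ {a} k → k ≢ suc zero → ∀ l → R z z k l ≡ R a z k l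
  off₁ zero          _ l = refl
  off₁ (suc zero)    p l = ⊥-elim (p refl)
  off₁ (suc (suc k)) _ l = refl
  offⱼ : ∀ b c k → k ≢ j′ → ∀ l → R y b k l ≡ R y c k l
  offⱼ b c zero          p l = refl
  offⱼ b c (suc zero)    p l = refl
  offⱼ b c (suc (suc k)) p l = cong (λ f → f l)
    (trans (≔-off (λ i → r (suc (suc i))) j b k (λ q → p (cong (λ i → suc (suc i)) q))) (sym (≔-off (λ i → r (suc (suc i))) j c k (λ q → p (cong (λ i → suc (suc i)) q)))))
  r≈ : r ≈ R y x
  r≈ zero l = refl
  r≈ (suc zero) l = refl
  r≈ (suc (suc k)) l with k Fin.≟ j
  ... | yes refl = sym (e l)
  ... | no  _    = refl

det-alt : ∀ n → DetAlt n
det-alt (suc n) r zero    zero    i≢j e = ⊥-elim (i≢j refl)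
det-alt (suc n) r zero    (suc j) i≢j e = det-alt₀ n (det-alt n) r j e
det-alt (suc n) r (suc i) zero    i≢j e = det-alt₀ n (det-alt n) r i (sym ∘ e)
det-alt (suc n) r (suc i) (suc j) i≢j e = det-altₛ n (det-alt n) r i j (i≢j ∘ cong suc) e

det-alternating : ∀ n → Alternating (det n)
det-alternating n .≈-resp = det-cong n
det-alternating n .lin = det-lin n
det-alternating n .alt {r} = det-alt n r

-- Products, scalings and row operations

det-⊗ : ∀ n (C A : Rows n n) → det n (C ⊗ A) ≡ det n C * det n A
det-⊗ n = alternating-⊗ n (det-alternating n)

prodFin : ∀ n → (Fin n → ℤ) → ℤ
prodFin zero    f = 1ℤ
prodFin (suc n) f = f zero * prodFin n (f ∘ suc)

prodFin-const : ∀ n a → prodFin n (λ _ → a) ≡ a ℤ.^ n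
prodFin-const zero    a = refl
prodFin-const (suc n) a = cong (a *_) (prodFin-const n a)

det-row-scale : ∀ n (f : Fin n → ℤ) (A : Rows n n) → det n (λ i k → f i * A i k) ≡ prodFin n f * det n A
det-row-scale zero    f A = refl
det-row-scale (suc n) f A = trans (sum-cong (suc n) λ j → trans
    (cong (sign (toℕ j) * (f zero * A zero j) *_) (det-row-scale n (f ∘ suc) (λ i k → A (suc i) (punchIn j k))))
    (lem (sign (toℕ j)) (f zero) (A zero j) (prodFin n (f ∘ suc)) _))
  (sum-*ˡ (suc n) (f zero * prodFin n (f ∘ suc)) (λ j → sign (toℕ j) * A zero j * det n (λ i k → A (suc i) (punchIn j k))))
  where lem : ∀ s a x p m → s * (a * x) * (p * m) ≡ a * p * (s * x * m)
        lem = solve-∀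

det-scale : ∀ n a (A : Rows n n) → det n (λ i k → a * A i k) ≡ a ℤ.^ n * det n A
det-scale n a A = trans (det-row-scale n (λ _ → a) A) (cong (_* det n A) (prodFin-const n a))

det-row₀ : ∀ n (A : Rows (suc n) (suc n)) → (∀ j → A zero (suc j) ≡ 0ℤ) →
           det (suc n) A ≡ A zero zero * det n (λ i k → A (suc i) (suc k))
det-row₀ n A e = trans (sum-single (suc n) zero {λ j → sign (toℕ j) * A zero j * det n (λ i k → A (suc i) (punchIn j k))} λ
    { zero    p → ⊥-elim (p refl)
    ; (suc j) _ → trans (cong (λ z → sign (toℕ (suc j)) * z * det n (λ i k → A (suc i) (punchIn (suc j) k))) (e j)) (lem (sign (toℕ (suc j))) _) })
  (cong (_* det n (λ i k → A (suc i) (suc k))) (ℤₚ.*-identityˡ (A zero zero)))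
  where lem : ∀ s m → s * 0ℤ * m ≡ 0ℤ
        lem = solve-∀

δ : ∀ {n} → Rows n n
δ zero    zero    = 1ℤ
δ zero    (suc j) = 0ℤ
δ (suc i) zero    = 0ℤ
δ (suc i) (suc j) = δ i j

δ-diag : ∀ {n} (i : Fin n) → δ i i ≡ 1ℤ
δ-diag zero    = refl
δ-diag (suc i) = δ-diag i

δ-off : ∀ {n} {i j : Fin n} → i ≢ j → δ i j ≡ 0ℤ
δ-off {i = zero}  {zero}  p = ⊥-elim (p refl)
δ-off {i = zero}  {suc j} p = refl
δ-off {i = suc i} {zero}  p = refl
δ-off {i = suc i} {suc j} p = δ-off (p ∘ cong suc)

sum-δ : ∀ n (f : Fin n → ℤ) k → sumFin n (λ j → f j * δ j k) ≡ f k
sum-δ n f k = trans (sum-single n k λ i p → trans (cong (f i *_) (δ-off p)) (ℤₚ.*-zeroʳ (f i)))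
                    (trans (cong (f k *_) (δ-diag k)) (ℤₚ.*-identityʳ (f k)))

det-δ : ∀ n → det n δ ≡ 1ℤ
det-δ zero    = refl
det-δ (suc n) = trans (det-row₀ n δ (λ _ → refl)) (trans (ℤₚ.*-identityˡ _) (det-δ n))

lin-sum : ∀ {n p} {F : Rows n p → ℤ} → Alternating F → ∀ m (A : Rows n p) i (c : Fin m → ℤ) (v : Rows m p) →
          F (A [ i ≔ (λ k → sumFin m (λ j → c j * v j k)) ]) ≡ sumFin m (λ j → c j * F (A [ i ≔ v j ]))
lin-sum {F = F} 𝔸 zero A i c v = 𝔸 .lin A A i 0ℤ 0ℤ off off (λ j → cong (λ f → f j) (≔-at A i (λ _ → 0ℤ)))
  where off : ∀ k → k ≢ i → ∀ j → (A [ i ≔ (λ _ → 0ℤ) ]) k j ≡ A k j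
        off k p j = cong (λ f → f j) (≔-off A i _ k p)
lin-sum {F = F} 𝔸 (suc m) A i c v =
  trans (𝔸 .lin (A [ i ≔ v zero ]) (A [ i ≔ w ]) i (c zero) 1ℤ (off (v zero)) (off w) at)
        (trans (cong (λ z → c zero * F (A [ i ≔ v zero ]) + 1ℤ * z) (lin-sum 𝔸 m A i (c ∘ suc) (v ∘ suc)))
               (cong (_+_ (c zero * F (A [ i ≔ v zero ]))) (ℤₚ.*-identityˡ _)))
  where
  w = λ k → sumFin m (λ j → c (suc j) * v (suc j) k)
  u = λ k → sumFin (suc m) (λ j → c j * v j k)
  off : ∀ x k → k ≢ i → ∀ j → (A [ i ≔ u ]) k j ≡ (A [ i ≔ x ]) k j
  off x k p j = cong (λ f → f j) (trans (≔-off A i u k p) (sym (≔-off A i x k p)))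
  at : ∀ j → (A [ i ≔ u ]) i j ≡ c zero * (A [ i ≔ v zero ]) i j + 1ℤ * (A [ i ≔ w ]) i j
  at j rewrite ≔-at A i u | ≔-at A i (v zero) | ≔-at A i w =
    cong (_+_ (c zero * v zero j)) (sym (ℤₚ.*-identityˡ (w j)))

det-row-replace : ∀ n (A B : Rows n n) i (c : Fin n → ℤ) → c i ≡ 1ℤ →
  (∀ k → k ≢ i → ∀ j → B k j ≡ A k j) → (∀ j → B i j ≡ sumFin n (λ d → c d * A d j)) →
  det n B ≡ det n A
det-row-replace n A B i c cᵢ off at = begin
  det n B                                            ≡⟨ det-cong n B≈ ⟩
  det n (A [ i ≔ (λ j → sumFin n (λ d → c d * A d j)) ]) ≡⟨ lin-sum (det-alternating n) n A i c A ⟩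
  sumFin n (λ d → c d * det n (A [ i ≔ A d ]))       ≡⟨ sum-single n i (λ d p → trans (cong (c d *_) (vanish d p)) (ℤₚ.*-zeroʳ (c d))) ⟩
  c i * det n (A [ i ≔ A i ])                        ≡⟨ cong₂ _*_ cᵢ (det-cong n same) ⟩
  1ℤ * det n A                                       ≡⟨ ℤₚ.*-identityˡ _ ⟩
  det n A                                            ∎
  where
  open ≡-Reasoning
  B≈ : B ≈ (A [ i ≔ (λ j → sumFin n (λ d → c d * A d j)) ])
  B≈ k j with k Fin.≟ i
  ... | yes refl = at j
  ... | no p     = off k p j
  same : (A [ i ≔ A i ]) ≈ A
  same k j with k Fin.≟ i
  ... | yes refl = refl
  ... | no p     = refl
  vanish : ∀ d → d ≢ i → det n (A [ i ≔ A d ]) ≡ 0ℤ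
  vanish d p = det-alt n _ d i p (λ k → cong (λ f → f k)
    (trans (≔-off A i (A d) d p) (sym (≔-at A i (A d)))))

-- Unitriangular matrices

-- Triangularity refers to the rank `ρ`, not to the order of the indices. Unit rows are put in by
-- increasing rank: the row of rank `s` involves, besides itself, only rows of smaller rank, which
-- are unit rows already. Injectivity of `ρ` makes one row change at a time.
module Unitriangular (n : ℕ) (U : Rows n n) (ρ : Fin n → ℕ) (ρ-inj : ∀ c d → ρ c ≡ ρ d → c ≡ d)
  (U-diag : ∀ c → U c c ≡ 1ℤ) (U-off : ∀ c d → c ≢ d → ¬ (ρ d < ρ c) → U c d ≡ 0ℤ) where

  cleared : ℕ → Rows n n
  cleared s c = if does (ρ c ℕ.<? s) then δ c else U c

  cleared-< : ∀ s c → ρ c < s → cleared s c ≡ δ c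
  cleared-< s c p rewrite dec-true (ρ c ℕ.<? s) p = refl

  cleared-≮ : ∀ s c → ¬ (ρ c < s) → cleared s c ≡ U c
  cleared-≮ s c p rewrite dec-false (ρ c ℕ.<? s) p = refl

  cleared-suc : ∀ s c → ρ c ≢ s → cleared s c ≡ cleared (suc s) c
  cleared-suc s c p with ρ c ℕ.<? s
  ... | yes q = trans (cleared-< s c q) (sym (cleared-< (suc s) c (ℕₚ.m<n⇒m<1+n q)))
  ... | no q  = trans (cleared-≮ s c q) (sym (cleared-≮ (suc s) c (λ r → q (ℕₚ.≤∧≢⇒< (ℕₚ.≤-pred r) p))))

  det-cleared-suc : ∀ s → det n (cleared s) ≡ det n (cleared (suc s))
  det-cleared-suc s with Finₚ.any? (λ c → ρ c ℕ.≟ s)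
  ... | no none = det-cong n λ c j → cong (λ f → f j) (cleared-suc s c (λ e → none (c , e)))
  ... | yes (c , refl) = det-row-replace n (cleared (suc s)) (cleared s) c (U c) (U-diag c)
        (λ k p j → cong (λ f → f j) (cleared-suc s k (p ∘ ρ-inj k c)))
        (λ j → trans (cong (λ f → f j) (cleared-≮ s c (ℕₚ.<-irrefl refl)))
                     (trans (sym (sum-δ n (U c) j)) (sum-cong n (λ d → sym (term j d)))))
    where
    term : ∀ j d → U c d * cleared (suc s) d j ≡ U c d * δ d j
    term j d with ρ d ℕ.<? suc s
    ... | yes p = cong (λ f → U c d * f j) (cleared-< (suc s) d p)
    ... | no p  = trans (cong (_* cleared (suc s) d j) z) (cong (_* δ d j) (sym z))
      where z = U-off c d (λ { refl → p ℕₚ.≤-refl }) (λ q → p (ℕₚ.m<n⇒m<1+n q))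

  det-cleared : ∀ s → det n U ≡ det n (cleared s)
  det-cleared zero    = refl
  det-cleared (suc s) = trans (det-cleared s) (det-cleared-suc s)

  det≡1 : det n U ≡ 1ℤ
  det≡1 with bound n ρ
    where
    bound : ∀ n (ρ : Fin n → ℕ) → ∃ λ b → ∀ c → ρ c < b
    bound zero ρ = 0 , λ ()
    bound (suc n) ρ with bound n (ρ ∘ suc)
    ... | b , p = suc (ρ zero ℕ.+ b) , λ
      { zero → s≤s (ℕₚ.m≤m+n _ _) ; (suc c) → ℕₚ.≤-trans (p c) (ℕₚ.m≤n⇒m≤1+n (ℕₚ.m≤n+m _ _)) }
  ... | b , p = trans (det-cleared b) (trans (det-cong n (λ c j → cong (λ f → f j) (cleared-< b c (p c)))) (det-δ n))

det-unitriangular : ∀ n (U : Rows n n) (ρ : Fin n → ℕ) → (∀ c → U c c ≡ 1ℤ) →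
  (∀ c d → c ≢ d → ¬ (ρ d < ρ c) → U c d ≡ 0ℤ) → det n U ≡ 1ℤ
det-unitriangular n U ρ diag off =
  Unitriangular.det≡1 n U key key-inj diag (λ c d p q → off c d p (λ r → q (key-mono d c r)))
  where
  key : Fin n → ℕ
  -- The lexicographic order on (ρ c, c), because `toℕ c` is below `n`; ties in `ρ` are broken by
  -- the index.
  key c = ρ c ℕ.* n ℕ.+ toℕ c
  key-mono : ∀ c d → ρ c < ρ d → key c < key d
  key-mono c d p = begin-strict
    ρ c ℕ.* n ℕ.+ toℕ c <⟨ ℕₚ.+-monoʳ-< (ρ c ℕ.* n) (Finₚ.toℕ<n c) ⟩
    ρ c ℕ.* n ℕ.+ n     ≡⟨ ℕₚ.+-comm (ρ c ℕ.* n) n ⟩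
    suc (ρ c) ℕ.* n     ≤⟨ ℕₚ.*-monoˡ-≤ n p ⟩
    ρ d ℕ.* n           ≤⟨ ℕₚ.m≤m+n _ _ ⟩
    key d               ∎
    where open ℕₚ.≤-Reasoning
  key-inj : ∀ c d → key c ≡ key d → c ≡ d
  key-inj c d e with ℕₚ.<-cmp (ρ c) (ρ d)
  ... | tri< p _ _ = ⊥-elim (ℕₚ.<⇒≢ (key-mono c d p) e)
  ... | tri> _ _ p = ⊥-elim (ℕₚ.<⇒≢ (key-mono d c p) (sym e))
  ... | tri≈ _ p _ = Finₚ.toℕ-injective (ℕₚ.+-cancelˡ-≡ (ρ c ℕ.* n) _ _
                           (trans e (cong (λ z → z ℕ.* n ℕ.+ toℕ d) (sym p))))

-- Permutation matrices

𝟙 : Bool → ℕ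
𝟙 b = if b then 1 else 0

sumℕ : ℕ → (ℕ → ℕ) → ℕ
sumℕ zero    f = 0
sumℕ (suc n) f = f 0 ℕ.+ sumℕ n (f ∘ suc)

sumℕ-0 : ∀ n {f : ℕ → ℕ} → (∀ i → i < n → f i ≡ 0) → sumℕ n f ≡ 0
sumℕ-0 zero    p = refl
sumℕ-0 (suc n) p = cong₂ ℕ._+_ (p 0 (s≤s z≤n)) (sumℕ-0 n (λ i q → p (suc i) (s≤s q)))

count< : ∀ n k → k ≤ n → sumℕ n (λ b → 𝟙 (b <ᵇ k)) ≡ k
count< n       zero    p = sumℕ-0 n (λ _ _ → refl)
count< (suc n) (suc k) (s≤s p) = cong suc (count< n k p)

inversions : ℕ → (ℕ → ℕ) → ℕ
inversions zero    g = 0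
inversions (suc n) g = sumℕ n (λ j → 𝟙 (g (suc j) <ᵇ g 0)) ℕ.+ inversions n (g ∘ suc)

sign-+ : ∀ a b → sign (a ℕ.+ b) ≡ sign a * sign b
sign-+ zero    b = sym (ℤₚ.*-identityˡ _)
sign-+ (suc a) b = trans (cong -_ (sign-+ a b)) (ℤₚ.neg-distribˡ-* (sign a) (sign b))

sumFin-sumℕ : ∀ n (f : ℕ → ℕ) → sumFin n (λ i → ℤ.+ f (toℕ i)) ≡ ℤ.+ sumℕ n f
sumFin-sumℕ zero    f = refl
sumFin-sumℕ (suc n) f = cong (_+_ (ℤ.+ f 0)) (sumFin-sumℕ n (f ∘ suc))

FinInjective : ∀ {n} → (Fin n → Fin n) → Set
FinInjective f = ∀ i j → f i ≡ f j → i ≡ j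

module _ {n} (f : Fin (suc n) → Fin (suc n)) (inj : FinInjective f) where

  f₀≢ : ∀ i → f zero ≢ f (suc i)
  f₀≢ i e with inj _ _ e
  ... | ()

  rest : Fin n → Fin n
  rest i = punchOut (f₀≢ i)

  rest-injective : FinInjective rest
  rest-injective i j e = Finₚ.suc-injective (inj _ _ (Finₚ.punchOut-injective (f₀≢ i) (f₀≢ j) e))

sum-reindex : ∀ n (f : Fin n → Fin n) → FinInjective f → ∀ h → sumFin n (h ∘ f) ≡ sumFin n h
sum-reindex zero    f inj h = refl
sum-reindex (suc n) f inj h = begin
  h (f zero) + sumFin n (h ∘ f ∘ suc)
    ≡⟨ cong (_+_ (h (f zero))) (sum-cong n (λ i → cong h (sym (Finₚ.punchIn-punchOut (f₀≢ f inj i))))) ⟩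
  h (f zero) + sumFin n (h ∘ punchIn (f zero) ∘ rest f inj)
    ≡⟨ cong (_+_ (h (f zero))) (sum-reindex n (rest f inj) (rest-injective f inj) (h ∘ punchIn (f zero))) ⟩
  h (f zero) + sumFin n (h ∘ punchIn (f zero))
    ≡⟨ sym (sum-punchIn n (f zero) h) ⟩
  sumFin (suc n) h ∎
  where open ≡-Reasoning

punchOut-<ᵇ : ∀ {n} {b a a′ : Fin (suc n)} (p : b ≢ a) (q : b ≢ a′) →
              (toℕ (punchOut p) <ᵇ toℕ (punchOut q)) ≡ (toℕ a <ᵇ toℕ a′)
punchOut-<ᵇ {b = zero} {zero}          p q = ⊥-elim (p refl)
punchOut-<ᵇ {b = zero} {suc a} {zero}  p q = ⊥-elim (q refl)
punchOut-<ᵇ {b = zero} {suc a} {suc _} p q = refl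
punchOut-<ᵇ {suc n} {suc b} {zero}  {zero}  p q = refl
punchOut-<ᵇ {suc n} {suc b} {zero}  {suc _} p q = refl
punchOut-<ᵇ {suc n} {suc b} {suc _} {zero}  p q = refl
punchOut-<ᵇ {suc n} {suc b} {suc _} {suc _} p q = punchOut-<ᵇ (p ∘ cong suc) (q ∘ cong suc)

δ-punchIn : ∀ {n} {a b : Fin (suc n)} (p : b ≢ a) k → δ a (punchIn b k) ≡ δ (punchOut p) k
δ-punchIn {a = zero}  {zero}  p k = ⊥-elim (p refl)
δ-punchIn {a = suc a} {zero}  p k = refl
δ-punchIn {suc n} {zero}  {suc b} p zero    = refl
δ-punchIn {suc n} {zero}  {suc b} p (suc k) = refl
δ-punchIn {suc n} {suc a} {suc b} p zero    = refl
δ-punchIn {suc n} {suc a} {suc b} p (suc k) = δ-punchIn (p ∘ cong suc) k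

-- The values of f enter only through their relative order, recorded by g; this
-- is what survives the deletion of a row and a column.
det-permutation : ∀ n (f : Fin n → Fin n) (g : ℕ → ℕ) → FinInjective f →
  (∀ i j → (toℕ (f i) <ᵇ toℕ (f j)) ≡ (g (toℕ i) <ᵇ g (toℕ j))) →
  det n (λ i → δ (f i)) ≡ sign (inversions n g)
det-permutation zero    f g inj e = refl
det-permutation (suc n) f g inj e = begin
  det (suc n) (λ i → δ (f i))
    ≡⟨ sum-single (suc n) f₀ {λ j → sign (toℕ j) * δ f₀ j * minor j} (λ j p → trans (cong (λ z → sign (toℕ j) * z * minor j) (δ-off (p ∘ sym))) (lem (sign (toℕ j)) (minor j))) ⟩
  sign (toℕ f₀) * δ f₀ f₀ * minor f₀
    ≡⟨ cong₂ _*_ (trans (cong (sign (toℕ f₀) *_) (δ-diag f₀)) (ℤₚ.*-identityʳ (sign (toℕ f₀))))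
         (trans (det-cong n (λ i k → δ-punchIn (f₀≢ f inj i) k))
                (det-permutation n (rest f inj) (g ∘ suc) (rest-injective f inj)
                  (λ i j → trans (punchOut-<ᵇ (f₀≢ f inj i) (f₀≢ f inj j)) (e (suc i) (suc j))))) ⟩
  sign (toℕ f₀) * sign (inversions n (g ∘ suc))
    ≡⟨ cong (λ z → sign z * sign (inversions n (g ∘ suc))) below ⟩
  sign (sumℕ n (λ j → 𝟙 (g (suc j) <ᵇ g 0))) * sign (inversions n (g ∘ suc))
    ≡⟨ sym (sign-+ (sumℕ n (λ j → 𝟙 (g (suc j) <ᵇ g 0))) _) ⟩
  sign (inversions (suc n) g) ∎
  where
  open ≡-Reasoning
  f₀ = f zero
  minor : Fin (suc n) → ℤ
  minor j = det n (λ i k → δ (f (suc i)) (punchIn j k))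
  lem : ∀ s m → s * 0ℤ * m ≡ 0ℤ
  lem = solve-∀
  irr : ∀ m → (m <ᵇ m) ≡ false
  irr zero    = refl
  irr (suc m) = irr m
  -- The sign of the expansion is that of the column `f₀`. All smaller values are attained, as `f`
  -- is a permutation, and they occur at later positions, so `f₀` also counts the inversions with
  -- position 0.
  below : toℕ f₀ ≡ sumℕ n (λ j → 𝟙 (g (suc j) <ᵇ g 0))
  below = ℤₚ.+-injective (begin
    ℤ.+ toℕ f₀
      ≡⟨ sym (trans (sumFin-sumℕ (suc n) (λ b → 𝟙 (b <ᵇ toℕ f₀))) (cong ℤ.+_ (count< (suc n) (toℕ f₀) (ℕₚ.<⇒≤ (Finₚ.toℕ<n f₀))))) ⟩
    sumFin (suc n) (λ b → ℤ.+ 𝟙 (toℕ b <ᵇ toℕ f₀))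
      ≡⟨ sym (sum-reindex (suc n) f inj (λ b → ℤ.+ 𝟙 (toℕ b <ᵇ toℕ f₀))) ⟩
    ℤ.+ 𝟙 (toℕ f₀ <ᵇ toℕ f₀) + sumFin n (λ i → ℤ.+ 𝟙 (toℕ (f (suc i)) <ᵇ toℕ f₀))
      ≡⟨ cong₂ _+_ (cong (λ z → ℤ.+ 𝟙 z) (irr (toℕ f₀))) (sum-cong n (λ i → cong (λ z → ℤ.+ 𝟙 z) (e (suc i) zero))) ⟩
    0ℤ + sumFin n (λ i → ℤ.+ 𝟙 (g (suc (toℕ i)) <ᵇ g 0))
      ≡⟨ ℤₚ.+-identityˡ _ ⟩
    sumFin n (λ i → ℤ.+ 𝟙 (g (suc (toℕ i)) <ᵇ g 0))
      ≡⟨ sumFin-sumℕ n (λ j → 𝟙 (g (suc j) <ᵇ g 0)) ⟩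
    ℤ.+ sumℕ n (λ j → 𝟙 (g (suc j) <ᵇ g 0)) ∎)

-- Rows indexed by residues

module Modular (N′ : ℕ) where

  N : ℕ
  N = suc N′

  infix 4 _~_
  -- A record instead of the bare equation, since unification cannot recover `x` and `y` from
  -- `x % N ≡ y % N`.
  record _~_ (x y : ℕ) : Set where
    constructor mk~
    field un~ : x % N ≡ y % N
  open _~_ public

  ~-refl : ∀ {x} → x ~ x
  ~-refl = mk~ refl

  ≡⇒~ : ∀ {x y} → x ≡ y → x ~ y
  ≡⇒~ refl = ~-refl

  ~-sym : ∀ {x y} → x ~ y → y ~ x
  ~-sym (mk~ e) = mk~ (sym e)

  ~-trans : ∀ {x y z} → x ~ y → y ~ z → x ~ z
  ~-trans (mk~ e) (mk~ f) = mk~ (trans e f)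

  ~-+ : ∀ {x y z w} → x ~ y → z ~ w → x ℕ.+ z ~ y ℕ.+ w
  ~-+ {x} {y} {z} {w} (mk~ e) (mk~ f) = mk~ (trans (%-distribˡ-+ x z N)
    (trans (cong₂ (λ a b → (a ℕ.+ b) % N) e f) (sym (%-distribˡ-+ y w N))))

  ~-* : ∀ {x y z w} → x ~ y → z ~ w → x ℕ.* z ~ y ℕ.* w
  ~-* {x} {y} {z} {w} (mk~ e) (mk~ f) = mk~ (trans (%-distribˡ-* x z N)
    (trans (cong₂ (λ a b → (a ℕ.* b) % N) e f) (sym (%-distribˡ-* y w N))))

  ~-+kN : ∀ x k → x ℕ.+ k ℕ.* N ~ x
  ~-+kN x k = mk~ ([m+kn]%n≡m%n x k N)

  ~-% : ∀ x → x % N ~ x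
  ~-% x = mk~ (m%n%n≡m%n x N)

  ~⇒≡ : ∀ {x y} → x < N → y < N → x ~ y → x ≡ y
  ~⇒≡ p q (mk~ e) = trans (sym (m<n⇒m%n≡m p)) (trans e (m<n⇒m%n≡m q))

  infix 4 _~?_
  _~?_ : ∀ x y → Dec (x ~ y)
  x ~? y with x % N ℕ.≟ y % N
  ... | yes e = yes (mk~ e)
  ... | no n  = no (n ∘ un~)

  ~⇒∣ : ∀ {x y} → x ~ y → N ∣ ∣ x - y ∣
  ~⇒∣ {x} {y} (mk~ p) = divides ∣ x ℕ./ N - y ℕ./ N ∣ (begin
    ∣ x - y ∣ ≡⟨ cong₂ ∣_-_∣ (m≡m%n+[m/n]*n x N) (trans (m≡m%n+[m/n]*n y N) (cong (ℕ._+ y ℕ./ N ℕ.* N) (sym p))) ⟩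
    ∣ x % N ℕ.+ x ℕ./ N ℕ.* N - x % N ℕ.+ y ℕ./ N ℕ.* N ∣ ≡⟨ ℕₚ.∣m+n-m+o∣≡∣n-o∣ (x % N) _ _ ⟩
    ∣ x ℕ./ N ℕ.* N - y ℕ./ N ℕ.* N ∣ ≡⟨ sym (ℕₚ.*-distribʳ-∣-∣ N (x ℕ./ N) (y ℕ./ N)) ⟩
    ∣ x ℕ./ N - y ℕ./ N ∣ ℕ.* N ∎)
    where open ≡-Reasoning

  ∣⇒~ : ∀ {x y} → N ∣ ∣ x - y ∣ → x ~ y
  ∣⇒~ {x} {y} (divides k p) with ℕₚ.≤-total x y
  ... | inj₁ q = ~-sym (~-trans (≡⇒~ (sym (trans (cong (x ℕ.+_) (trans (sym p) (ℕₚ.m≤n⇒∣m-n∣≡n∸m q))) (ℕₚ.m+[n∸m]≡n q)))) (~-+kN x k))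
  ... | inj₂ q = ~-trans (≡⇒~ (sym (trans (cong (y ℕ.+_) (trans (sym p) (trans (ℕₚ.∣-∣-comm x y) (ℕₚ.m≤n⇒∣m-n∣≡n∸m q)))) (ℕₚ.m+[n∸m]≡n q)))) (~-+kN y k)

  residue : ℕ → Fin N
  residue x = Fin.fromℕ< (m%n<n x N)

  toℕ-residue : ∀ x → toℕ (residue x) ≡ x % N
  toℕ-residue x = Finₚ.toℕ-fromℕ< (m%n<n x N)

  residue~ : ∀ x → toℕ (residue x) ~ x
  residue~ x = ~-trans (≡⇒~ (toℕ-residue x)) (~-% x)

  Fin~⇒≡ : ∀ {i j : Fin N} → toℕ i ~ toℕ j → i ≡ j
  Fin~⇒≡ {i} {j} e = Finₚ.toℕ-injective (~⇒≡ (Finₚ.toℕ<n i) (Finₚ.toℕ<n j) e)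

  -- Kept abstract so that sums of indicators do not unfold during unification.
  abstract
    ι : ℕ → ℕ → ℤ
    ι x y = if does (x ~? y) then 1ℤ else 0ℤ

    ι-yes : ∀ {x y} → x ~ y → ι x y ≡ 1ℤ
    ι-yes {x} {y} p with x ~? y
    ... | yes _ = refl
    ... | no q  = ⊥-elim (q p)

    ι-no : ∀ {x y} → ¬ x ~ y → ι x y ≡ 0ℤ
    ι-no {x} {y} p with x ~? y
    ... | yes q = ⊥-elim (p q)
    ... | no _  = refl

    ι-⇔ : ∀ {x y z w} → (x ~ y → z ~ w) → (z ~ w → x ~ y) → ι x y ≡ ι z w
    ι-⇔ {x} {y} f g with x ~? y
    ... | yes p = sym (ι-yes (f p))
    ... | no p  = sym (ι-no (p ∘ g))

  -- `E y` is the coefficient row of the monomial with exponent `y` in ℤ[x]/(x^N - 1).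
  E : ℕ → Fin N → ℤ
  E x j = ι x (toℕ j)

  Periodic : (ℕ → Fin N → ℤ) → Set
  Periodic a = ∀ {x y} → x ~ y → ∀ j → a x j ≡ a y j

  E-periodic : Periodic E
  E-periodic p j = ι-⇔ (~-trans (~-sym p)) (~-trans p)

  E-δ : ∀ x j → E x j ≡ δ (residue x) j
  E-δ x j with residue x Fin.≟ j
  ... | yes refl = trans (ι-yes (~-sym (residue~ x))) (sym (δ-diag (residue x)))
  ... | no p     = trans (ι-no (λ q → p (Fin~⇒≡ (~-trans (residue~ x) q)))) (sym (δ-off p))

  sum-E : ∀ x (f : Fin N → ℤ) → sumFin N (λ k → E x k * f k) ≡ f (residue x)
  sum-E x f = trans (sum-single N (residue x) {λ k → E x k * f k}
      (λ k p → cong (_* f k) (ι-no (λ q → p (Fin~⇒≡ (~-trans (~-sym q) (~-sym (residue~ x))))))))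
    (trans (cong (_* f (residue x)) (ι-yes (~-sym (residue~ x)))) (ℤₚ.*-identityˡ _))

  sum-E-1 : ∀ x → sumFin N (E x) ≡ 1ℤ
  sum-E-1 x = trans (sum-cong N (λ k → sym (ℤₚ.*-identityʳ (E x k)))) (sum-E x (λ _ → 1ℤ))

  -- Multiplication by u is undone by v, and N′ plays the role of −1.
  E-affine : ∀ u v → u ℕ.* v ~ 1 → ∀ s k j → ι (u ℕ.* k ℕ.+ s) j ≡ ι (v ℕ.* (j ℕ.+ N′ ℕ.* s)) k
  E-affine u v uv s k j = ι-⇔ fwd bwd
    where
    eq₁ : ∀ u v k s n → v ℕ.* (u ℕ.* k ℕ.+ s ℕ.+ n ℕ.* s) ≡ u ℕ.* v ℕ.* k ℕ.+ v ℕ.* s ℕ.* suc n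
    eq₁ = ℕ-Solver.solve-∀
    eq₂ : ∀ u v j s n → u ℕ.* (v ℕ.* (j ℕ.+ n ℕ.* s)) ℕ.+ s ≡ u ℕ.* v ℕ.* (j ℕ.+ n ℕ.* s) ℕ.+ s
    eq₂ = ℕ-Solver.solve-∀
    eq₃ : ∀ j s n → 1 ℕ.* (j ℕ.+ n ℕ.* s) ℕ.+ s ≡ j ℕ.+ s ℕ.* suc n
    eq₃ = ℕ-Solver.solve-∀
    fwd : u ℕ.* k ℕ.+ s ~ j → v ℕ.* (j ℕ.+ N′ ℕ.* s) ~ k
    fwd p = ~-trans (~-* (~-refl {v}) (~-+ (~-sym p) (~-refl {N′ ℕ.* s})))
           (~-trans (≡⇒~ (eq₁ u v k s N′))
           (~-trans (~-+kN (u ℕ.* v ℕ.* k) (v ℕ.* s))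
           (~-trans (~-* uv (~-refl {k})) (≡⇒~ (ℕₚ.*-identityˡ k)))))
    bwd : v ℕ.* (j ℕ.+ N′ ℕ.* s) ~ k → u ℕ.* k ℕ.+ s ~ j
    bwd p = ~-trans (~-+ (~-* (~-refl {u}) (~-sym p)) (~-refl {s}))
           (~-trans (≡⇒~ (eq₂ u v j s N′))
           (~-trans (~-+ (~-* uv (~-refl {j ℕ.+ N′ ℕ.* s})) (~-refl {s}))
           (~-trans (≡⇒~ (eq₃ j s N′)) (~-+kN j s))))

  sum-E-affine : ∀ u v → u ℕ.* v ~ 1 → ∀ s j → sumFin N (λ k → E (u ℕ.* toℕ k ℕ.+ s) j) ≡ 1ℤ
  sum-E-affine u v uv s j = trans (sum-cong N (λ k → E-affine u v uv s (toℕ k) (toℕ j)))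
                                  (sum-E-1 (v ℕ.* (toℕ j ℕ.+ N′ ℕ.* s)))

  -- Formal linear combinations of the rows E x and of the all-ones row 𝟏, so
  -- that multiplication by a matrix becomes substitution for the generators.
  infixl 6 _⊕_
  infixr 7 _⊙_
  data Lin : Set where
    e   : ℕ → Lin
    𝟏   : Lin
    _⊕_ : Lin → Lin → Lin
    _⊙_ : ℤ → Lin → Lin
    ⨁   : ℕ → (ℕ → Lin) → Lin

  sumTo : ℕ → (ℕ → ℤ) → ℤ
  sumTo zero    f = 0ℤ
  sumTo (suc n) f = sumTo n f + f n

  eval : Lin → (ℕ → ℤ) → ℤ → ℤ
  eval (e x)   a t = a x
  eval 𝟏       a t = t
  eval (l ⊕ r) a t = eval l a t + eval r a t
  eval (c ⊙ l) a t = c * eval l a t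
  eval (⨁ n l) a t = sumTo n (λ i → eval (l i) a t)

  row : Lin → Fin N → ℤ
  row l j = eval l (λ x → E x j) 1ℤ

  mat : (ℕ → Fin N → ℤ) → Rows N N
  mat a i = a (toℕ i)

  total : (ℕ → Fin N → ℤ) → Fin N → ℤ
  total a j = sumFin N (λ k → a (toℕ k) j)

  row-⊗ : ∀ l (a : ℕ → Fin N → ℤ) → Periodic a → ∀ j →
          sumFin N (λ k → row l k * mat a k j) ≡ eval l (λ x → a x j) (total a j)
  row-⊗ (e x) a per j = trans (sum-E x (λ k → mat a k j)) (per (residue~ x) j)
  row-⊗ 𝟏 a per j = sum-cong N (λ k → ℤₚ.*-identityˡ (mat a k j))
  row-⊗ (l ⊕ r) a per j = trans (sum-cong N (λ k → ℤₚ.*-distribʳ-+ (mat a k j) (row l k) (row r k)))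
    (trans (sum-+ N (λ k → row l k * mat a k j) (λ k → row r k * mat a k j))
           (cong₂ _+_ (row-⊗ l a per j) (row-⊗ r a per j)))
  row-⊗ (c ⊙ l) a per j = trans (sum-cong N (λ k → ℤₚ.*-assoc c (row l k) (mat a k j)))
    (trans (sum-*ˡ N c (λ k → row l k * mat a k j)) (cong (c *_) (row-⊗ l a per j)))
  row-⊗ (⨁ zero l) a per j = sum-0 N (λ k → refl)
  row-⊗ (⨁ (suc n) l) a per j =
    trans (sum-cong N (λ k → ℤₚ.*-distribʳ-+ (mat a k j) (row (⨁ n l) k) (row (l n) k)))
    (trans (sum-+ N (λ k → row (⨁ n l) k * mat a k j) (λ k → row (l n) k * mat a k j))
           (cong₂ _+_ (row-⊗ (⨁ n l) a per j) (row-⊗ (l n) a per j)))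

  -- Multiplicativity of `det` read as composition of operators: rows are the images of the
  -- generators, and the left factor acts first. It is typically used twice, to factor one matrix
  -- `b` in two ways.
  det-subst : ∀ (c : ℕ → Lin) (a b : ℕ → Fin N → ℤ) → Periodic a →
    (∀ x j → eval (c x) (λ y → a y j) (total a j) ≡ b x j) →
    det N (mat (row ∘ c)) * det N (mat a) ≡ det N (mat b)
  det-subst c a b per eq = trans (sym (det-⊗ N (mat (row ∘ c)) (mat a)))
    (det-cong N (λ i j → trans (row-⊗ (c (toℕ i)) a per j) (eq (toℕ i) j)))

  det-E : det N (mat E) ≡ 1ℤ
  det-E = trans (det-cong N (λ i j → trans (E-δ (toℕ i) j) (cong (λ z → δ z j) (Fin~⇒≡ (residue~ (toℕ i)))))) (det-δ N)

  scaling : ℕ → ℕ → Lin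
  scaling u x = e (u ℕ.* x)

  scaling-periodic : ∀ u → Periodic (row ∘ scaling u)
  scaling-periodic u p j = E-periodic (~-* (~-refl {u}) p) j

  det-scaling-* : ∀ u v → det N (mat (row ∘ scaling u)) * det N (mat (row ∘ scaling v)) ≡ det N (mat (row ∘ scaling (u ℕ.* v)))
  det-scaling-* u v = det-subst (scaling u) (row ∘ scaling v) (row ∘ scaling (u ℕ.* v)) (scaling-periodic v)
    (λ x j → cong (λ z → E z j) (eq u v x))
    where eq : ∀ u v x → v ℕ.* (u ℕ.* x) ≡ u ℕ.* v ℕ.* x
          eq = ℕ-Solver.solve-∀

  det-scaling-~1 : ∀ u → u ~ 1 → det N (mat (row ∘ scaling u)) ≡ 1ℤ
  det-scaling-~1 u p = trans (det-cong N (λ i j → E-periodic (~-trans (~-* p ~-refl) (≡⇒~ (ℕₚ.*-identityˡ (toℕ i)))) j)) det-E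

  det-scaling : ∀ u v → u ℕ.* v ~ 1 → det N (mat (row ∘ scaling u)) ≡ sign (inversions N (λ i → (u ℕ.* i) % N))
  det-scaling u v uv = trans (det-cong N (λ i j → E-δ (u ℕ.* toℕ i) j))
    (det-permutation N f (λ i → (u ℕ.* i) % N) inj
      (λ i j → cong₂ _<ᵇ_ (toℕ-residue (u ℕ.* toℕ i)) (toℕ-residue (u ℕ.* toℕ j))))
    where
    f : Fin N → Fin N
    f i = residue (u ℕ.* toℕ i)
    eq : ∀ u v x → v ℕ.* (u ℕ.* x) ≡ u ℕ.* v ℕ.* x
    eq = ℕ-Solver.solve-∀
    back : ∀ x → v ℕ.* (u ℕ.* x) ~ x
    back x = ~-trans (≡⇒~ (eq u v x)) (~-trans (~-* uv ~-refl) (≡⇒~ (ℕₚ.*-identityˡ x)))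
    inj : FinInjective f
    inj i j p = Fin~⇒≡ (~-trans (~-sym (back (toℕ i))) (~-trans (~-* (~-refl {v})
      (~-trans (~-sym (residue~ _)) (~-trans (≡⇒~ (cong toℕ p)) (residue~ _)))) (back (toℕ j))))

-- Reduction to the doubling map

cancelˡ : ∀ {a x y} → a ≢ 0ℤ → a * x ≡ a * y → x ≡ y
cancelˡ {a} {x} {y} p q = ℤₚ.*-cancelˡ-≡ a x y {{ℤ.≢-nonZero p}} q

unit≢0 : ∀ {a b} → a * b ≡ 1ℤ → a ≢ 0ℤ
unit≢0 () refl

sign²≡1 : ∀ n → sign n * sign n ≡ 1ℤ
sign²≡1 zero    = refl
sign²≡1 (suc n) = trans (lem (sign n)) (sign²≡1 n)
  where lem : ∀ x → - x * - x ≡ x * x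
        lem = solve-∀

module OddModulus (m : ℕ) where

  open Modular (m ℕ.+ m)

  half : ℕ
  half = suc m

  2*half~1 : 2 ℕ.* half ~ 1
  2*half~1 = ~-trans (≡⇒~ (eq m)) (~-+kN 1 1)
    where eq : ∀ m → 2 ℕ.* suc m ≡ 1 ℕ.+ 1 ℕ.* suc (m ℕ.+ m)
          eq = ℕ-Solver.solve-∀

  2*-cancel : ∀ {x y} → 2 ℕ.* x ~ 2 ℕ.* y → x ~ y
  2*-cancel {x} {y} p = ~-trans (~-sym (red x)) (~-trans (~-* (~-refl {half}) p) (red y))
    where
    eq : ∀ h x → h ℕ.* (2 ℕ.* x) ≡ 2 ℕ.* h ℕ.* x
    eq = ℕ-Solver.solve-∀
    red : ∀ x → half ℕ.* (2 ℕ.* x) ~ x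
    red x = ~-trans (≡⇒~ (eq half x)) (~-trans (~-* 2*half~1 (~-refl {x})) (≡⇒~ (ℕₚ.*-identityˡ x)))

  2^*-cancel : ∀ k {x y} → 2 ℕ.^ k ℕ.* x ~ 2 ℕ.^ k ℕ.* y → x ~ y
  2^*-cancel zero    {x} {y} p = ~-trans (≡⇒~ (sym (ℕₚ.*-identityˡ x))) (~-trans p (≡⇒~ (ℕₚ.*-identityˡ y)))
  2^*-cancel (suc k) {x} {y} p = 2^*-cancel k (2*-cancel
    (~-trans (≡⇒~ (sym (ℕₚ.*-assoc 2 (2 ℕ.^ k) x))) (~-trans p (≡⇒~ (ℕₚ.*-assoc 2 (2 ℕ.^ k) y)))))

module Doubling (m : ℕ) where

  open Modular (m ℕ.+ m)
  open OddModulus m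

  N′ : ℕ
  N′ = m ℕ.+ m

  N̂ : ℤ
  N̂ = ℤ.+ N

  total-shift : ∀ s j → sumFin N (λ k → E (toℕ k ℕ.+ s) j) ≡ 1ℤ
  total-shift s j = trans (sum-cong N (λ k → cong (λ z → E (z ℕ.+ s) j) (sym (ℕₚ.*-identityˡ (toℕ k)))))
                          (sum-E-affine 1 1 ~-refl s j)

  total-E : ∀ j → total E j ≡ 1ℤ
  total-E j = trans (sum-cong N (λ k → cong (λ z → E z j) (sym (ℕₚ.+-identityʳ (toℕ k))))) (total-shift 0 j)

  total-double : ∀ j → sumFin N (λ k → E (2 ℕ.* toℕ k) j) ≡ 1ℤ
  total-double j = trans (sum-cong N (λ k → cong (λ z → E z j) (sym (ℕₚ.+-identityʳ (2 ℕ.* toℕ k)))))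
                         (sum-E-affine 2 half 2*half~1 0 j)

  total-const : ∀ n → sumFin n (λ _ → 1ℤ) ≡ ℤ.+ n
  total-const zero    = refl
  total-const (suc n) = cong (_+_ 1ℤ) (total-const n)

  -- shiftsum is D + (x + x⁻¹); difference and difference₂ are multiplication by
  -- g = x − x⁻¹ and by D g, made invertible at x = 1 by adding 𝟏; scaled is N (D + 1)
  -- with the corresponding correction.
  double shiftsum I+D difference difference₂ scaled : ℕ → Lin
  double      = scaling 2
  shiftsum y  = e (2 ℕ.* y) ⊕ e (y ℕ.+ 1) ⊕ e (y ℕ.+ N′)
  I+D y       = e (2 ℕ.* y) ⊕ e y
  difference y  = e (y ℕ.+ 1) ⊕ ℤ.-1ℤ ⊙ e (y ℕ.+ N′) ⊕ 𝟏
  difference₂ y = e (y ℕ.+ 2) ⊕ ℤ.-1ℤ ⊙ e (y ℕ.+ 2 ℕ.* N′) ⊕ 𝟏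
  scaled y      = N̂ ⊙ e (2 ℕ.* y) ⊕ N̂ ⊙ e y ⊕ 𝟏

  Δ : (ℕ → Lin) → ℤ
  Δ c = det N (mat (row ∘ c))

  shiftsum-periodic : Periodic (row ∘ shiftsum)
  shiftsum-periodic p j = cong₂ _+_ (cong₂ _+_ (E-periodic (~-* (~-refl {2}) p) j) (E-periodic (~-+ p ~-refl) j))
                                    (E-periodic (~-+ p ~-refl) j)

  difference-periodic : Periodic (row ∘ difference)
  difference-periodic p j = cong₂ (λ a b → a + ℤ.-1ℤ * b + 1ℤ) (E-periodic (~-+ p ~-refl) j) (E-periodic (~-+ p ~-refl) j)

  difference₂-periodic : Periodic (row ∘ difference₂)
  difference₂-periodic p j = cong₂ (λ a b → a + ℤ.-1ℤ * b + 1ℤ) (E-periodic (~-+ p ~-refl) j) (E-periodic (~-+ p ~-refl) j)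

  scaled-periodic : Periodic (row ∘ scaled)
  scaled-periodic p j = cong₂ (λ a b → N̂ * a + N̂ * b + 1ℤ) (E-periodic (~-* (~-refl {2}) p) j) (E-periodic p j)

  I+D-periodic : Periodic (row ∘ I+D)
  I+D-periodic p j = cong₂ _+_ (E-periodic (~-* (~-refl {2}) p) j) (E-periodic p j)

  sum-+-- : ∀ n (f g h : Fin n → ℤ) → sumFin n (λ k → f k + ℤ.-1ℤ * g k + h k) ≡ sumFin n f + ℤ.-1ℤ * sumFin n g + sumFin n h
  sum-+-- n f g h = trans (sum-+ n (λ k → f k + ℤ.-1ℤ * g k) h) (cong (_+ sumFin n h)
    (trans (sum-+ n f (λ k → ℤ.-1ℤ * g k)) (cong (_+_ (sumFin n f)) (sum-*ˡ n ℤ.-1ℤ g))))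

  total-difference : ∀ j → total (row ∘ difference) j ≡ N̂
  total-difference j = trans (sum-+-- N (λ k → E (toℕ k ℕ.+ 1) j) (λ k → E (toℕ k ℕ.+ N′) j) (λ _ → 1ℤ))
    (cong₂ _+_ (cong₂ (λ a b → a + ℤ.-1ℤ * b) (total-shift 1 j) (total-shift N′ j)) (total-const N))

  total-difference₂ : ∀ j → total (row ∘ difference₂) j ≡ N̂
  total-difference₂ j = trans (sum-+-- N (λ k → E (toℕ k ℕ.+ 2) j) (λ k → E (toℕ k ℕ.+ 2 ℕ.* N′) j) (λ _ → 1ℤ))
    (cong₂ _+_ (cong₂ (λ a b → a + ℤ.-1ℤ * b) (total-shift 2 j) (total-shift (2 ℕ.* N′) j)) (total-const N))

  total-shiftsum : ∀ j → total (row ∘ shiftsum) j ≡ ℤ.+ 3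
  total-shiftsum j = trans (sum-+ N (λ k → E (2 ℕ.* toℕ k) j + E (toℕ k ℕ.+ 1) j) (λ k → E (toℕ k ℕ.+ N′) j))
    (cong₂ _+_ (trans (sum-+ N (λ k → E (2 ℕ.* toℕ k) j) (λ k → E (toℕ k ℕ.+ 1) j))
                      (cong₂ _+_ (total-double j) (total-shift 1 j))) (total-shift N′ j))

  total-scaled : ∀ j → total (row ∘ scaled) j ≡ N̂ * 1ℤ + N̂ * 1ℤ + N̂
  total-scaled j = trans (sum-+ N (λ k → N̂ * E (2 ℕ.* toℕ k) j + N̂ * E (toℕ k) j) (λ _ → 1ℤ))
    (cong₂ _+_ (trans (sum-+ N (λ k → N̂ * E (2 ℕ.* toℕ k) j) (λ k → N̂ * E (toℕ k) j))
                      (cong₂ _+_ (trans (sum-*ˡ N N̂ (λ k → E (2 ℕ.* toℕ k) j)) (cong (N̂ *_) (total-double j)))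
                                 (trans (sum-*ˡ N N̂ (λ k → E (toℕ k) j)) (cong (N̂ *_) (total-E j))))) (total-const N))

  sumTo-cong : ∀ n {f g : ℕ → ℤ} → (∀ i → f i ≡ g i) → sumTo n f ≡ sumTo n g
  sumTo-cong zero    p = refl
  sumTo-cong (suc n) p = cong₂ _+_ (sumTo-cong n p) (p n)

  sumTo-Fin : ∀ n (f : ℕ → ℤ) → sumTo n f ≡ sumFin n (f ∘ toℕ)
  sumTo-Fin zero    f = refl
  sumTo-Fin (suc n) f = trans (shift n f) (cong (_+_ (f 0)) (sumTo-Fin n (f ∘ suc)))
    where
    shift : ∀ n (f : ℕ → ℤ) → sumTo (suc n) f ≡ f 0 + sumTo n (f ∘ suc)
    shift zero    f = trans (ℤₚ.+-identityˡ (f 0)) (sym (ℤₚ.+-identityʳ (f 0)))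
    shift (suc n) f = trans (cong (_+ f (suc n)) (shift n f)) (ℤₚ.+-assoc (f 0) (sumTo n (f ∘ suc)) (f (suc n)))

  -- Summation by parts. The `1ℤ` is the contribution of the summand `𝟏` of `difference` and the
  -- origin of the sum of the `i` on the right.
  abel : ∀ n (f : ℕ → ℤ) → sumTo n (λ i → ℤ.+ i * (f (suc i) + ℤ.-1ℤ * f i + 1ℤ)) + sumTo n (f ∘ suc)
                           ≡ ℤ.+ n * f n + sumTo n (λ i → ℤ.+ i)
  abel zero    f = refl
  abel (suc n) f = trans (lem₁ S (ℤ.+ n) (f (suc n)) (f n) T)
                  (trans (cong (λ z → z + _) (abel n f))
                         (lem₂ (ℤ.+ n) (f (suc n)) (f n) U))
    where
    S = sumTo n (λ i → ℤ.+ i * (f (suc i) + ℤ.-1ℤ * f i + 1ℤ))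
    T = sumTo n (f ∘ suc)
    U = sumTo n (λ i → ℤ.+ i)
    lem₁ : ∀ s n x y t → (s + n * (x + ℤ.-1ℤ * y + 1ℤ)) + (t + x) ≡ (s + t) + (n * (x + ℤ.-1ℤ * y + 1ℤ) + x)
    lem₁ = solve-∀
    lem₂ : ∀ n x y u → (n * y + u) + (n * (x + ℤ.-1ℤ * y + 1ℤ) + x) ≡ (1ℤ + n) * x + (u + n)
    lem₂ = solve-∀

  2*sum-id : ∀ n → ℤ.+ 2 * sumTo n (λ i → ℤ.+ i) ≡ ℤ.+ n * (ℤ.+ n + ℤ.-1ℤ)
  2*sum-id zero    = refl
  2*sum-id (suc n) = trans (ℤₚ.*-distribˡ-+ (ℤ.+ 2) (sumTo n (λ i → ℤ.+ i)) (ℤ.+ n))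
    (trans (cong (_+ ℤ.+ 2 * ℤ.+ n) (2*sum-id n)) (lem (ℤ.+ n)))
    where lem : ∀ n → n * (n + ℤ.-1ℤ) + ℤ.+ 2 * n ≡ (1ℤ + n) * ((1ℤ + n) + ℤ.-1ℤ)
          lem = solve-∀

  sum-id : sumTo N (λ i → ℤ.+ i) ≡ N̂ * ℤ.+ m
  sum-id = cancelˡ {ℤ.+ 2} (λ ()) (trans (2*sum-id N) (trans (cong (λ z → N̂ * z) (lem₀)) (lem N̂ (ℤ.+ m))))
    where
    lem : ∀ n m → n * (m + m) ≡ ℤ.+ 2 * (n * m)
    lem = solve-∀
    lem₀ : N̂ + ℤ.-1ℤ ≡ ℤ.+ m + ℤ.+ m
    lem₀ = refl

  -- N² times the inverse of difference, by Abel summation; the coefficient of 𝟏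
  -- is the one for which the all-ones terms cancel.
  antidifference : ℕ → Lin
  antidifference y = N̂ ⊙ ⨁ N (λ i → ℤ.+ i ⊙ e (y ℕ.+ 1 ℕ.+ 2 ℕ.* i)) ⊕ (1ℤ + - (N̂ * ℤ.+ m)) ⊙ 𝟏

  -- Composition with `antidifference` gives multiplication by N², whose determinant is a power of
  -- N. Non-vanishing is enough to cancel `Δ difference` from an equation between integers.
  Δ-difference≢0 : Δ difference ≢ 0ℤ
  Δ-difference≢0 d≡0 = N̂²≢0 (ℤₚ.i^n≡0⇒i≡0 (N̂ * N̂) N (begin
    (N̂ * N̂) ℤ.^ N                    ≡⟨ sym (ℤₚ.*-identityʳ _) ⟩
    (N̂ * N̂) ℤ.^ N * 1ℤ               ≡⟨ cong ((N̂ * N̂) ℤ.^ N *_) (sym det-E) ⟩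
    (N̂ * N̂) ℤ.^ N * det N (mat E)    ≡⟨ sym (det-scale N (N̂ * N̂) (mat E)) ⟩
    det N (mat (λ y j → N̂ * N̂ * E y j)) ≡⟨ sym (det-subst antidifference (row ∘ difference) (λ y j → N̂ * N̂ * E y j) difference-periodic entry) ⟩
    Δ antidifference * Δ difference  ≡⟨ cong (Δ antidifference *_) d≡0 ⟩
    Δ antidifference * 0ℤ            ≡⟨ ℤₚ.*-zeroʳ (Δ antidifference) ⟩
    0ℤ ∎))
    where
    open ≡-Reasoning
    N̂²≢0 : N̂ * N̂ ≢ 0ℤ
    N̂²≢0 ()
    entry : ∀ y j → eval (antidifference y) (λ z → row (difference z) j) (total (row ∘ difference) j) ≡ N̂ * N̂ * E y j
    entry y j = begin
      N̂ * sumTo N (λ i → ℤ.+ i * row (difference (y ℕ.+ 1 ℕ.+ 2 ℕ.* i)) j) + (1ℤ + - (N̂ * ℤ.+ m)) * total (row ∘ difference) j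
        ≡⟨ cong₂ (λ a b → N̂ * a + (1ℤ + - (N̂ * ℤ.+ m)) * b)
             (sumTo-cong N (λ i → cong (ℤ.+ i *_) (cong₂ (λ a b → a + ℤ.-1ℤ * b + 1ℤ) (cong (λ z → E z j) (eq₁ y i))
               (E-periodic (~-trans (≡⇒~ (eq₂ y i m)) (~-+kN (y ℕ.+ 2 ℕ.* i) 1)) j)))) (total-difference j) ⟩
      N̂ * S + (1ℤ + - (N̂ * ℤ.+ m)) * N̂
        ≡⟨ lem₁ N̂ S (ℤ.+ m) ⟩
      N̂ * (S + 1ℤ) + - (N̂ * (N̂ * ℤ.+ m))
        ≡⟨ cong (λ z → N̂ * (S + z) + - (N̂ * (N̂ * ℤ.+ m))) (sym total-f) ⟩
      N̂ * (S + sumTo N (f ∘ suc)) + - (N̂ * (N̂ * ℤ.+ m))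
        ≡⟨ cong (λ z → N̂ * z + - (N̂ * (N̂ * ℤ.+ m))) (abel N f) ⟩
      N̂ * (N̂ * f N + sumTo N (λ i → ℤ.+ i)) + - (N̂ * (N̂ * ℤ.+ m))
        ≡⟨ cong₂ (λ a b → N̂ * (N̂ * a + b) + - (N̂ * (N̂ * ℤ.+ m))) (E-periodic (~-+kN y 2) j) sum-id ⟩
      N̂ * (N̂ * E y j + N̂ * ℤ.+ m) + - (N̂ * (N̂ * ℤ.+ m))
        ≡⟨ lem₂ N̂ (E y j) (ℤ.+ m) ⟩
      N̂ * N̂ * E y j ∎
      where
      f : ℕ → ℤ
      f i = E (y ℕ.+ 2 ℕ.* i) j
      S = sumTo N (λ i → ℤ.+ i * (f (suc i) + ℤ.-1ℤ * f i + 1ℤ))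
      eq₁ : ∀ y i → y ℕ.+ 1 ℕ.+ 2 ℕ.* i ℕ.+ 1 ≡ y ℕ.+ 2 ℕ.* suc i
      eq₁ = ℕ-Solver.solve-∀
      eq₂ : ∀ y i m → y ℕ.+ 1 ℕ.+ 2 ℕ.* i ℕ.+ (m ℕ.+ m) ≡ y ℕ.+ 2 ℕ.* i ℕ.+ 1 ℕ.* suc (m ℕ.+ m)
      eq₂ = ℕ-Solver.solve-∀
      eq₃ : ∀ y i → y ℕ.+ 2 ℕ.* suc i ≡ 2 ℕ.* i ℕ.+ (y ℕ.+ 2)
      eq₃ = ℕ-Solver.solve-∀
      -- N is odd, so N steps of length 2 visit each residue exactly once.
      total-f : sumTo N (f ∘ suc) ≡ 1ℤ
      total-f = trans (sumTo-Fin N (f ∘ suc)) (trans (sum-cong N (λ i → cong (λ z → E z j) (eq₃ y (toℕ i))))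
                      (sum-E-affine 2 half 2*half~1 (y ℕ.+ 2) j))
      lem₁ : ∀ n s m → n * s + (1ℤ + - (n * m)) * n ≡ n * (s + 1ℤ) + - (n * (n * m))
      lem₁ = solve-∀
      lem₂ : ∀ n x m → n * (n * x + n * m) + - (n * (n * m)) ≡ n * n * x
      lem₂ = solve-∀

  -- The substitution of x² for x carries multiplication by g into multiplication by D g, so the two
  -- are conjugate by `double`.
  Δ-difference₂ : Δ difference₂ ≡ Δ difference
  Δ-difference₂ = cancelˡ {Δ double} Δ-double≢0 (begin
    Δ double * Δ difference₂  ≡⟨ det-subst double (row ∘ difference₂) X difference₂-periodic (λ y j → refl) ⟩
    det N (mat X)             ≡⟨ sym (det-subst difference (row ∘ double) X (scaling-periodic 2) (λ y j →
                                   cong₂ _+_ (cong₂ (λ a b → E a j + ℤ.-1ℤ * E b j) (eq₁ y) (ℕₚ.*-distribˡ-+ 2 y N′)) (total-double j))) ⟩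
    Δ difference * Δ double   ≡⟨ ℤₚ.*-comm (Δ difference) (Δ double) ⟩
    Δ double * Δ difference ∎)
    where
    open ≡-Reasoning
    X : ℕ → Fin N → ℤ
    X y j = E (2 ℕ.* y ℕ.+ 2) j + ℤ.-1ℤ * E (2 ℕ.* y ℕ.+ 2 ℕ.* N′) j + 1ℤ
    eq₁ : ∀ y → 2 ℕ.* (y ℕ.+ 1) ≡ 2 ℕ.* y ℕ.+ 2
    eq₁ = ℕ-Solver.solve-∀
    Δ-double≢0 : Δ double ≢ 0ℤ
    Δ-double≢0 = unit≢0 {Δ double} {Δ (scaling half)} (trans (det-scaling-* 2 half) (det-scaling-~1 (2 ℕ.* half) 2*half~1))

  -- Up to the scalar N, `scaled` followed by `difference₂` is the same operator as `difference`
  -- followed by `shiftsum`; the terms at exponent `y` cancel as in the difference of squares. The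
  -- summand `𝟏` of `scaled` takes the value N on the all-ones row and raises the eigenvalue there
  -- from 2N to 3N, which matches the column sums 3 of `shiftsum`.
  Δ-scaled : Δ scaled ≡ N̂ ℤ.^ N * Δ shiftsum
  Δ-scaled = cancelˡ Δ-difference≢0 (begin
    Δ difference * Δ scaled         ≡⟨ ℤₚ.*-comm (Δ difference) (Δ scaled) ⟩
    Δ scaled * Δ difference         ≡⟨ cong (Δ scaled *_) (sym Δ-difference₂) ⟩
    Δ scaled * Δ difference₂        ≡⟨ det-subst scaled (row ∘ difference₂) (λ y j → N̂ * X y j) difference₂-periodic entry₁ ⟩
    det N (mat (λ y j → N̂ * X y j)) ≡⟨ det-scale N N̂ (mat X) ⟩
    N̂ ℤ.^ N * det N (mat X)         ≡⟨ cong (N̂ ℤ.^ N *_) (sym (det-subst difference (row ∘ shiftsum) X shiftsum-periodic entry₂)) ⟩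
    N̂ ℤ.^ N * (Δ difference * Δ shiftsum) ≡⟨ lem (N̂ ℤ.^ N) (Δ difference) (Δ shiftsum) ⟩
    Δ difference * (N̂ ℤ.^ N * Δ shiftsum) ∎)
    where
    open ≡-Reasoning
    lem : ∀ a b c → a * (b * c) ≡ b * (a * c)
    lem = solve-∀
    X : ℕ → Fin N → ℤ
    X y j = (E (2 ℕ.* y ℕ.+ 2) j + ℤ.-1ℤ * E (2 ℕ.* y ℕ.+ 2 ℕ.* N′) j) + (E (y ℕ.+ 2) j + ℤ.-1ℤ * E (y ℕ.+ 2 ℕ.* N′) j) + ℤ.+ 3
    entry₁ : ∀ y j → eval (scaled y) (λ z → row (difference₂ z) j) (total (row ∘ difference₂) j) ≡ N̂ * X y j
    entry₁ y j = trans (cong (λ t → N̂ * row (difference₂ (2 ℕ.* y)) j + N̂ * row (difference₂ y) j + t) (total-difference₂ j))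
                       (lem₁ N̂ (E (2 ℕ.* y ℕ.+ 2) j) (E (2 ℕ.* y ℕ.+ 2 ℕ.* N′) j) (E (y ℕ.+ 2) j) (E (y ℕ.+ 2 ℕ.* N′) j))
      where lem₁ : ∀ n a b c d → n * (a + ℤ.-1ℤ * b + 1ℤ) + n * (c + ℤ.-1ℤ * d + 1ℤ) + n ≡ n * ((a + ℤ.-1ℤ * b) + (c + ℤ.-1ℤ * d) + ℤ.+ 3)
            lem₁ = solve-∀
    entry₂ : ∀ y j → eval (difference y) (λ z → row (shiftsum z) j) (total (row ∘ shiftsum) j) ≡ X y j
    entry₂ y j = trans
      (cong₂ _+_ (cong₂ (λ a b → a + ℤ.-1ℤ * b)
        (cong₂ (λ a b → E a j + E b j + E (y ℕ.+ 1 ℕ.+ N′) j) (eq₁ y) (ℕₚ.+-assoc y 1 1))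
        (cong₂ _+_ (cong₂ (λ a b → E a j + E b j) (ℕₚ.*-distribˡ-+ 2 y N′) (eq₂ y N′)) (cong (λ a → E a j) (eq₃ y N′))))
        (total-shiftsum j))
      (lem₂ (E (2 ℕ.* y ℕ.+ 2) j) (E (2 ℕ.* y ℕ.+ 2 ℕ.* N′) j) (E (y ℕ.+ 2) j) (E (y ℕ.+ 2 ℕ.* N′) j) (E (y ℕ.+ 1 ℕ.+ N′) j))
      where
      eq₁ : ∀ y → 2 ℕ.* (y ℕ.+ 1) ≡ 2 ℕ.* y ℕ.+ 2
      eq₁ = ℕ-Solver.solve-∀
      eq₂ : ∀ y n → y ℕ.+ n ℕ.+ 1 ≡ y ℕ.+ 1 ℕ.+ n
      eq₂ = ℕ-Solver.solve-∀
      eq₃ : ∀ y n → y ℕ.+ n ℕ.+ n ≡ y ℕ.+ 2 ℕ.* n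
      eq₃ = ℕ-Solver.solve-∀
      lem₂ : ∀ a b c d x → (a + c + x) + ℤ.-1ℤ * (b + x + d) + ℤ.+ 3 ≡ (a + ℤ.-1ℤ * b) + (c + ℤ.-1ℤ * d) + ℤ.+ 3
      lem₂ = solve-∀

  -- The basis with E 0 replaced by the all-ones row, an eigenvector of scaled.
  withOnes : ℕ → Lin
  withOnes y = e y ⊕ ι y 0 ⊙ (𝟏 ⊕ ℤ.-1ℤ ⊙ e y)

  -- This is `scaled` in the basis `withOnes`, with `e 0` now standing for the all-ones row. Row 0
  -- collects 2N + 1 + N′ = 3N, the eigenvalue of that row.
  block : ℕ → Lin
  block y = N̂ ⊙ (e (2 ℕ.* y) ⊕ e y) ⊕ e 0 ⊕ (ι y 0 * ℤ.+ N′) ⊙ e 0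

  ι₀-periodic : ∀ {x y} → x ~ y → ι x 0 ≡ ι y 0
  ι₀-periodic p = ι-⇔ (~-trans (~-sym p)) (~-trans p)

  withOnes-periodic : Periodic (row ∘ withOnes)
  withOnes-periodic p j = cong₂ (λ a b → a + b * (1ℤ + ℤ.-1ℤ * a)) (E-periodic p j) (ι₀-periodic p)

  Δ-withOnes : Δ withOnes ≡ 1ℤ
  Δ-withOnes = det-unitriangular N (mat (row ∘ withOnes)) ρ diag off
    where
    ρ : Fin N → ℕ
    -- Row 0 is the all-ones row, the only one that is not a unit row, so it gets the higher rank.
    ρ zero    = 1
    ρ (suc _) = 0
    lem : ∀ b → 1ℤ + b * (1ℤ + ℤ.-1ℤ * 1ℤ) ≡ 1ℤ
    lem = solve-∀
    lem₂ : ∀ a → a + 0ℤ * (1ℤ + ℤ.-1ℤ * a) ≡ a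
    lem₂ = solve-∀
    diag : ∀ c → mat (row ∘ withOnes) c c ≡ 1ℤ
    diag c = trans (cong (λ a → a + ι (toℕ c) 0 * (1ℤ + ℤ.-1ℤ * a)) (ι-yes (~-refl {toℕ c}))) (lem (ι (toℕ c) 0))
    off : ∀ c d → c ≢ d → ¬ (ρ d < ρ c) → mat (row ∘ withOnes) c d ≡ 0ℤ
    off zero    zero    p q = ⊥-elim (p refl)
    off zero    (suc d) p q = ⊥-elim (q (s≤s z≤n))
    off (suc c) d p q = trans (cong (λ b → E (suc (toℕ c)) d + b * (1ℤ + ℤ.-1ℤ * E (suc (toℕ c)) d)) (ι-no suc≁0))
      (trans (lem₂ (E (suc (toℕ c)) d)) (ι-no (p ∘ Fin~⇒≡)))
      where suc≁0 : ¬ suc (toℕ c) ~ 0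
            suc≁0 r with ~⇒≡ (Finₚ.toℕ<n (suc c)) (s≤s z≤n) r
            ... | ()

  -- Doubling fixes 0, so row 0 of `I+D` is supported at 0 and this minor carries the rest. The
  -- corner is 2 for `I+D` and 3N for `block`, whose minor has N times these rows; this is where the
  -- ratio 3 : 2 arises.
  D₀ : ℤ
  D₀ = det N′ (λ i k → row (I+D (toℕ (suc i))) (suc k))

  E₀-suc : ∀ (k : Fin N′) → E 0 (suc k) ≡ 0ℤ
  E₀-suc k = ι-no λ r → contra (~⇒≡ (s≤s z≤n) (Finₚ.toℕ<n (suc k)) r)
    where contra : ∀ {n} → 0 ≢ suc n
          contra ()

  ι-suc : ∀ (k : Fin N′) → ι (suc (toℕ k)) 0 ≡ 0ℤ
  ι-suc k = trans (ι-⇔ ~-sym ~-sym) (E₀-suc k)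

  Δ-I+D : Δ (I+D) ≡ ℤ.+ 2 * D₀
  Δ-I+D = trans (det-row₀ N′ (mat (row ∘ I+D)) (λ j → cong₂ _+_ (E₀-suc j) (E₀-suc j)))
                (cong (_* D₀) (cong₂ _+_ (ι-yes ~-refl) (ι-yes ~-refl)))

  Δ-block : Δ block ≡ ℤ.+ 3 * N̂ * (N̂ ℤ.^ N′ * D₀)
  Δ-block = trans (det-row₀ N′ (mat (row ∘ block)) (λ j → trans
      (cong (λ z → N̂ * (z + z) + z + (ι 0 0 * ℤ.+ N′) * z) (E₀-suc j)) (lem₀ N̂ (ι 0 0 * ℤ.+ N′))))
    (cong₂ _*_ (trans (cong₂ (λ z w → N̂ * (z + z) + z + (w * ℤ.+ N′) * z) (ι-yes (~-refl {0})) (ι-yes (~-refl {0}))) (lem₁ (ℤ.+ N′)))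
      (trans (det-cong N′ (λ i k → trans (cong₂ (λ z w → N̂ * row (I+D (toℕ (suc i))) (suc k) + z + (w * ℤ.+ N′) * z) (E₀-suc k) (ι-suc i))
                (lem₂ (N̂ * row (I+D (toℕ (suc i))) (suc k)) (ℤ.+ N′))))
             (det-scale N′ N̂ (λ i k → row (I+D (toℕ (suc i))) (suc k)))))
    where
    lem₀ : ∀ n s → n * (0ℤ + 0ℤ) + 0ℤ + s * 0ℤ ≡ 0ℤ
    lem₀ = solve-∀
    lem₁ : ∀ n → (1ℤ + n) * (1ℤ + 1ℤ) + 1ℤ + (1ℤ * n) * 1ℤ ≡ ℤ.+ 3 * (1ℤ + n)
    lem₁ = solve-∀
    lem₂ : ∀ x n → x + 0ℤ + (0ℤ * n) * 0ℤ ≡ x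
    lem₂ = solve-∀

  Δ-scaled-block : Δ scaled ≡ Δ block
  Δ-scaled-block = begin
    Δ scaled            ≡⟨ sym (ℤₚ.*-identityˡ (Δ scaled)) ⟩
    1ℤ * Δ scaled       ≡⟨ cong (_* Δ scaled) (sym Δ-withOnes) ⟩
    Δ withOnes * Δ scaled ≡⟨ det-subst withOnes (row ∘ scaled) X scaled-periodic (λ y j → refl) ⟩
    det N (mat X)       ≡⟨ sym (det-subst block (row ∘ withOnes) X withOnes-periodic entry) ⟩
    Δ block * Δ withOnes ≡⟨ cong (Δ block *_) Δ-withOnes ⟩
    Δ block * 1ℤ        ≡⟨ ℤₚ.*-identityʳ (Δ block) ⟩
    Δ block ∎
    where
    open ≡-Reasoning
    X : ℕ → Fin N → ℤ
    X y j = row (scaled y) j + ι y 0 * (total (row ∘ scaled) j + ℤ.-1ℤ * row (scaled y) j)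
    lem₁ : ∀ n z w p → (1ℤ + n) * ((z + 1ℤ * (1ℤ + ℤ.-1ℤ * z)) + (w + 1ℤ * (1ℤ + ℤ.-1ℤ * w))) + (p + 1ℤ * (1ℤ + ℤ.-1ℤ * p)) + (1ℤ * n) * (p + 1ℤ * (1ℤ + ℤ.-1ℤ * p))
            ≡ ((1ℤ + n) * z + (1ℤ + n) * w + 1ℤ) + 1ℤ * (((1ℤ + n) * 1ℤ + (1ℤ + n) * 1ℤ + (1ℤ + n)) + ℤ.-1ℤ * ((1ℤ + n) * z + (1ℤ + n) * w + 1ℤ))
    lem₁ = solve-∀
    lem₂ : ∀ n z w p t → (1ℤ + n) * ((z + 0ℤ * (1ℤ + ℤ.-1ℤ * z)) + (w + 0ℤ * (1ℤ + ℤ.-1ℤ * w))) + (p + 1ℤ * (1ℤ + ℤ.-1ℤ * p)) + (0ℤ * n) * (p + 1ℤ * (1ℤ + ℤ.-1ℤ * p))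
            ≡ ((1ℤ + n) * z + (1ℤ + n) * w + 1ℤ) + 0ℤ * (t + ℤ.-1ℤ * ((1ℤ + n) * z + (1ℤ + n) * w + 1ℤ))
    lem₂ = solve-∀
    L : ℤ → ℤ → ℤ
    L i z = z + i * (1ℤ + ℤ.-1ℤ * z)
    entry′ : ∀ y j i₂ i₁ → ι (2 ℕ.* y) 0 ≡ i₂ → ι y 0 ≡ i₁ →
      eval (block y) (λ z → row (withOnes z) j) (total (row ∘ withOnes) j) ≡
      N̂ * (L i₂ (E (2 ℕ.* y) j) + L i₁ (E y j)) + L 1ℤ (E 0 j) + (i₁ * ℤ.+ N′) * L 1ℤ (E 0 j)
    entry′ y j _ _ refl refl = cong (λ i → N̂ * (L (ι (2 ℕ.* y) 0) (E (2 ℕ.* y) j) + L (ι y 0) (E y j)) + L i (E 0 j) + (ι y 0 * ℤ.+ N′) * L i (E 0 j)) (ι-yes (~-refl {0}))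
    entry : ∀ y j → eval (block y) (λ z → row (withOnes z) j) (total (row ∘ withOnes) j) ≡ X y j
    entry y j with y ~? 0
    ... | yes p = trans (entry′ y j 1ℤ 1ℤ (ι-yes (~-* (~-refl {2}) p)) (ι-yes p))
                 (trans (lem₁ (ℤ.+ N′) (E (2 ℕ.* y) j) (E y j) (E 0 j))
                        (cong₂ (λ i t → row (scaled y) j + i * (t + ℤ.-1ℤ * row (scaled y) j)) (sym (ι-yes p)) (sym (total-scaled j))))
    ... | no p  = trans (entry′ y j 0ℤ 0ℤ (ι-no (p ∘ 2*-cancel)) (ι-no p))
                 (trans (lem₂ (ℤ.+ N′) (E (2 ℕ.* y) j) (E y j) (E 0 j) (total (row ∘ scaled) j))
                        (cong (λ i → row (scaled y) j + i * (total (row ∘ scaled) j + ℤ.-1ℤ * row (scaled y) j)) (sym (ι-no p))))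

  Δ-shiftsum : Δ shiftsum ≡ ℤ.+ 3 * D₀
  Δ-shiftsum = cancelˡ {N̂ ℤ.^ N} (λ p → N̂≢0 (ℤₚ.i^n≡0⇒i≡0 N̂ N p))
    (trans (sym Δ-scaled) (trans Δ-scaled-block (trans Δ-block (lem N̂ (N̂ ℤ.^ N′) D₀))))
    where
    N̂≢0 : N̂ ≢ 0ℤ
    N̂≢0 ()
    lem : ∀ n p d → ℤ.+ 3 * n * (p * d) ≡ n * p * (ℤ.+ 3 * d)
    lem = solve-∀

-- Relabelling the rows and columns of the Conway matrix

module Conway (m : ℕ) where

  open Modular (m ℕ.+ m)
  open OddModulus m
  open Doubling m

  [≡?]≡ι : ∀ x y → [ x ≡? y [mod N ] ] ≡ ι x y
  [≡?]≡ι x y with N ∣? ∣ x - y ∣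
  ... | yes p = sym (ι-yes (∣⇒~ p))
  ... | no p  = sym (ι-no (p ∘ ~⇒∣))

  quarter : ℕ
  quarter = half ℕ.* half

  4*quarter~1 : 4 ℕ.* quarter ~ 1
  4*quarter~1 = ~-trans (≡⇒~ (eq half)) (~-* 2*half~1 2*half~1)
    where eq : ∀ h → 4 ℕ.* (h ℕ.* h) ≡ 2 ℕ.* h ℕ.* (2 ℕ.* h)
          eq = ℕ-Solver.solve-∀

  -- The three congruences solved for the column by `E-affine`, whose form `N′ * s` is kept: s = 0
  -- in the first two, s = 1 in the third, which reads 4b + 1 ≡ 3a.
  conwayRow : ℕ → Lin
  conwayRow a = e (half ℕ.* (3 ℕ.* a ℕ.+ N′ ℕ.* 0)) ⊕ e (quarter ℕ.* (3 ℕ.* a ℕ.+ 1 ℕ.+ N′ ℕ.* 0))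
                ⊕ e (quarter ℕ.* (3 ℕ.* a ℕ.+ N′ ℕ.* 1))

  conwayMatrix≈ : conwayMatrix N ≈ mat (row ∘ conwayRow)
  conwayMatrix≈ a b = cong₂ _+_ (cong₂ _+_
      (trans ([≡?]≡ι _ _) (trans (cong (λ z → ι z (3 ℕ.* toℕ a)) (sym (ℕₚ.+-identityʳ (2 ℕ.* toℕ b)))) (E-affine 2 half 2*half~1 0 (toℕ b) (3 ℕ.* toℕ a))))
      (trans ([≡?]≡ι _ _) (trans (cong (λ z → ι z (3 ℕ.* toℕ a ℕ.+ 1)) (sym (ℕₚ.+-identityʳ (4 ℕ.* toℕ b)))) (E-affine 4 quarter 4*quarter~1 0 (toℕ b) (3 ℕ.* toℕ a ℕ.+ 1)))))
      (trans ([≡?]≡ι _ _) (E-affine 4 quarter 4*quarter~1 1 (toℕ b) (3 ℕ.* toℕ a)))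

  Δ-scaling4 : Δ (scaling 4) ≡ 1ℤ
  Δ-scaling4 = trans (sym (det-scaling-* 2 2)) (trans (cong₂ _*_ s s) (sign²≡1 (inversions N (λ i → (2 ℕ.* i) % N))))
    where s = det-scaling 2 half 2*half~1

  det-conway : det N (conwayMatrix N) ≡ Δ (scaling 3) * Δ shiftsum
  det-conway = begin
    det N (conwayMatrix N)       ≡⟨ det-cong N conwayMatrix≈ ⟩
    Δ conwayRow                  ≡⟨ sym (ℤₚ.*-identityʳ (Δ conwayRow)) ⟩
    Δ conwayRow * 1ℤ             ≡⟨ cong (Δ conwayRow *_) (sym Δ-scaling4) ⟩
    Δ conwayRow * Δ (scaling 4)  ≡⟨ det-subst conwayRow (row ∘ scaling 4) (λ a → row (shiftsum (3 ℕ.* a))) (scaling-periodic 4) entry ⟩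
    det N (mat (λ a → row (shiftsum (3 ℕ.* a)))) ≡⟨ sym (det-subst (scaling 3) (row ∘ shiftsum) (λ a → row (shiftsum (3 ℕ.* a))) shiftsum-periodic (λ a j → refl)) ⟩
    Δ (scaling 3) * Δ shiftsum ∎
    where
    open ≡-Reasoning
    eq₁ : ∀ h z n → 4 ℕ.* (h ℕ.* (z ℕ.+ n ℕ.* 0)) ≡ 2 ℕ.* h ℕ.* (2 ℕ.* z)
    eq₁ = ℕ-Solver.solve-∀
    cancel₄ : ∀ {z w} → z ≡ w → 4 ℕ.* (quarter ℕ.* z) ~ w
    cancel₄ {z} refl = ~-trans (≡⇒~ (sym (ℕₚ.*-assoc 4 quarter z))) (~-trans (~-* 4*quarter~1 (~-refl {z})) (≡⇒~ (ℕₚ.*-identityˡ z)))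
    eq₂ : ∀ z n → z ℕ.+ n ℕ.* 0 ≡ z
    eq₂ = ℕ-Solver.solve-∀
    entry : ∀ a j → eval (conwayRow a) (λ z → E (4 ℕ.* z) j) (total (row ∘ scaling 4) j) ≡ row (shiftsum (3 ℕ.* a)) j
    entry a j = cong₂ _+_ (cong₂ _+_
      (E-periodic (~-trans (≡⇒~ (eq₁ half (3 ℕ.* a) N′)) (~-trans (~-* 2*half~1 (~-refl {2 ℕ.* (3 ℕ.* a)})) (≡⇒~ (ℕₚ.*-identityˡ (2 ℕ.* (3 ℕ.* a)))))) j)
      (E-periodic (cancel₄ (eq₂ (3 ℕ.* a ℕ.+ 1) N′)) j))
      (E-periodic (cancel₄ (cong (3 ℕ.* a ℕ.+_) (ℕₚ.*-identityʳ N′))) j)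

-- Signs of multiplication by 2 and by 3

sumℕ-cong : ∀ n {f g : ℕ → ℕ} → (∀ i → i < n → f i ≡ g i) → sumℕ n f ≡ sumℕ n g
sumℕ-cong zero    p = refl
sumℕ-cong (suc n) p = cong₂ ℕ._+_ (p 0 (s≤s z≤n)) (sumℕ-cong n (λ i q → p (suc i) (s≤s q)))

sumℕ-+ : ∀ n (f g : ℕ → ℕ) → sumℕ n (λ i → f i ℕ.+ g i) ≡ sumℕ n f ℕ.+ sumℕ n g
sumℕ-+ zero    f g = refl
sumℕ-+ (suc n) f g = trans (cong (ℕ._+_ (f 0 ℕ.+ g 0)) (sumℕ-+ n (f ∘ suc) (g ∘ suc)))
                           (lem (f 0) (g 0) (sumℕ n (f ∘ suc)) (sumℕ n (g ∘ suc)))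
  where lem : ∀ a b c d → (a ℕ.+ b) ℕ.+ (c ℕ.+ d) ≡ (a ℕ.+ c) ℕ.+ (b ℕ.+ d)
        lem = ℕ-Solver.solve-∀

sumℕ-split : ∀ a b (f : ℕ → ℕ) → sumℕ (a ℕ.+ b) f ≡ sumℕ a f ℕ.+ sumℕ b (λ i → f (a ℕ.+ i))
sumℕ-split zero    b f = refl
sumℕ-split (suc a) b f = trans (cong (ℕ._+_ (f 0)) (sumℕ-split a b (f ∘ suc))) (sym (ℕₚ.+-assoc (f 0) _ _))

sumℕ-snoc : ∀ n (f : ℕ → ℕ) → sumℕ (suc n) f ≡ sumℕ n f ℕ.+ f n
sumℕ-snoc zero    f = ℕₚ.+-comm (f 0) 0
sumℕ-snoc (suc n) f = trans (cong (ℕ._+_ (f 0)) (sumℕ-snoc n (f ∘ suc))) (sym (ℕₚ.+-assoc (f 0) _ _))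

triangle : ℕ → ℕ
triangle zero    = 0
triangle (suc n) = suc n ℕ.+ triangle n

sumℕ-suc : ∀ n → sumℕ n suc ≡ triangle n
sumℕ-suc zero    = refl
sumℕ-suc (suc n) = trans (sumℕ-snoc n suc) (trans (ℕₚ.+-comm _ (suc n)) (cong (ℕ._+_ (suc n)) (sumℕ-suc n)))

crossings : (a b : ℕ) (g h : ℕ → ℕ) → ℕ
crossings a b g h = sumℕ a (λ i → sumℕ b (λ j → 𝟙 (h j <ᵇ g i)))

inversions-split : ∀ a b g → inversions (a ℕ.+ b) g ≡
  inversions a g ℕ.+ inversions b (λ j → g (a ℕ.+ j)) ℕ.+ crossings a b g (λ j → g (a ℕ.+ j))
inversions-split zero    b g = sym (ℕₚ.+-identityʳ _)
inversions-split (suc a) b g = trans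
  (cong₂ ℕ._+_ (sumℕ-split a b (λ j → 𝟙 (g (suc j) <ᵇ g 0))) (inversions-split a b (g ∘ suc)))
  (lem (sumℕ a (λ j → 𝟙 (g (suc j) <ᵇ g 0))) (sumℕ b (λ j → 𝟙 (g (suc (a ℕ.+ j)) <ᵇ g 0)))
       (inversions a (g ∘ suc)) (inversions b (λ j → g (suc (a ℕ.+ j)))) (crossings a b (g ∘ suc) (λ j → g (suc (a ℕ.+ j)))))
  where lem : ∀ x y i k c → (x ℕ.+ y) ℕ.+ (i ℕ.+ k ℕ.+ c) ≡ x ℕ.+ i ℕ.+ k ℕ.+ (y ℕ.+ c)
        lem = ℕ-Solver.solve-∀

crossings-split : ∀ a b c g h → crossings a (b ℕ.+ c) g h ≡ crossings a b g h ℕ.+ crossings a c g (λ j → h (b ℕ.+ j))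
crossings-split a b c g h = trans (sumℕ-cong a (λ i _ → sumℕ-split b c (λ j → 𝟙 (h j <ᵇ g i))))
  (sumℕ-+ a (λ i → sumℕ b (λ j → 𝟙 (h j <ᵇ g i))) (λ i → sumℕ c (λ j → 𝟙 (h (b ℕ.+ j) <ᵇ g i))))

<ᵇ-⇔ : ∀ {a b c d} → (a < b → c < d) → (c < d → a < b) → (a <ᵇ b) ≡ (c <ᵇ d)
<ᵇ-⇔ {a} {b} {c} {d} f g = does-⇔ (mk⇔ f g) (a ℕ.<? b) (c ℕ.<? d)

inversions-progression : ∀ u r n g → (∀ i → i < n → g i ≡ u ℕ.* i ℕ.+ r) → inversions n g ≡ 0
inversions-progression u r zero    g p = refl
inversions-progression u r (suc n) g p = cong₂ ℕ._+_
  (sumℕ-0 n (λ j q → cong 𝟙 (trans (cong₂ _<ᵇ_ (p (suc j) (s≤s q)) (p 0 (s≤s z≤n)))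
    (dec-false (u ℕ.* suc j ℕ.+ r ℕ.<? u ℕ.* 0 ℕ.+ r) (ℕₚ.≤⇒≯ (ℕₚ.+-monoˡ-≤ r (ℕₚ.*-monoʳ-≤ u {0} {suc j} z≤n)))))))
  (inversions-progression u (u ℕ.+ r) n (g ∘ suc) (λ i q → trans (p (suc i) (s≤s q)) (eq u i r)))
  where eq : ∀ u i r → u ℕ.* suc i ℕ.+ r ≡ u ℕ.* i ℕ.+ (u ℕ.+ r)
        eq = ℕ-Solver.solve-∀

-- The offsets differ by less than the step `u`, so only the indices decide.
progression-< : ∀ u r s i j → r ≤ s → s < r ℕ.+ u → (u ℕ.* j ℕ.+ s <ᵇ u ℕ.* i ℕ.+ r) ≡ (j <ᵇ i)
progression-< u r s i j r≤s s<r+u = <ᵇ-⇔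
  (λ p → ℕₚ.*-cancelˡ-< u j i (ℕₚ.+-cancelʳ-< r (u ℕ.* j) (u ℕ.* i) (ℕₚ.≤-<-trans (ℕₚ.+-monoʳ-≤ (u ℕ.* j) r≤s) p)))
  (λ p → begin-strict
    u ℕ.* j ℕ.+ s           <⟨ ℕₚ.+-monoʳ-< (u ℕ.* j) s<r+u ⟩
    u ℕ.* j ℕ.+ (r ℕ.+ u)   ≡⟨ eq u j r ⟩
    u ℕ.* suc j ℕ.+ r       ≤⟨ ℕₚ.+-monoˡ-≤ r (ℕₚ.*-monoʳ-≤ u p) ⟩
    u ℕ.* i ℕ.+ r           ∎)
  where
  open ℕₚ.≤-Reasoning
  eq : ∀ u j r → u ℕ.* j ℕ.+ (r ℕ.+ u) ≡ u ℕ.* suc j ℕ.+ r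
  eq = ℕ-Solver.solve-∀

-- Entry `i` of the first block exceeds exactly `i` entries of the second, which exist because
-- `m ≤ b`; the total is 0 + 1 + ... + m.
crossings-< : ∀ u r s m b g h → r ≤ s → s < r ℕ.+ u → m ≤ b →
  (∀ i → i < suc m → g i ≡ u ℕ.* i ℕ.+ r) → (∀ j → j < b → h j ≡ u ℕ.* j ℕ.+ s) →
  crossings (suc m) b g h ≡ triangle m
crossings-< u r s m b g h r≤s s<r+u m≤b G H = trans
  (sumℕ-cong (suc m) {_} {λ i → i} (λ i p → trans
    (sumℕ-cong b (λ j q → cong 𝟙 (trans (cong₂ _<ᵇ_ (H j q) (G i p)) (progression-< u r s i j r≤s s<r+u))))
    (count< b i (ℕₚ.≤-trans (ℕₚ.≤-pred p) m≤b))))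
  (sumℕ-suc m)

-- With the offsets reversed, entry `i` exceeds one entry more; the shorter block still yields 1 +
-- ... + m.
crossings-≤ : ∀ u r s m g h → s < r → r ≤ s ℕ.+ u →
  (∀ i → i < m → g i ≡ u ℕ.* i ℕ.+ r) → (∀ j → j < m → h j ≡ u ℕ.* j ℕ.+ s) →
  crossings m m g h ≡ triangle m
crossings-≤ u r s m g h s<r r≤s+u G H = trans
  (sumℕ-cong m {_} {suc} (λ i p → trans
    (sumℕ-cong m (λ j q → cong 𝟙 (trans (cong₂ _<ᵇ_ (H j q) (G i p)) (step i j))))
    (count< m (suc i) p)))
  (sumℕ-suc m)
  where
  open ℕₚ.≤-Reasoning
  eq : ∀ u i s → u ℕ.* i ℕ.+ (s ℕ.+ u) ≡ u ℕ.* suc i ℕ.+ s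
  eq = ℕ-Solver.solve-∀
  step : ∀ i j → (u ℕ.* j ℕ.+ s <ᵇ u ℕ.* i ℕ.+ r) ≡ (j <ᵇ suc i)
  step i j = <ᵇ-⇔
    (λ p → ℕₚ.*-cancelˡ-< u j (suc i) (ℕₚ.+-cancelʳ-< s (u ℕ.* j) (u ℕ.* suc i) (begin-strict
      u ℕ.* j ℕ.+ s         <⟨ p ⟩
      u ℕ.* i ℕ.+ r         ≤⟨ ℕₚ.+-monoʳ-≤ (u ℕ.* i) r≤s+u ⟩
      u ℕ.* i ℕ.+ (s ℕ.+ u) ≡⟨ eq u i s ⟩
      u ℕ.* suc i ℕ.+ s     ∎)))
    (λ p → begin-strict
      u ℕ.* j ℕ.+ s         ≤⟨ ℕₚ.+-monoˡ-≤ s (ℕₚ.*-monoʳ-≤ u (ℕₚ.≤-pred p)) ⟩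
      u ℕ.* i ℕ.+ s         <⟨ ℕₚ.+-monoʳ-< (u ℕ.* i) s<r ⟩
      u ℕ.* i ℕ.+ r         ∎)

%-unique : ∀ {x r} k n .{{_ : ℕ.NonZero n}} → x ≡ r ℕ.+ k ℕ.* n → r < n → x % n ≡ r
%-unique {r = r} k n refl p = trans ([m+kn]%n≡m%n r k n) (m<n⇒m%n≡m p)

sign-triple : ∀ t → sign (t ℕ.+ (t ℕ.+ t)) ≡ sign t
sign-triple t = trans (sign-+ t (t ℕ.+ t)) (trans (cong (sign t *_) (trans (sign-+ t t) (sign²≡1 t))) (ℤₚ.*-identityʳ (sign t)))

-- The values form two increasing blocks, 0, 2, ..., 2m and 1, 3, ..., 2m - 1, so every inversion
-- crosses between them. The sign is the Jacobi symbol (2/N).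
sign-double-map : ∀ m → sign (inversions (suc m ℕ.+ m) (λ i → (2 ℕ.* i) % (suc m ℕ.+ m))) ≡ sign (triangle m)
sign-double-map m = cong sign (trans (inversions-split (suc m) m g)
  (cong₂ ℕ._+_ (cong₂ ℕ._+_ (inversions-progression 2 0 (suc m) g g₁) (inversions-progression 2 1 m (λ j → g (suc m ℕ.+ j)) g₂))
    (crossings-< 2 0 1 m m g (λ j → g (suc m ℕ.+ j)) z≤n (s≤s (s≤s z≤n)) ℕₚ.≤-refl g₁ g₂)))
  where
  N = suc m ℕ.+ m
  g : ℕ → ℕ
  g i = (2 ℕ.* i) % N
  open ℕₚ.≤-Reasoning
  eq₁ : ∀ i n → 2 ℕ.* i ≡ 2 ℕ.* i ℕ.+ 0 ℕ.+ 0 ℕ.* n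
  eq₁ = ℕ-Solver.solve-∀
  eq₂ : ∀ i m → 2 ℕ.* (suc m ℕ.+ i) ≡ 2 ℕ.* i ℕ.+ 1 ℕ.+ 1 ℕ.* (suc m ℕ.+ m)
  eq₂ = ℕ-Solver.solve-∀
  eq₃ : ∀ m → suc (2 ℕ.* m ℕ.+ 0) ≡ suc m ℕ.+ m
  eq₃ = ℕ-Solver.solve-∀
  eq₄ : ∀ i → suc (2 ℕ.* i ℕ.+ 1) ≡ 2 ℕ.* suc i
  eq₄ = ℕ-Solver.solve-∀
  eq₅ : ∀ m → suc (2 ℕ.* m) ≡ suc m ℕ.+ m
  eq₅ = ℕ-Solver.solve-∀
  g₁ : ∀ i → i < suc m → g i ≡ 2 ℕ.* i ℕ.+ 0
  g₁ i p = %-unique 0 N (eq₁ i N) (begin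
    suc (2 ℕ.* i ℕ.+ 0) ≤⟨ s≤s (ℕₚ.+-monoˡ-≤ 0 (ℕₚ.*-monoʳ-≤ 2 (ℕₚ.≤-pred p))) ⟩
    suc (2 ℕ.* m ℕ.+ 0) ≡⟨ eq₃ m ⟩
    N ∎)
  g₂ : ∀ i → i < m → g (suc m ℕ.+ i) ≡ 2 ℕ.* i ℕ.+ 1
  g₂ i p = %-unique 1 N (eq₂ i m) (begin
    suc (2 ℕ.* i ℕ.+ 1) ≡⟨ eq₄ i ⟩
    2 ℕ.* suc i         ≤⟨ ℕₚ.*-monoʳ-≤ 2 p ⟩
    2 ℕ.* m             ≤⟨ ℕₚ.n≤1+n _ ⟩
    suc (2 ℕ.* m)       ≡⟨ eq₅ m ⟩
    N ∎)

inversions-3blocks : ∀ a b c g → inversions (a ℕ.+ (b ℕ.+ c)) g ≡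
  inversions a g ℕ.+ (inversions b (λ j → g (a ℕ.+ j)) ℕ.+ inversions c (λ j → g (a ℕ.+ (b ℕ.+ j)))
    ℕ.+ crossings b c (λ j → g (a ℕ.+ j)) (λ j → g (a ℕ.+ (b ℕ.+ j))))
  ℕ.+ (crossings a b g (λ j → g (a ℕ.+ j)) ℕ.+ crossings a c g (λ j → g (a ℕ.+ (b ℕ.+ j))))
inversions-3blocks a b c g = trans (inversions-split a (b ℕ.+ c) g)
  (cong₂ ℕ._+_ (cong (ℕ._+_ (inversions a g)) (inversions-split b c (λ j → g (a ℕ.+ j))))
               (crossings-split a b c g (λ j → g (a ℕ.+ j))))

-- For N = 3m + 1 the blocks of values are 0, 3, ..., 3m, then 2, 5, ..., 3m - 1, then 1, 4, ..., 3m
-- - 2. Each of the three pairs of blocks contributes `triangle m`, and three times a number has its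
-- parity.
sign-triple-map₁ : ∀ m → sign (inversions (suc m ℕ.+ (m ℕ.+ m)) (λ i → (3 ℕ.* i) % (suc m ℕ.+ (m ℕ.+ m)))) ≡ sign (triangle m)
sign-triple-map₁ m = trans (cong sign (trans (inversions-3blocks (suc m) m m g)
  (cong₂ ℕ._+_ (cong₂ ℕ._+_ (inversions-progression 3 0 (suc m) g g₁)
      (cong₂ ℕ._+_ (cong₂ ℕ._+_ (inversions-progression 3 2 m h₂ g₂) (inversions-progression 3 1 m h₃ g₃))
        (crossings-≤ 3 2 1 m h₂ h₃ (s≤s (s≤s z≤n)) (s≤s (s≤s z≤n)) g₂ g₃)))
    (cong₂ ℕ._+_ (crossings-< 3 0 2 m m g h₂ z≤n (s≤s (s≤s (s≤s z≤n))) ℕₚ.≤-refl g₁ g₂)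
                 (crossings-< 3 0 1 m m g h₃ z≤n (s≤s (s≤s z≤n)) ℕₚ.≤-refl g₁ g₃)))))
  (sign-triple (triangle m))
  where
  N = suc m ℕ.+ (m ℕ.+ m)
  g h₂ h₃ : ℕ → ℕ
  g i = (3 ℕ.* i) % N
  h₂ j = g (suc m ℕ.+ j)
  h₃ j = g (suc m ℕ.+ (m ℕ.+ j))
  open ℕₚ.≤-Reasoning
  eq₁ : ∀ i n → 3 ℕ.* i ≡ 3 ℕ.* i ℕ.+ 0 ℕ.+ 0 ℕ.* n
  eq₁ = ℕ-Solver.solve-∀
  eq₂ : ∀ i m → 3 ℕ.* (suc m ℕ.+ i) ≡ 3 ℕ.* i ℕ.+ 2 ℕ.+ 1 ℕ.* (suc m ℕ.+ (m ℕ.+ m))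
  eq₂ = ℕ-Solver.solve-∀
  eq₃ : ∀ i m → 3 ℕ.* (suc m ℕ.+ (m ℕ.+ i)) ≡ 3 ℕ.* i ℕ.+ 1 ℕ.+ 2 ℕ.* (suc m ℕ.+ (m ℕ.+ m))
  eq₃ = ℕ-Solver.solve-∀
  eq₄ : ∀ m → suc (3 ℕ.* m ℕ.+ 0) ≡ suc m ℕ.+ (m ℕ.+ m)
  eq₄ = ℕ-Solver.solve-∀
  eq₅ : ∀ i → suc (3 ℕ.* i ℕ.+ 2) ≡ 3 ℕ.* suc i
  eq₅ = ℕ-Solver.solve-∀
  eq₆ : ∀ m → suc (3 ℕ.* m) ≡ suc m ℕ.+ (m ℕ.+ m)
  eq₆ = ℕ-Solver.solve-∀
  small : ∀ r i → r ≤ 2 → i < m → 3 ℕ.* i ℕ.+ r < N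
  small r i q p = begin
    suc (3 ℕ.* i ℕ.+ r) ≤⟨ s≤s (ℕₚ.+-monoʳ-≤ (3 ℕ.* i) q) ⟩
    suc (3 ℕ.* i ℕ.+ 2) ≡⟨ eq₅ i ⟩
    3 ℕ.* suc i         ≤⟨ ℕₚ.*-monoʳ-≤ 3 p ⟩
    3 ℕ.* m             ≤⟨ ℕₚ.n≤1+n _ ⟩
    suc (3 ℕ.* m)       ≡⟨ eq₆ m ⟩
    N ∎
  g₁ : ∀ i → i < suc m → g i ≡ 3 ℕ.* i ℕ.+ 0
  g₁ i p = %-unique 0 N (eq₁ i N) (begin
    suc (3 ℕ.* i ℕ.+ 0) ≤⟨ s≤s (ℕₚ.+-monoˡ-≤ 0 (ℕₚ.*-monoʳ-≤ 3 (ℕₚ.≤-pred p))) ⟩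
    suc (3 ℕ.* m ℕ.+ 0) ≡⟨ eq₄ m ⟩
    N ∎)
  g₂ : ∀ i → i < m → h₂ i ≡ 3 ℕ.* i ℕ.+ 2
  g₂ i p = %-unique 1 N (eq₂ i m) (small 2 i ℕₚ.≤-refl p)
  g₃ : ∀ i → i < m → h₃ i ≡ 3 ℕ.* i ℕ.+ 1
  g₃ i p = %-unique 2 N (eq₃ i m) (small 1 i (s≤s z≤n) p)

-- For N = 3m + 2 the blocks are 0, 3, ..., 3m, then 1, 4, ..., 3m + 1, then 2, 5, ..., 3m - 1;
-- again each pair contributes `triangle m`.
sign-triple-map₂ : ∀ m → sign (inversions (suc m ℕ.+ (suc m ℕ.+ m)) (λ i → (3 ℕ.* i) % (suc m ℕ.+ (suc m ℕ.+ m)))) ≡ sign (triangle m)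
sign-triple-map₂ m = trans (cong sign (trans (inversions-3blocks (suc m) (suc m) m g)
  (cong₂ ℕ._+_ (cong₂ ℕ._+_ (inversions-progression 3 0 (suc m) g g₁)
      (cong₂ ℕ._+_ (cong₂ ℕ._+_ (inversions-progression 3 1 (suc m) h₂ g₂) (inversions-progression 3 2 m h₃ g₃))
        (crossings-< 3 1 2 m m h₂ h₃ (s≤s z≤n) (s≤s (s≤s (s≤s z≤n))) ℕₚ.≤-refl g₂ g₃)))
    (cong₂ ℕ._+_ (crossings-< 3 0 1 m (suc m) g h₂ z≤n (s≤s (s≤s z≤n)) (ℕₚ.n≤1+n m) g₁ g₂)
                 (crossings-< 3 0 2 m m g h₃ z≤n (s≤s (s≤s (s≤s z≤n))) ℕₚ.≤-refl g₁ g₃)))))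
  (sign-triple (triangle m))
  where
  N = suc m ℕ.+ (suc m ℕ.+ m)
  g h₂ h₃ : ℕ → ℕ
  g i = (3 ℕ.* i) % N
  h₂ j = g (suc m ℕ.+ j)
  h₃ j = g (suc m ℕ.+ (suc m ℕ.+ j))
  open ℕₚ.≤-Reasoning
  eq₁ : ∀ i n → 3 ℕ.* i ≡ 3 ℕ.* i ℕ.+ 0 ℕ.+ 0 ℕ.* n
  eq₁ = ℕ-Solver.solve-∀
  eq₂ : ∀ i m → 3 ℕ.* (suc m ℕ.+ i) ≡ 3 ℕ.* i ℕ.+ 1 ℕ.+ 1 ℕ.* (suc m ℕ.+ (suc m ℕ.+ m))
  eq₂ = ℕ-Solver.solve-∀
  eq₃ : ∀ i m → 3 ℕ.* (suc m ℕ.+ (suc m ℕ.+ i)) ≡ 3 ℕ.* i ℕ.+ 2 ℕ.+ 2 ℕ.* (suc m ℕ.+ (suc m ℕ.+ m))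
  eq₃ = ℕ-Solver.solve-∀
  eq₅ : ∀ i → suc (3 ℕ.* i ℕ.+ 2) ≡ 3 ℕ.* suc i
  eq₅ = ℕ-Solver.solve-∀
  eq₆ : ∀ m → suc (suc (3 ℕ.* m)) ≡ suc m ℕ.+ (suc m ℕ.+ m)
  eq₆ = ℕ-Solver.solve-∀
  small : ∀ r i → r ≤ 1 → i < suc m → 3 ℕ.* i ℕ.+ r < N
  small r i q p = begin
    suc (3 ℕ.* i ℕ.+ r) ≤⟨ s≤s (ℕₚ.+-mono-≤ (ℕₚ.*-monoʳ-≤ 3 (ℕₚ.≤-pred p)) q) ⟩
    suc (3 ℕ.* m ℕ.+ 1) ≡⟨ cong suc (ℕₚ.+-comm (3 ℕ.* m) 1) ⟩
    suc (suc (3 ℕ.* m)) ≡⟨ eq₆ m ⟩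
    N ∎
  g₁ : ∀ i → i < suc m → g i ≡ 3 ℕ.* i ℕ.+ 0
  g₁ i p = %-unique 0 N (eq₁ i N) (small 0 i z≤n p)
  g₂ : ∀ i → i < suc m → h₂ i ≡ 3 ℕ.* i ℕ.+ 1
  g₂ i p = %-unique 1 N (eq₂ i m) (small 1 i ℕₚ.≤-refl p)
  g₃ : ∀ i → i < m → h₃ i ≡ 3 ℕ.* i ℕ.+ 2
  g₃ i p = %-unique 2 N (eq₃ i m) (begin
    suc (3 ℕ.* i ℕ.+ 2) ≡⟨ eq₅ i ⟩
    3 ℕ.* suc i         ≤⟨ ℕₚ.*-monoʳ-≤ 3 p ⟩
    3 ℕ.* m             ≤⟨ ℕₚ.m≤n⇒m≤1+n (ℕₚ.n≤1+n _) ⟩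
    suc (suc (3 ℕ.* m)) ≡⟨ eq₆ m ⟩
    N ∎)

-- The four new summands add up to 4m + 10, which is even.
sign-triangle-period : ∀ m → sign (triangle (4 ℕ.+ m)) ≡ sign (triangle m)
sign-triangle-period m = trans (cong sign (eq m (triangle m))) (trans (sign-+ (2 ℕ.* m ℕ.+ 5 ℕ.+ (2 ℕ.* m ℕ.+ 5)) (triangle m))
  (trans (cong (_* sign (triangle m)) (trans (sign-+ (2 ℕ.* m ℕ.+ 5) (2 ℕ.* m ℕ.+ 5)) (sign²≡1 (2 ℕ.* m ℕ.+ 5)))) (ℤₚ.*-identityˡ _)))
  where eq : ∀ m t → 4 ℕ.+ m ℕ.+ (3 ℕ.+ m ℕ.+ (2 ℕ.+ m ℕ.+ (1 ℕ.+ m ℕ.+ t))) ≡ 2 ℕ.* m ℕ.+ 5 ℕ.+ (2 ℕ.* m ℕ.+ 5) ℕ.+ t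
        eq = ℕ-Solver.solve-∀

sign-triangle : ∀ t r → sign (triangle (r ℕ.+ 4 ℕ.* t)) ≡ sign (triangle r)
sign-triangle zero    r = cong (sign ∘ triangle) (ℕₚ.+-identityʳ r)
sign-triangle (suc t) r = trans (cong (sign ∘ triangle) (eq r t)) (trans (sign-triangle-period (r ℕ.+ 4 ℕ.* t)) (sign-triangle t r))
  where eq : ∀ r t → r ℕ.+ 4 ℕ.* suc t ≡ 4 ℕ.+ (r ℕ.+ 4 ℕ.* t)
        eq = ℕ-Solver.solve-∀

-- The order of 2

least : ∀ {P : ℕ → Set} → (∀ n → Dec (P n)) → ∀ n → P n → ∃ λ k → P k × (∀ j → j < k → ¬ P j)
least {P} P? n p with search (suc n)
  where
  search : ∀ n → (∃ λ k → P k × (∀ j → j < k → ¬ P j)) ⊎ (∀ j → j < n → ¬ P j)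
  search zero = inj₂ λ _ ()
  search (suc n) with search n
  ... | inj₁ found = inj₁ found
  ... | inj₂ none with P? n
  ...   | yes p = inj₁ (n , p , none)
  ...   | no ¬p = inj₂ λ j j<1+n q → none j (ℕₚ.≤∧≢⇒< (ℕₚ.≤-pred j<1+n) (λ { refl → ¬p q })) q
... | inj₁ found = found
... | inj₂ none  = ⊥-elim (none n ℕₚ.≤-refl p)

record IsOrder (d k : ℕ) : Set where
  field
    positive : 0 < k
    period   : d ∣ ∣ 2 ℕ.^ k - 1 ∣
    minimal  : ∀ j → 0 < j → d ∣ ∣ 2 ℕ.^ j - 1 ∣ → k ≤ j

-- The witness `j` lies in the range that the fuel still covers, which excludes the default 0.
-- Minimality is claimed only from `k` on, since the search has rejected the earlier exponents.
ordAux-spec : ∀ d f k j → k ≤ j → j < k ℕ.+ f → d ∣ ∣ 2 ℕ.^ j - 1 ∣ →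
  k ≤ ordAux d f k × d ∣ ∣ 2 ℕ.^ ordAux d f k - 1 ∣ × (∀ i → k ≤ i → d ∣ ∣ 2 ℕ.^ i - 1 ∣ → ordAux d f k ≤ i)
ordAux-spec d zero    k j k≤j j<k p = ⊥-elim (ℕₚ.<⇒≱ (subst (j <_) (ℕₚ.+-identityʳ k) j<k) k≤j)
ordAux-spec d (suc f) k j k≤j j<k p with d ∣? ∣ 2 ℕ.^ k - 1 ∣
... | yes q = ℕₚ.≤-refl , q , λ i k≤i _ → k≤i
... | no ¬q with ordAux-spec d f (suc k) j (next j k≤j p) (subst (j <_) (ℕₚ.+-suc k f) j<k) p
  where
  next : ∀ i → k ≤ i → d ∣ ∣ 2 ℕ.^ i - 1 ∣ → suc k ≤ i
  next i k≤i p = ℕₚ.≤∧≢⇒< k≤i (λ { refl → ¬q p })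
...   | a , b , c = ℕₚ.<⇒≤ a , b , λ i k≤i r → c i (ℕₚ.≤∧≢⇒< k≤i (λ { refl → ¬q r })) r

odd⇒1+m+m : ∀ n → ¬ 2 ∣ n → ∃ λ m → n ≡ suc (m ℕ.+ m)
odd⇒1+m+m zero          p = ⊥-elim (p (divides 0 refl))
odd⇒1+m+m (suc zero)    p = 0 , refl
odd⇒1+m+m (suc (suc n)) p with odd⇒1+m+m n (λ { (divides q e) → p (divides (suc q) (cong (λ z → suc (suc z)) e)) })
... | m , e = suc m , cong (λ z → suc (suc z)) (trans e (sym (ℕₚ.+-suc m m)))

-- Among the powers 2^0, ..., 2^d two agree modulo d. As 2 can be cancelled, the difference of their
-- exponents is a period between 1 and d, exactly the range that `ord2` searches.
ord2-isOrder : ∀ d → ¬ 2 ∣ d → IsOrder d (ord2 d)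
ord2-isOrder d odd with odd⇒1+m+m d odd
... | m , refl with Finₚ.pigeonhole (ℕₚ.n<1+n d) (λ i → Modular.residue (m ℕ.+ m) (2 ℕ.^ toℕ i))
...   | i , j , i<j , collision = record { positive = proj₁ spec ; period = proj₁ (proj₂ spec) ; minimal = proj₂ (proj₂ spec) }
  where
  open Modular (m ℕ.+ m)
  open OddModulus m
  t = toℕ j ℕ.∸ toℕ i
  i+t : toℕ i ℕ.+ t ≡ toℕ j
  i+t = ℕₚ.m+[n∸m]≡n (ℕₚ.<⇒≤ i<j)
  2^t~1 : 2 ℕ.^ t ~ 1
  2^t~1 = ~-sym (2^*-cancel (toℕ i) (~-trans (≡⇒~ (ℕₚ.*-identityʳ (2 ℕ.^ toℕ i)))
    (~-trans (~-trans (~-sym (residue~ _)) (~-trans (≡⇒~ (cong toℕ collision)) (residue~ _)))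
             (≡⇒~ (trans (cong (2 ℕ.^_) (sym i+t)) (ℕₚ.^-distribˡ-+-* 2 (toℕ i) t))))))
  spec = ordAux-spec d d 1 t (ℕₚ.m<n⇒0<n∸m i<j)
    (s≤s (ℕₚ.≤-trans (ℕₚ.m∸n≤m (toℕ j) (toℕ i)) (ℕₚ.≤-pred (Finₚ.toℕ<n j)))) (~⇒∣ 2^t~1)

-- An odd exponent k with 2^k ≡ 1

∣x-1∣⇒ : ∀ {d x} → 0 < x → d ∣ ∣ x - 1 ∣ → ∃ λ q → x ≡ suc (q ℕ.* d)
∣x-1∣⇒ {x = suc x} _ (divides q e) = q , cong suc (trans (sym (ℕₚ.∣-∣-identityʳ x)) e)

⇒∣x-1∣ : ∀ {d x} → (∃ λ q → x ≡ suc (q ℕ.* d)) → d ∣ ∣ x - 1 ∣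
⇒∣x-1∣ (q , refl) = divides q (ℕₚ.∣-∣-identityʳ _)

binomial : ∀ y n → ∃ λ z → suc y ℕ.^ n ≡ suc (n ℕ.* y ℕ.+ y ℕ.* y ℕ.* z)
binomial y zero    = 0 , cong suc (sym (ℕₚ.*-zeroʳ (y ℕ.* y)))
binomial y (suc n) with binomial y n
... | z , e = z ℕ.+ n ℕ.+ y ℕ.* z , trans (cong (suc y ℕ.*_) e) (eq y n z)
  where eq : ∀ y n z → (1 ℕ.+ y) ℕ.* (1 ℕ.+ (n ℕ.* y ℕ.+ y ℕ.* y ℕ.* z)) ≡ 1 ℕ.+ ((1 ℕ.+ n) ℕ.* y ℕ.+ y ℕ.* y ℕ.* (z ℕ.+ n ℕ.+ y ℕ.* z))
        eq = ℕ-Solver.solve-∀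

^-≡1 : ∀ {M x} n → (∃ λ q → x ≡ suc (q ℕ.* M)) → ∃ λ q → x ℕ.^ n ≡ suc (q ℕ.* M)
^-≡1 {M} n (q , refl) with binomial (q ℕ.* M) n
... | z , e = n ℕ.* q ℕ.+ q ℕ.* q ℕ.* M ℕ.* z , trans e (cong suc (eq n q M z))
  where eq : ∀ n q M z → n ℕ.* (q ℕ.* M) ℕ.+ q ℕ.* M ℕ.* (q ℕ.* M) ℕ.* z ≡ (n ℕ.* q ℕ.+ q ℕ.* q ℕ.* M ℕ.* z) ℕ.* M
        eq = ℕ-Solver.solve-∀

-- Write x = 1 + y. In the binomial expansion of the p-th power, p M divides the linear term p y; in
-- the higher terms one factor y supplies p and another supplies M.
^-lift : ∀ {M p x} → (∃ λ q → x ≡ suc (q ℕ.* M)) → (∃ λ q → x ≡ suc (q ℕ.* p)) →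
         ∃ λ q → x ℕ.^ p ≡ suc (q ℕ.* (p ℕ.* M))
^-lift {M} {p} (q , refl) (r , e) with binomial (q ℕ.* M) p
... | z , f = q ℕ.+ r ℕ.* q ℕ.* z , trans f (cong suc (trans (cong (λ y → p ℕ.* (q ℕ.* M) ℕ.+ y ℕ.* (q ℕ.* M) ℕ.* z) (ℕₚ.suc-injective e)) (eq p q M r z)))
  where eq : ∀ p q M r z → p ℕ.* (q ℕ.* M) ℕ.+ r ℕ.* p ℕ.* (q ℕ.* M) ℕ.* z ≡ (q ℕ.+ r ℕ.* q ℕ.* z) ℕ.* (p ℕ.* M)
        eq = ℕ-Solver.solve-∀

odd-* : ∀ {a b} → ¬ 2 ∣ a → ¬ 2 ∣ b → ¬ 2 ∣ a ℕ.* b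
odd-* {a} {b} p q r with euclidsLemma a b prime[2] r
... | inj₁ s = p s
... | inj₂ s = q s

¬2∣1 : ¬ 2 ∣ 1
¬2∣1 (divides (suc _) ())

-- The exponent is `k * o * p`: `k` serves the remaining factors, `o` makes the power 1 modulo `p`
-- as well, and the extra `p` merges both congruences into one modulo the product. Repeated primes
-- are thus treated like new ones, and all three factors are odd.
odd-period-product : ∀ ps → All Prime ps → (∀ p → Prime p → p ∣ product ps → ¬ 2 ∣ p) →
  (∀ p → Prime p → p ∣ product ps → ¬ 2 ∣ ord2 p) →
  ∃ λ k → ¬ 2 ∣ k × ∃ λ q → 2 ℕ.^ k ≡ suc (q ℕ.* product ps)
odd-period-product [] [] odd ordOdd = 1 , ¬2∣1 , 1 , refl
odd-period-product (p ∷ ps) (prp ∷ prs) odd ordOdd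
  with odd-period-product ps prs (λ q pr d → odd q pr (∣n⇒∣m*n p d)) (λ q pr d → ordOdd q pr (∣n⇒∣m*n p d))
... | k , k-odd , 2^k≡1 = k ℕ.* o ℕ.* p , odd-* (odd-* k-odd (ordOdd p prp (m∣m*n _))) (odd p prp (m∣m*n _)) ,
  proj₁ lifted , trans (sym (ℕₚ.^-*-assoc 2 (k ℕ.* o) p)) (proj₂ lifted)
  where
  o = ord2 p
  mod-M : ∃ λ q → 2 ℕ.^ (k ℕ.* o) ≡ suc (q ℕ.* product ps)
  mod-M = subst (λ x → ∃ λ q → x ≡ suc (q ℕ.* product ps)) (ℕₚ.^-*-assoc 2 k o) (^-≡1 o 2^k≡1)
  mod-p : ∃ λ q → 2 ℕ.^ (k ℕ.* o) ≡ suc (q ℕ.* p)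
  mod-p = subst (λ x → ∃ λ q → x ≡ suc (q ℕ.* p)) (trans (ℕₚ.^-*-assoc 2 o k) (cong (2 ℕ.^_) (ℕₚ.*-comm o k)))
    (^-≡1 k (∣x-1∣⇒ (ℕₚ.m^n>0 2 o) (IsOrder.period (ord2-isOrder p (odd p prp (m∣m*n _))))))
  lifted = ^-lift {product ps} {p} mod-M mod-p

odd-period : ∀ N → ¬ 2 ∣ N → (∀ p → Prime p → p ∣ N → ¬ 2 ∣ ord2 p) →
  ∃ λ k → ¬ 2 ∣ k × N ∣ ∣ 2 ℕ.^ k - 1 ∣
odd-period zero    odd ordOdd = ⊥-elim (odd (divides 0 refl))
odd-period (suc n) odd ordOdd = go (PrimeFactorisation.factors F) (PrimeFactorisation.isFactorisation F) (PrimeFactorisation.factorsPrime F)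
  where
  F = factorise (suc n)
  go : ∀ ps → suc n ≡ product ps → All Prime ps → ∃ λ k → ¬ 2 ∣ k × suc n ∣ ∣ 2 ℕ.^ k - 1 ∣
  go ps e prs with odd-period-product ps prs (λ p _ d 2∣p → odd (∣-trans 2∣p (subst (p ∣_) (sym e) d))) (λ p pr d → ordOdd p pr (subst (p ∣_) (sym e) d))
  ... | k , k-odd , c = k , k-odd , subst (_∣ ∣ 2 ℕ.^ k - 1 ∣) (sym e) (⇒∣x-1∣ c)

-- The determinant of 1 + D by orbits of doubling

det-zero-row : ∀ n (A : Rows n n) i → (∀ j → A i j ≡ 0ℤ) → det n A ≡ 0ℤ
det-zero-row n A i z = det-lin n A A i 0ℤ 0ℤ (λ _ _ _ → refl) (λ _ _ _ → refl) z

prodFin-2^ : ∀ n (g : ℕ → ℕ) → prodFin n (λ i → ℤ.+ (2 ℕ.^ g (toℕ i))) ≡ ℤ.+ (2 ℕ.^ sumℕ n g)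
prodFin-2^ zero    g = refl
prodFin-2^ (suc n) g = trans (cong (ℤ.+ (2 ℕ.^ g 0) *_) (prodFin-2^ n (g ∘ suc)))
  (trans (sym (ℤₚ.pos-* (2 ℕ.^ g 0) (2 ℕ.^ sumℕ n (g ∘ suc)))) (cong ℤ.+_ (sym (ℕₚ.^-distribˡ-+-* 2 (g 0) (sumℕ n (g ∘ suc))))))

sign-odd : ∀ k → ¬ 2 ∣ k → sign k ≡ ℤ.-1ℤ
sign-odd k p with odd⇒1+m+m k p
... | m , refl = cong -_ (trans (sign-+ m m) (sign²≡1 m))

sign-even : ∀ k → 2 ∣ k → sign k ≡ 1ℤ
sign-even k (divides q refl) = trans (cong sign (trans (ℕₚ.*-comm q 2) (cong (q ℕ.+_) (ℕₚ.+-identityʳ q)))) (trans (sign-+ q q) (sign²≡1 q))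

module DoublingOrbits (m : ℕ) where

  open Modular (m ℕ.+ m)
  open OddModulus m
  open Doubling m

  sumTo-0 : ∀ n {f : ℕ → ℤ} → (∀ j → j < n → f j ≡ 0ℤ) → sumTo n f ≡ 0ℤ
  sumTo-0 zero    p = refl
  sumTo-0 (suc n) p = cong₂ _+_ (sumTo-0 n (λ j q → p j (ℕₚ.m<n⇒m<1+n q))) (p n ℕₚ.≤-refl)

  sumTo-first : ∀ n {f : ℕ → ℤ} → (∀ j → 0 < j → j < suc n → f j ≡ 0ℤ) → sumTo (suc n) f ≡ f 0
  sumTo-first zero    {f} p = ℤₚ.+-identityˡ (f 0)
  sumTo-first (suc n) {f} p = trans (cong₂ _+_ (sumTo-first n (λ j q r → p j q (ℕₚ.m<n⇒m<1+n r))) (p (suc n) (s≤s z≤n) ℕₚ.≤-refl))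
                                    (ℤₚ.+-identityʳ (f 0))

  telescope : ∀ n (f : ℕ → ℤ) → sumTo n (λ j → sign j * (f (suc j) + f j)) ≡ f 0 + - (sign n * f n)
  telescope zero    f = lem (f 0)
    where lem : ∀ x → 0ℤ ≡ x + - (1ℤ * x)
          lem = solve-∀
  telescope (suc n) f = trans (cong (_+ sign n * (f (suc n) + f n)) (telescope n f)) (lem (f 0) (sign n) (f n) (f (suc n)))
    where lem : ∀ a s x y → (a + - (s * x)) + s * (y + x) ≡ a + - (- s * y)
          lem = solve-∀

  -- S picks at most one element c from each orbit, and L c is the length of the
  -- orbit; the alternating sum of the rows along the orbit telescopes.
  module AlternatingSums (S : ℕ → Set) (S? : ∀ c → Dec (S c)) (L : ℕ → ℕ)
    (L>0 : ∀ c → 0 < L c)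
    (L-period : ∀ c → S c → 2 ℕ.^ L c ℕ.* c ~ c)
    (L-minimal : ∀ c → S c → ∀ j → 0 < j → j < L c → ¬ 2 ℕ.^ j ℕ.* c ~ c)
    (S-unique : ∀ c d j → S c → S d → 2 ℕ.^ j ℕ.* c ~ d → c ~ d) where

    U : ℕ → Lin
    U c = if does (S? c) then ⨁ (L c) (λ j → sign j ⊙ e (2 ℕ.^ j ℕ.* c)) else e c

    U-yes : ∀ c → S c → U c ≡ ⨁ (L c) (λ j → sign j ⊙ e (2 ℕ.^ j ℕ.* c))
    U-yes c p rewrite dec-true (S? c) p = refl

    U-no : ∀ c → ¬ S c → U c ≡ e c
    U-no c p rewrite dec-false (S? c) p = refl

    -- In the row of a chosen element its own coefficient is 1, because no shorter power returns to
    -- it, and no other chosen element occurs. So the two ranks 1 on `S` and 0 off it suffice.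
    Δ-U : Δ U ≡ 1ℤ
    Δ-U = det-unitriangular N (mat (row ∘ U)) ρ diag off
      where
      ρ : Fin N → ℕ
      ρ c = 𝟙 (does (S? (toℕ c)))
      sum₁ : ∀ n c → 0 < n → S c → (∀ j → 0 < j → j < n → ¬ 2 ℕ.^ j ℕ.* c ~ c) → sumTo n (λ j → sign j * ι (2 ℕ.^ j ℕ.* c) c) ≡ 1ℤ
      sum₁ (suc n) c _ s min = trans (sumTo-first n (λ j p q → trans (cong (sign j *_) (ι-no (min j p q))) (ℤₚ.*-zeroʳ (sign j))))
        (trans (ℤₚ.*-identityˡ _) (ι-yes (≡⇒~ (ℕₚ.*-identityˡ c))))
      diag : ∀ c → mat (row ∘ U) c c ≡ 1ℤ
      diag c = helper (S? (toℕ c))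
        where
        helper : Dec (S (toℕ c)) → row (U (toℕ c)) c ≡ 1ℤ
        helper (yes s) = trans (cong (λ l → row l c) (U-yes (toℕ c) s)) (sum₁ (L (toℕ c)) (toℕ c) (L>0 (toℕ c)) s (L-minimal (toℕ c) s))
        helper (no s)  = trans (cong (λ l → row l c) (U-no (toℕ c) s)) (ι-yes ~-refl)
      off : ∀ c d → c ≢ d → ¬ (ρ d < ρ c) → mat (row ∘ U) c d ≡ 0ℤ
      off c d c≢d nlt = helper (S? (toℕ c)) (S? (toℕ d))
        where
        helper : Dec (S (toℕ c)) → Dec (S (toℕ d)) → row (U (toℕ c)) d ≡ 0ℤ
        helper (no s)  _       = trans (cong (λ l → row l d) (U-no (toℕ c) s)) (ι-no (c≢d ∘ Fin~⇒≡))
        helper (yes s) (yes t) = trans (cong (λ l → row l d) (U-yes (toℕ c) s)) (sumTo-0 (L (toℕ c)) (λ j _ →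
          trans (cong (sign j *_) (ι-no (λ p → c≢d (Fin~⇒≡ (S-unique _ _ j s t p))))) (ℤₚ.*-zeroʳ (sign j))))
        helper (yes s) (no t)  = ⊥-elim (nlt lt)
          where lt : ρ d < ρ c
                lt rewrite dec-true (S? (toℕ c)) s | dec-false (S? (toℕ d)) t = s≤s z≤n

    -- Left multiplication by `U` keeps the determinant and replaces the row of each chosen `c` by 1
    -- - (-1)^L times a unit row. `X` is a parameter so that each use may present these rows in its
    -- own form.
    Δ-telescoped : (X : ℕ → Fin N → ℤ) →
      (∀ c j → S c → X c j ≡ E c j + - (sign (L c) * E c j)) →
      (∀ c j → ¬ S c → X c j ≡ row (I+D c) j) → Δ (I+D) ≡ det N (mat X)
    Δ-telescoped X X-yes X-no = trans (sym (trans (cong (_* Δ (I+D)) Δ-U) (ℤₚ.*-identityˡ (Δ (I+D)))))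
      (det-subst U (row ∘ I+D) X I+D-periodic entry)
      where
      entry : ∀ c j → eval (U c) (λ y → row (I+D y) j) (total (row ∘ I+D) j) ≡ X c j
      entry c j = helper (S? c)
        where
        ev : Lin → ℤ
        ev l = eval l (λ y → row (I+D y) j) (total (row ∘ I+D) j)
        f : ℕ → ℤ
        f i = E (2 ℕ.^ i ℕ.* c) j
        helper : Dec (S c) → ev (U c) ≡ X c j
        helper (no s)  = trans (cong ev (U-no c s)) (sym (X-no c j s))
        helper (yes s) = trans (cong ev (U-yes c s)) (trans
          (sumTo-cong (L c) (λ i → cong (λ z → sign i * (E z j + f i)) (sym (ℕₚ.*-assoc 2 (2 ℕ.^ i) c))))
          (trans (telescope (L c) f)
          (trans (cong₂ (λ a b → a + - (sign (L c) * b)) (E-periodic (≡⇒~ (ℕₚ.*-identityˡ c)) j) (E-periodic (L-period c s) j))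
                 (sym (X-yes c j s)))))

  -- A single orbit of even length suffices: only `a` is chosen, and its alternating sum telescopes
  -- to the zero row.
  even-orbit : ∀ a k → 0 < k → 2 ∣ k → 2 ℕ.^ k ℕ.* a ~ a → (∀ j → 0 < j → j < k → ¬ 2 ℕ.^ j ℕ.* a ~ a) → Δ (I+D) ≡ 0ℤ
  even-orbit a k k>0 even per min =
    trans (Δ-telescoped X (λ c j s → trans (X-yes c j s) (sym (trans (cong (λ z → E c j + - (z * E c j)) (sign-even k even)) (lem (E c j)))))
                          X-no)
          (det-zero-row N (mat X) (residue a) (λ j → X-yes (toℕ (residue a)) j (residue~ a)))
    where
    lem : ∀ x → x + - (1ℤ * x) ≡ 0ℤ
    lem = solve-∀
    transport : ∀ {c} j → c ~ a → 2 ℕ.^ j ℕ.* c ~ 2 ℕ.^ j ℕ.* a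
    transport j p = ~-* (~-refl {2 ℕ.^ j}) p
    open AlternatingSums (_~ a) (_~? a) (λ _ → k) (λ _ → k>0)
      (λ c p → ~-trans (transport k p) (~-trans per (~-sym p)))
      (λ c p j j>0 j<k q → min j j>0 j<k (~-trans (~-sym (transport j p)) (~-trans q p)))
      (λ c d j p q _ → ~-trans p (~-sym q))
    X : ℕ → Fin N → ℤ
    X c j = if does (c ~? a) then 0ℤ else row (I+D c) j
    X-yes : ∀ c j → c ~ a → X c j ≡ 0ℤ
    X-yes c j p rewrite dec-true (c ~? a) p = refl
    X-no : ∀ c j → ¬ c ~ a → X c j ≡ row (I+D c) j
    X-no c j p rewrite dec-false (c ~? a) p = refl

  2^+ : ∀ i j c → 2 ℕ.^ (i ℕ.+ j) ℕ.* c ≡ 2 ℕ.^ i ℕ.* (2 ℕ.^ j ℕ.* c)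
  2^+ i j c = trans (cong (ℕ._* c) (ℕₚ.^-distribˡ-+-* 2 i j)) (ℕₚ.*-assoc (2 ℕ.^ i) (2 ℕ.^ j) c)

  period-* : ∀ L c → 2 ℕ.^ L ℕ.* c ~ c → ∀ q → 2 ℕ.^ (q ℕ.* L) ℕ.* c ~ c
  period-* L c p zero    = ≡⇒~ (ℕₚ.*-identityˡ c)
  period-* L c p (suc q) = ~-trans (≡⇒~ (2^+ L (q ℕ.* L) c)) (~-trans (~-* (~-refl {2 ℕ.^ L}) (period-* L c p q)) p)

  period-% : ∀ L .{{_ : ℕ.NonZero L}} c → 2 ℕ.^ L ℕ.* c ~ c → ∀ j → 2 ℕ.^ j ℕ.* c ~ 2 ℕ.^ (j % L) ℕ.* c
  period-% L c p j = ~-trans (≡⇒~ (trans (cong (λ z → 2 ℕ.^ z ℕ.* c) (m≡m%n+[m/n]*n j L)) (2^+ (j % L) (j ℕ./ L ℕ.* L) c)))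
    (~-* (~-refl {2 ℕ.^ (j % L)}) (period-* L c p (j ℕ./ L)))

  module Representatives (κ′ : ℕ) (2^κ~1 : 2 ℕ.^ suc κ′ ~ 1) where

    κ : ℕ
    κ = suc κ′

    κ-period : ∀ c → 2 ℕ.^ κ ℕ.* c ~ c
    κ-period c = ~-trans (~-* 2^κ~1 (~-refl {c})) (≡⇒~ (ℕₚ.*-identityˡ c))

    -- Multiplication by 2^j is undone by a further power of 2, since j κ′ + j = j κ.
    back : ∀ j {c d} → 2 ℕ.^ j ℕ.* c ~ d → 2 ℕ.^ (j ℕ.* κ′) ℕ.* d ~ c
    back j {c} {d} p = ~-trans (~-* (~-refl {2 ℕ.^ (j ℕ.* κ′)}) (~-sym p)) (~-trans (≡⇒~ (trans (sym (2^+ (j ℕ.* κ′) j c))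
      (cong (λ z → 2 ℕ.^ z ℕ.* c) (trans (ℕₚ.+-comm (j ℕ.* κ′) j) (sym (ℕₚ.*-suc j κ′)))))) (period-* κ c (κ-period c) j))

    -- The least residue of an orbit represents it. Exponents matter only modulo `κ`, so the
    -- quantifier over all `j` is decidable.
    Rep : ℕ → Set
    Rep c = ∀ j → c % N ≤ (2 ℕ.^ j ℕ.* c) % N

    Rep-or-smaller : ∀ c → Rep c ⊎ ∃ λ j → (2 ℕ.^ j ℕ.* c) % N < c % N
    Rep-or-smaller c with ℕₚ.anyUpTo? (λ j → (2 ℕ.^ j ℕ.* c) % N ℕ.<? c % N) κ
    ... | yes (j , _ , p) = inj₂ (j , p)
    ... | no none = inj₁ λ j → ℕₚ.≮⇒≥ (λ p → none (j % κ , m%n<n j κ , subst (_< c % N) (un~ (period-% κ c (κ-period c) j)) p))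

    Rep? : ∀ c → Dec (Rep c)
    Rep? c with Rep-or-smaller c
    ... | inj₁ r       = yes r
    ... | inj₂ (j , p) = no λ r → ℕₚ.<⇒≱ p (r j)

    Rep-~ : ∀ {c d} → c ~ d → Rep c → Rep d
    Rep-~ {c} {d} p r j = subst (_≤ (2 ℕ.^ j ℕ.* d) % N) (un~ p)
      (subst (c % N ≤_) (un~ (~-* (~-refl {2 ℕ.^ j}) p)) (r j))

    Rep-unique : ∀ c d j → Rep c → Rep d → 2 ℕ.^ j ℕ.* c ~ d → c ~ d
    Rep-unique c d j r s p = mk~ (ℕₚ.≤-antisym (subst (c % N ≤_) (un~ p) (r j)) (subst (d % N ≤_) (un~ (back j p)) (s (j ℕ.* κ′))))

    Rep-exists : ∀ c → ∃ λ j → Rep (2 ℕ.^ j ℕ.* c)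
    Rep-exists c = go c (<-wellFounded (c % N))
      where
      go : ∀ c → Acc _<_ (c % N) → ∃ λ j → Rep (2 ℕ.^ j ℕ.* c)
      go c (acc rs) with Rep-or-smaller c
      ... | inj₁ r = 0 , Rep-~ (≡⇒~ (sym (ℕₚ.*-identityˡ c))) r
      ... | inj₂ (j , p) with go (2 ℕ.^ j ℕ.* c) (rs p)
      ...   | i , r = i ℕ.+ j , subst Rep (sym (2^+ i j c)) r

    length : ∀ c → ∃ λ L → (0 < L × 2 ℕ.^ L ℕ.* c ~ c) × (∀ j → j < L → ¬ (0 < j × 2 ℕ.^ j ℕ.* c ~ c))
    length c = least dec κ (s≤s z≤n , κ-period c)
      where
      dec : ∀ j → Dec (0 < j × 2 ℕ.^ j ℕ.* c ~ c)
      dec j with 0 ℕ.<? j | 2 ℕ.^ j ℕ.* c ~? c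
      ... | yes p | yes q = yes (p , q)
      ... | no p  | _     = no (p ∘ proj₁)
      ... | yes _ | no q  = no (q ∘ proj₂)

    length-∣κ : ∀ c → proj₁ (length c) ∣ κ
    length-∣κ c with length c
    ... | suc L , (_ , p) , min = m%n≡0⇒n∣m κ (suc L) (zero-rem (κ % suc L) (m%n<n κ (suc L)) (~-trans (~-sym (period-% (suc L) c p κ)) (κ-period c)))
      where
      zero-rem : ∀ r → r < suc L → 2 ℕ.^ r ℕ.* c ~ c → r ≡ 0
      zero-rem zero    _ _ = refl
      zero-rem (suc r) q s = ⊥-elim (min (suc r) q (s≤s z≤n , s))

    steps : ∀ c → ∃ λ j → Rep (2 ℕ.^ j ℕ.* c) × (∀ i → i < j → ¬ Rep (2 ℕ.^ i ℕ.* c))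
    steps c = least (λ j → Rep? (2 ℕ.^ j ℕ.* c)) (proj₁ (Rep-exists c)) (proj₂ (Rep-exists c))

    steps-double : ∀ c d → ¬ Rep c → 2 ℕ.* c ~ d → proj₁ (steps d) < proj₁ (steps c)
    steps-double c d ¬r p with steps c
    ... | zero  , r , _ = ⊥-elim (¬r (Rep-~ (≡⇒~ (ℕₚ.*-identityˡ c)) r))
    ... | suc j , r , _ with steps d
    ...   | i , _ , min = s≤s (ℕₚ.≮⇒≥ λ j<i → min j j<i (Rep-~ (~-trans (≡⇒~ (eq (2 ℕ.^ j) c)) (~-* (~-refl {2 ℕ.^ j}) p)) r))
      where eq : ∀ t c → 2 ℕ.* t ℕ.* c ≡ t ℕ.* (2 ℕ.* c)
            eq = ℕ-Solver.solve-∀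

    representatives : ℕ
    representatives = sumℕ N (λ c → 𝟙 (does (Rep? c)))

    -- What telescoping leaves of `I+D`, with the factor 2 taken out of the rows of representatives.
    -- It is unitriangular for the number of `steps`, because doubling a non-representative brings
    -- it one step closer to its representative.
    V : ℕ → Lin
    V c = e c ⊕ (if does (Rep? c) then 0ℤ else 1ℤ) ⊙ e (2 ℕ.* c)

    Δ-V : Δ V ≡ 1ℤ
    Δ-V = det-unitriangular N (mat (row ∘ V)) (λ c → proj₁ (steps (toℕ c))) diag off
      where
      value : ∀ c j → ¬ (¬ Rep c × 2 ℕ.* c ~ toℕ j) → row (V c) j ≡ E c j
      value c j none with Rep? c
      ... | yes _ = ℤₚ.+-identityʳ (E c j)
      ... | no r  = trans (cong (λ z → E c j + 1ℤ * z) (ι-no (λ p → none (r , p)))) (ℤₚ.+-identityʳ (E c j))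
      -- A residue with 2c ≡ c could put a 2 on the diagonal, but it is alone in its orbit and hence
      -- a representative.
      fixed : ∀ c → 2 ℕ.* c ~ c → Rep c
      fixed c p j = ℕₚ.≤-reflexive (sym (un~ (~-trans (≡⇒~ (cong (λ z → 2 ℕ.^ z ℕ.* c) (sym (ℕₚ.*-identityʳ j)))) (period-* 1 c p j))))
      diag : ∀ c → mat (row ∘ V) c c ≡ 1ℤ
      diag c = trans (value (toℕ c) c (λ { (r , p) → r (fixed (toℕ c) p) })) (ι-yes ~-refl)
      off : ∀ c d → c ≢ d → ¬ (proj₁ (steps (toℕ d)) < proj₁ (steps (toℕ c))) → mat (row ∘ V) c d ≡ 0ℤ
      off c d c≢d nlt = trans (value (toℕ c) d (λ { (r , p) → nlt (steps-double (toℕ c) (toℕ d) r p) })) (ι-no (c≢d ∘ Fin~⇒≡))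

    -- Every orbit length divides `κ` and so is odd; each orbit then contributes 1 - (-1) = 2.
    odd-orbits : ¬ 2 ∣ κ → Δ (I+D) ≡ ℤ.+ (2 ℕ.^ representatives)
    odd-orbits odd = begin
      Δ (I+D)
        ≡⟨ Δ-telescoped (λ c j → w c * row (V c) j) X-yes X-no ⟩
      det N (mat (λ c j → w c * row (V c) j))
        ≡⟨ det-row-scale N (w ∘ toℕ) (mat (row ∘ V)) ⟩
      prodFin N (w ∘ toℕ) * Δ V
        ≡⟨ cong₂ _*_ (prodFin-2^ N (λ c → 𝟙 (does (Rep? c)))) Δ-V ⟩
      ℤ.+ (2 ℕ.^ representatives) * 1ℤ
        ≡⟨ ℤₚ.*-identityʳ _ ⟩
      ℤ.+ (2 ℕ.^ representatives) ∎
      where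
      open ≡-Reasoning
      w : ℕ → ℤ
      w c = ℤ.+ (2 ℕ.^ 𝟙 (does (Rep? c)))
      open AlternatingSums Rep Rep? (proj₁ ∘ length) (λ c → proj₁ (proj₁ (proj₂ (length c))))
        (λ c _ → proj₂ (proj₁ (proj₂ (length c)))) (λ c _ j j>0 j<L p → proj₂ (proj₂ (length c)) j j<L (j>0 , p)) Rep-unique
      lem₁ : ∀ x y → ℤ.+ 2 * (x + 0ℤ * y) ≡ x + - (ℤ.-1ℤ * x)
      lem₁ = solve-∀
      lem₂ : ∀ x y → 1ℤ * (x + 1ℤ * y) ≡ y + x
      lem₂ = solve-∀
      X-yes : ∀ c j → Rep c → w c * row (V c) j ≡ E c j + - (sign (proj₁ (length c)) * E c j)
      X-yes c j r rewrite dec-true (Rep? c) r = trans (lem₁ (E c j) (E (2 ℕ.* c) j))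
        (cong (λ z → E c j + - (z * E c j)) (sym (sign-odd (proj₁ (length c)) (λ p → odd (∣-trans p (length-∣κ c))))))
      X-no : ∀ c j → ¬ Rep c → w c * row (V c) j ≡ row (I+D c) j
      X-no c j r rewrite dec-false (Rep? c) r = lem₂ (E c j) (E (2 ℕ.* c) j)

-- Counting the orbits of doubling

sumℕ-swap : ∀ a b (f : ℕ → ℕ → ℕ) → sumℕ a (λ i → sumℕ b (f i)) ≡ sumℕ b (λ j → sumℕ a (λ i → f i j))
sumℕ-swap zero    b f = sym (sumℕ-0 b (λ _ _ → refl))
sumℕ-swap (suc a) b f = trans (cong (ℕ._+_ (sumℕ b (f 0))) (sumℕ-swap a b (f ∘ suc))) (sym (sumℕ-+ b (f 0) (λ j → sumℕ a (λ i → f (suc i) j))))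

sumℕ-* : ∀ n c (f : ℕ → ℕ) → sumℕ n (λ i → c ℕ.* f i) ≡ c ℕ.* sumℕ n f
sumℕ-* zero    c f = sym (ℕₚ.*-zeroʳ c)
sumℕ-* (suc n) c f = trans (cong (ℕ._+_ (c ℕ.* f 0)) (sumℕ-* n c (f ∘ suc))) (sym (ℕₚ.*-distribˡ-+ c (f 0) _))

sumℕ-const : ∀ n c → sumℕ n (λ _ → c) ≡ n ℕ.* c
sumℕ-const zero    c = refl
sumℕ-const (suc n) c = cong (c ℕ.+_) (sumℕ-const n c)

sumℕ-single : ∀ n j {f : ℕ → ℕ} → j < n → (∀ i → i < n → i ≢ j → f i ≡ 0) → sumℕ n f ≡ f j
sumℕ-single (suc n) zero    {f} _ p = trans (cong (ℕ._+_ (f 0)) (sumℕ-0 n (λ i q → p (suc i) (s≤s q) (λ ())))) (ℕₚ.+-identityʳ (f 0))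
sumℕ-single (suc n) (suc j) {f} (s≤s q) p = trans (cong (ℕ._+ sumℕ n (f ∘ suc)) (p 0 (s≤s z≤n) (λ ())))
  (sumℕ-single n j q (λ i r s → p (suc i) (s≤s r) (s ∘ ℕₚ.suc-injective)))

sumℕ-blocks : ∀ d e (f : ℕ → ℕ) → sumℕ (d ℕ.* e) f ≡ sumℕ d (λ u → sumℕ e (λ v → f (u ℕ.* e ℕ.+ v)))
sumℕ-blocks zero    e f = refl
sumℕ-blocks (suc d) e f = trans (sumℕ-split e (d ℕ.* e) f) (cong (ℕ._+_ (sumℕ e f)) (trans (sumℕ-blocks d e (λ i → f (e ℕ.+ i)))
  (sumℕ-cong d (λ u _ → sumℕ-cong e (λ v _ → cong f (sym (ℕₚ.+-assoc e (u ℕ.* e) v)))))))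

sum-map-upTo : ∀ n (f : ℕ → ℕ) → sum (map f (upTo n)) ≡ sumℕ n f
sum-map-upTo n f = go n (λ i → i)
  where
  go : ∀ n (h : ℕ → ℕ) → sum (map f (applyUpTo h n)) ≡ sumℕ n (f ∘ h)
  go zero    h = refl
  go (suc n) h = cong (ℕ._+_ (f (h 0))) (go n (h ∘ suc))

𝟙-yes : ∀ {P : Set} (d : Dec P) → P → 𝟙 (does d) ≡ 1
𝟙-yes d p = cong 𝟙 (dec-true d p)

𝟙-no : ∀ {P : Set} (d : Dec P) → ¬ P → 𝟙 (does d) ≡ 0
𝟙-no d p = cong 𝟙 (dec-false d p)

φ-sum : ∀ d → φ d ≡ sumℕ d (λ k → 𝟙 (does (gcd k d ℕ.≟ 1)))
φ-sum d = trans (sum-map-upTo d _) (sumℕ-cong d (λ k _ → cong 𝟙 (isYes≗does (gcd k d ℕ.≟ 1))))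

module ClassCount (N d e′ : ℕ) (N≡d*e : N ≡ d ℕ.* suc e′) where

  e : ℕ
  e = suc e′

  N≡e*d : N ≡ e ℕ.* d
  N≡e*d = trans N≡d*e (ℕₚ.*-comm d e)

  class⇒gcd≡e : ∀ c .{{_ : ℕ.NonZero d}} → gcd c N ℕ.* d ≡ N → gcd c N ≡ e
  class⇒gcd≡e c p = ℕₚ.*-cancelʳ-≡ (gcd c N) e d (trans p N≡e*d)

  gcd-u*e : ∀ u → gcd (u ℕ.* e ℕ.+ 0) N ≡ e ℕ.* gcd u d
  gcd-u*e u = trans (cong₂ gcd (trans (ℕₚ.+-identityʳ (u ℕ.* e)) (ℕₚ.*-comm u e)) N≡e*d) (sym (c*gcd[m,n]≡gcd[cm,cn] e u d))

  -- The range below N is cut into `d` blocks of length `e`. Residues of the class are multiples of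
  -- `e`, so only the first place of block `u` can count, and it does when `u` is coprime to `d`.
  class-count : .{{_ : ℕ.NonZero d}} → sumℕ N (λ c → 𝟙 (does (gcd c N ℕ.* d ℕ.≟ N))) ≡ φ d
  class-count = trans (cong (λ n → sumℕ n f) N≡d*e) (trans (sumℕ-blocks d e f) (trans (sumℕ-cong d (λ u _ → inner u)) (sym (φ-sum d))))
    where
    f : ℕ → ℕ
    f c = 𝟙 (does (gcd c N ℕ.* d ℕ.≟ N))
    off : ∀ u v → v < e → v ≢ 0 → ¬ gcd (u ℕ.* e ℕ.+ v) N ℕ.* d ≡ N
    off u zero    _ v≢0 p = v≢0 refl
    off u (suc v) v<e v≢0 p = ℕₚ.<⇒≱ v<e (∣⇒≤ (∣m+n∣m⇒∣n (subst (_∣ u ℕ.* e ℕ.+ suc v) (class⇒gcd≡e (u ℕ.* e ℕ.+ suc v) p) (gcd[m,n]∣m (u ℕ.* e ℕ.+ suc v) N)) (n∣m*n u)))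
    fwd : ∀ u → gcd (u ℕ.* e ℕ.+ 0) N ℕ.* d ≡ N → gcd u d ≡ 1
    fwd u p = ℕₚ.*-cancelˡ-≡ (gcd u d) 1 e (trans (trans (sym (gcd-u*e u)) (class⇒gcd≡e (u ℕ.* e ℕ.+ 0) p)) (sym (ℕₚ.*-identityʳ e)))
    bwd : ∀ u → gcd u d ≡ 1 → gcd (u ℕ.* e ℕ.+ 0) N ℕ.* d ≡ N
    bwd u p = trans (cong (ℕ._* d) (trans (gcd-u*e u) (trans (cong (e ℕ.*_) p) (ℕₚ.*-identityʳ e)))) (sym N≡e*d)
    inner : ∀ u → sumℕ e (λ v → f (u ℕ.* e ℕ.+ v)) ≡ 𝟙 (does (gcd u d ℕ.≟ 1))
    inner u = trans (sumℕ-single e 0 {λ v → f (u ℕ.* e ℕ.+ v)} (s≤s z≤n)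
                      (λ v v<e v≢0 → 𝟙-no (gcd (u ℕ.* e ℕ.+ v) N ℕ.* d ℕ.≟ N) (off u v v<e v≢0)))
      (cong 𝟙 (does-⇔ (mk⇔ (fwd u) (bwd u)) (gcd (u ℕ.* e ℕ.+ 0) N ℕ.* d ℕ.≟ N) (gcd u d ℕ.≟ 1)))

∣m*x-x∣ : ∀ m x → ∣ m - 1 ∣ ℕ.* x ≡ ∣ m ℕ.* x - x ∣
∣m*x-x∣ m x = trans (ℕₚ.*-distribʳ-∣-∣ x m 1) (cong (λ z → ∣ m ℕ.* x - z ∣) (ℕₚ.*-identityˡ x))

module OrbitCount (m κ′ : ℕ) (2^κ~1 : Modular._~_ (m ℕ.+ m) (2 ℕ.^ suc κ′) 1) (odd : ¬ 2 ∣ suc (m ℕ.+ m)) where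

  open Modular (m ℕ.+ m)
  open OddModulus m
  open DoublingOrbits m
  open Representatives κ′ 2^κ~1

  -- `d` is the additive order of `c` in ℤ/N, written without division.
  Class : ℕ → ℕ → Set
  Class d c = gcd c N ℕ.* d ≡ N

  class? : ∀ d c → Dec (Class d c)
  class? d c = gcd c N ℕ.* d ℕ.≟ N

  gcd≢0 : ∀ c → gcd c N ≢ 0
  gcd≢0 c = gcd[m,n]≢0 c N (inj₂ (λ ()))

  -- Dividing by gcd(c, N) turns N ∣ (2^j - 1) c into d ∣ (2^j - 1) c′ with `c′` coprime to `d`.
  Class-period : ∀ {d c} j → Class d c → 2 ℕ.^ j ℕ.* c ~ c → d ∣ ∣ 2 ℕ.^ j - 1 ∣
  Class-period {d} {c} j cl p with gcd[m,n]∣m c N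
  ... | divides c′ c≡c′g = coprime-divisor (gcd≡1⇒coprime coprime) (*-cancelˡ-∣ g {{ℕ.≢-nonZero (gcd≢0 c)}} (subst₂ _∣_ (sym cl) eq (~⇒∣ p)))
    where
    g = gcd c N
    X = ∣ 2 ℕ.^ j - 1 ∣
    lem : ∀ x c g → x ℕ.* (c ℕ.* g) ≡ g ℕ.* (c ℕ.* x)
    lem = ℕ-Solver.solve-∀
    eq : ∣ 2 ℕ.^ j ℕ.* c - c ∣ ≡ g ℕ.* (c′ ℕ.* X)
    eq = trans (sym (∣m*x-x∣ (2 ℕ.^ j) c)) (trans (cong (X ℕ.*_) c≡c′g) (lem X c′ g))
    coprime : gcd d c′ ≡ 1
    coprime = ℕₚ.*-cancelˡ-≡ (gcd d c′) 1 g {{ℕ.≢-nonZero (gcd≢0 c)}} (trans (c*gcd[m,n]≡gcd[cm,cn] g d c′)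
      (trans (cong₂ gcd cl (trans (ℕₚ.*-comm g c′) (sym c≡c′g))) (trans (gcd-comm N c) (sym (ℕₚ.*-identityʳ g)))))

  period-Class : ∀ {d c} j → Class d c → d ∣ ∣ 2 ℕ.^ j - 1 ∣ → 2 ℕ.^ j ℕ.* c ~ c
  period-Class {d} {c} j cl (divides q X≡qd) with gcd[m,n]∣m c N
  ... | divides c′ c≡c′g = ∣⇒~ (divides (q ℕ.* c′) (trans (sym (∣m*x-x∣ (2 ℕ.^ j) c)) (trans (cong₂ ℕ._*_ X≡qd c≡c′g)
      (trans (lem q d c′ (gcd c N)) (cong (q ℕ.* c′ ℕ.*_) cl)))))
    where lem : ∀ q d c g → q ℕ.* d ℕ.* (c ℕ.* g) ≡ q ℕ.* c ℕ.* (g ℕ.* d)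
          lem = ℕ-Solver.solve-∀

  gcd-∣ : ∀ j {r c} → 2 ℕ.^ j ℕ.* r ~ c → gcd r N ∣ gcd c N
  gcd-∣ j {r} {c} p = gcd-greatest {c} {N}
    (∣n∣m%n⇒∣m {m = c} (gcd[m,n]∣n r N) (subst (gcd r N ∣_) (un~ p) (%-presˡ-∣ (∣n⇒∣m*n (2 ℕ.^ j) (gcd[m,n]∣m r N)) (gcd[m,n]∣n r N))))
    (gcd[m,n]∣n r N)

  Class-orbit : ∀ {d} j {r c} → 2 ℕ.^ j ℕ.* r ~ c → Class d r → Class d c
  Class-orbit {d} j p cl = trans (cong (ℕ._* d) (∣-antisym (gcd-∣ (j ℕ.* κ′) (back j p)) (gcd-∣ j p))) cl

  isClass : ℕ → ℕ → ℕ

  isClass d c = 𝟙 (does (class? d c))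

  isRep : ℕ → ℕ
  isRep r = 𝟙 (does (Rep? r))

  hits : ℕ → ℕ → ℕ → ℕ
  hits j r c = 𝟙 (does (2 ℕ.^ j ℕ.* r ~? c))

  sum-hits : ∀ j r → sumℕ N (hits j r) ≡ 1
  sum-hits j r = trans (sumℕ-single N (x % N) (m%n<n x N) (λ c c<N c≢ → 𝟙-no (x ~? c) (λ p → c≢ (sym (~⇒≡ (m%n<n x N) c<N (~-trans (~-% x) p))))))
                       (𝟙-yes (x ~? (x % N)) (~-sym (~-% x)))
    where x = 2 ℕ.^ j ℕ.* r

  module _ {d k : ℕ} (ord : IsOrder d k) where

    private
      instance
        k-nonZero : ℕ.NonZero k
        k-nonZero = ℕ.>-nonZero (IsOrder.positive ord)

    distinct : ∀ {r} → Class d r → ∀ i j → i < j → j < k → ¬ 2 ℕ.^ i ℕ.* r ~ 2 ℕ.^ j ℕ.* r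
    distinct {r} cl i j i<j j<k p = ℕₚ.<⇒≱ (ℕₚ.≤-<-trans (ℕₚ.m∸n≤m j i) j<k)
      (IsOrder.minimal ord (j ℕ.∸ i) (ℕₚ.m<n⇒0<n∸m i<j) (Class-period (j ℕ.∸ i) cl (2^*-cancel i
        (~-trans (≡⇒~ (trans (sym (2^+ i (j ℕ.∸ i) r)) (cong (λ z → 2 ℕ.^ z ℕ.* r) (ℕₚ.m+[n∸m]≡n (ℕₚ.<⇒≤ i<j))))) (~-sym p)))))

    hits-once : ∀ {r c} j → Class d r → 2 ℕ.^ j ℕ.* r ~ c → sumℕ k (λ j → hits j r c) ≡ 1
    hits-once {r} {c} j cl p = trans (sumℕ-single k j₀ (m%n<n j k) (λ i i<k i≢ → 𝟙-no (2 ℕ.^ i ℕ.* r ~? c) (unique i i<k i≢)))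
                                     (𝟙-yes (2 ℕ.^ j₀ ℕ.* r ~? c) hit)
      where
      j₀ = j % k
      hit : 2 ℕ.^ j₀ ℕ.* r ~ c
      hit = ~-trans (~-sym (period-% k r (period-Class k cl (IsOrder.period ord)) j)) p
      unique : ∀ i → i < k → i ≢ j₀ → ¬ 2 ℕ.^ i ℕ.* r ~ c
      unique i i<k i≢ q with ℕₚ.<-cmp i j₀
      ... | tri< i<j _ _ = distinct cl i j₀ i<j (m%n<n j k) (~-trans q (~-sym hit))
      ... | tri≈ _ i≡j _ = i≢ i≡j
      ... | tri> _ _ j<i = distinct cl j₀ i j<i i<k (~-trans hit (~-sym q))

    -- The orbit of `c` has exactly one representative `r`, and for `c` in the class exactly one `j`
    -- below `k` carries `r` to `c`. The additive order is constant along an orbit, so `r` is in the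
    -- class precisely when `c` is.
    covered-once : ∀ c → c < N → sumℕ N (λ r → isRep r ℕ.* isClass d r ℕ.* sumℕ k (λ j → hits j r c)) ≡ isClass d c
    covered-once c c<N = helper (class? d c)
      where
      t : ℕ → ℕ
      t r = isRep r ℕ.* isClass d r ℕ.* sumℕ k (λ j → hits j r c)
      vanish : ∀ r → (∀ j → Rep r → Class d r → ¬ 2 ℕ.^ j ℕ.* r ~ c) → t r ≡ 0
      vanish r none = go (Rep? r) (class? d r)
        where
        h = sumℕ k (λ j → hits j r c)
        go : Dec (Rep r) → Dec (Class d r) → t r ≡ 0
        go (no n)   _        = cong (λ z → z ℕ.* isClass d r ℕ.* h) (𝟙-no (Rep? r) n)
        go (yes _)  (no n)   = trans (cong (λ z → isRep r ℕ.* z ℕ.* h) (𝟙-no (class? d r) n)) (cong (ℕ._* h) (ℕₚ.*-zeroʳ (isRep r)))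
        go (yes re) (yes cl) = trans (cong (isRep r ℕ.* isClass d r ℕ.*_) (sumℕ-0 k (λ j _ → 𝟙-no (2 ℕ.^ j ℕ.* r ~? c) (none j re cl))))
                                     (ℕₚ.*-zeroʳ (isRep r ℕ.* isClass d r))
      helper : Dec (Class d c) → sumℕ N t ≡ isClass d c
      helper (no n) = trans (sumℕ-0 N (λ r _ → vanish r (λ j _ cl p → n (Class-orbit j p cl)))) (sym (𝟙-no (class? d c) n))
      helper (yes cl) = trans (sumℕ-single N r₀ (m%n<n (2 ℕ.^ i ℕ.* c) N) (λ r r<N r≢ → vanish r (λ j re _ p → r≢
            (~⇒≡ r<N (m%n<n (2 ℕ.^ i ℕ.* c) N) (Rep-unique r r₀ (i ℕ.+ j) re rep₀ (~-trans (≡⇒~ (2^+ i j r)) (~-trans (~-* (~-refl {2 ℕ.^ i}) p) to₀)))))))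
          (trans (cong₂ ℕ._*_ (cong₂ ℕ._*_ (𝟙-yes (Rep? r₀) rep₀) (𝟙-yes (class? d r₀) cl₀)) (hits-once (i ℕ.* κ′) cl₀ (back i to₀)))
                 (sym (𝟙-yes (class? d c) cl)))
        where
        i = proj₁ (Rep-exists c)
        r₀ = (2 ℕ.^ i ℕ.* c) % N
        to₀ : 2 ℕ.^ i ℕ.* c ~ r₀
        to₀ = ~-sym (~-% (2 ℕ.^ i ℕ.* c))
        rep₀ : Rep r₀
        rep₀ = Rep-~ to₀ (proj₂ (Rep-exists c))
        cl₀ : Class d r₀
        cl₀ = Class-orbit i to₀ cl

    -- Double counting of the triples (r, j, c) with 2^j r ≡ c, where `r` is a representative in the
    -- class and j < k: once by `c`, once by the pair (r, j).
    class-orbits : sumℕ N (isClass d) ≡ sumℕ N (λ r → isRep r ℕ.* isClass d r) ℕ.* k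
    class-orbits = begin
      sumℕ N (isClass d)
        ≡⟨ sumℕ-cong N (λ c c<N → sym (covered-once c c<N)) ⟩
      sumℕ N (λ c → sumℕ N (λ r → w r ℕ.* sumℕ k (λ j → hits j r c)))
        ≡⟨ sumℕ-swap N N (λ c r → w r ℕ.* sumℕ k (λ j → hits j r c)) ⟩
      sumℕ N (λ r → sumℕ N (λ c → w r ℕ.* sumℕ k (λ j → hits j r c)))
        ≡⟨ sumℕ-cong N (λ r _ → trans (sumℕ-* N (w r) (λ c → sumℕ k (λ j → hits j r c))) (trans (cong (w r ℕ.*_)
             (trans (sumℕ-swap N k (λ c j → hits j r c)) (trans (sumℕ-cong k (λ j _ → sum-hits j r)) (trans (sumℕ-const k 1) (ℕₚ.*-identityʳ k))))) (ℕₚ.*-comm (w r) k))) ⟩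
      sumℕ N (λ r → k ℕ.* w r)
        ≡⟨ sumℕ-* N k w ⟩
      k ℕ.* sumℕ N w
        ≡⟨ ℕₚ.*-comm k _ ⟩
      sumℕ N w ℕ.* k ∎
      where
      open ≡-Reasoning
      w : ℕ → ℕ
      w r = isRep r ℕ.* isClass d r

  div0-* : ∀ a k → 0 < k → (a ℕ.* k) div0 k ≡ a
  div0-* a (suc k) _ = m*n/n≡m a (suc k)

  φ-div-ord2 : ∀ d → d ∣ N → φ d div0 ord2 d ≡ sumℕ N (λ r → isRep r ℕ.* isClass d r)
  φ-div-ord2 d (divides zero ())
  φ-div-ord2 zero (divides (suc e′) N≡) with trans N≡ (ℕₚ.*-zeroʳ e′)
  ... | ()
  φ-div-ord2 d@(suc _) d∣N@(divides (suc e′) N≡) = trans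
    (cong (_div0 ord2 d) (trans (sym (ClassCount.class-count N d e′ (trans N≡ (ℕₚ.*-comm (suc e′) d)))) (class-orbits ord)))
    (div0-* _ (ord2 d) (IsOrder.positive ord))
    where ord = ord2-isOrder d (λ 2∣d → odd (∣-trans 2∣d d∣N))

  -- The summand of `K`, repeated verbatim so that `sum-map-upTo` applies to `K N` by computation.
  K-term : ℕ → ℕ
  K-term d = if (1 <ᵇ d) ∧ ⌊ d ∣? N ⌋ then φ d div0 ord2 d else 0

  K-term-sum : ∀ d → K-term d ≡ sumℕ N (λ r → isRep r ℕ.* (𝟙 (1 <ᵇ d) ℕ.* isClass d r))
  K-term-sum d with 1 <ᵇ d | d ∣? N
  ... | false | _      = sym (sumℕ-0 N (λ r _ → ℕₚ.*-zeroʳ (isRep r)))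
  ... | true  | yes p  = trans (φ-div-ord2 d p) (sumℕ-cong N (λ r _ → cong (isRep r ℕ.*_) (sym (ℕₚ.+-identityʳ (isClass d r)))))
  ... | true  | no ¬p  = sym (sumℕ-0 N (λ r _ → trans (cong (isRep r ℕ.*_) (trans (ℕₚ.+-identityʳ _)
                           (𝟙-no (class? d r) (λ cl → ¬p (divides (gcd r N) (sym cl)))))) (ℕₚ.*-zeroʳ (isRep r))))

  -- The number of d > 1 that are the additive order of `r`. Below N it is 1 except at r = 0, whose
  -- order 1 is left out of `K`; the orbit of 0 is the extra 1 in `representatives≡1+K`.
  classes : ℕ → ℕ
  classes r = sumℕ (suc N) (λ d → 𝟙 (1 <ᵇ d) ℕ.* isClass d r)

  classes-0 : classes 0 ≡ 0
  classes-0 = sumℕ-0 (suc N) (λ d _ → none d)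
    where
    none : ∀ d → 𝟙 (1 <ᵇ d) ℕ.* isClass d 0 ≡ 0
    none zero          = refl
    none (suc zero)    = refl
    none (suc (suc d)) = trans (ℕₚ.+-identityʳ _) (𝟙-no (class? (suc (suc d)) 0) (λ cl → absurd (trans (cong (ℕ._* suc (suc d)) (sym gcd0)) cl)))
      where
      gcd0 : gcd 0 N ≡ N
      gcd0 = ∣-antisym (gcd[m,n]∣n 0 N) (gcd-greatest (divides 0 refl) ∣-refl)
      absurd : N ℕ.* suc (suc d) ≢ N
      absurd p with ℕₚ.*-cancelˡ-≡ (suc (suc d)) 1 N (trans p (sym (ℕₚ.*-identityʳ N)))
      ... | ()

  classes-suc : ∀ r → suc r < N → classes (suc r) ≡ 1
  classes-suc r r<N with gcd[m,n]∣n (suc r) N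
  ... | divides d N≡d*g = trans (sumℕ-single (suc N) d d<1+N (λ i _ i≢d → trans (cong (𝟙 (1 <ᵇ i) ℕ.*_)
            (𝟙-no (class? i (suc r)) (λ cl → i≢d (ℕₚ.*-cancelˡ-≡ i d g (trans cl (trans N≡d*g (ℕₚ.*-comm d g))))))) (ℕₚ.*-zeroʳ (𝟙 (1 <ᵇ i)))))
      (cong₂ ℕ._*_ (𝟙-yes (1 ℕ.<? d) 1<d) (𝟙-yes (class? d (suc r)) (trans (ℕₚ.*-comm g d) (sym N≡d*g))))
    where
    g = gcd (suc r) N
    instance
      g-nonZero : ℕ.NonZero g
      g-nonZero = ℕ.≢-nonZero (gcd≢0 (suc r))
    d<1+N : d < suc N
    d<1+N = s≤s (∣⇒≤ (divides g (trans N≡d*g (ℕₚ.*-comm d g))))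
    g<N : g < N
    g<N = ℕₚ.≤-<-trans (∣⇒≤ (gcd[m,n]∣m (suc r) N)) r<N
    1<d : 1 < d
    1<d = ℕₚ.*-cancelʳ-< g 1 d (subst₂ _<_ (sym (ℕₚ.*-identityˡ g)) N≡d*g g<N)

  representatives≡1+K : representatives ≡ suc (K N)
  representatives≡1+K = sym (begin
    suc (K N)
      ≡⟨ cong suc (sum-map-upTo (suc N) K-term) ⟩
    suc (sumℕ (suc N) K-term)
      ≡⟨ cong suc (sumℕ-cong (suc N) (λ d _ → K-term-sum d)) ⟩
    suc (sumℕ (suc N) (λ d → sumℕ N (λ r → isRep r ℕ.* (𝟙 (1 <ᵇ d) ℕ.* isClass d r))))
      ≡⟨ cong suc (sumℕ-swap (suc N) N (λ d r → isRep r ℕ.* (𝟙 (1 <ᵇ d) ℕ.* isClass d r))) ⟩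
    suc (sumℕ N (λ r → sumℕ (suc N) (λ d → isRep r ℕ.* (𝟙 (1 <ᵇ d) ℕ.* isClass d r))))
      ≡⟨ cong suc (sumℕ-cong N (λ r _ → sumℕ-* (suc N) (isRep r) (λ d → 𝟙 (1 <ᵇ d) ℕ.* isClass d r))) ⟩
    suc (isRep 0 ℕ.* classes 0 ℕ.+ sumℕ (m ℕ.+ m) (λ r → isRep (suc r) ℕ.* classes (suc r)))
      ≡⟨ cong₂ (λ a b → suc (a ℕ.+ b)) (trans (cong (isRep 0 ℕ.*_) classes-0) (ℕₚ.*-zeroʳ (isRep 0)))
           (sumℕ-cong (m ℕ.+ m) (λ r r<N′ → trans (cong (isRep (suc r) ℕ.*_) (classes-suc r (s≤s r<N′))) (ℕₚ.*-identityʳ _))) ⟩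
    1 ℕ.+ sumℕ (m ℕ.+ m) (λ r → isRep (suc r))
      ≡⟨ cong (ℕ._+ sumℕ (m ℕ.+ m) (λ r → isRep (suc r))) (sym (𝟙-yes (Rep? 0) (λ _ → z≤n))) ⟩
    representatives ∎)
    where open ≡-Reasoning

-- The determinant, its sign and the residues modulo 24

-1^n : ∀ n → ℤ.-1ℤ ℤ.^ n ≡ sign n
-1^n zero    = refl
-1^n (suc n) = trans (cong (ℤ.-1ℤ *_) (-1^n n)) (ℤₚ.-1*i≡-i (sign n))

OddOrders : ℕ → Set
OddOrders N = ∀ p → Prime p → p ∣ N → ¬ 2 ∣ ord2 p

module Determinant (m : ℕ) where

  open Modular (m ℕ.+ m)
  open OddModulus m
  open Doubling m
  open Conway m
  open DoublingOrbits m

  odd : ¬ 2 ∣ N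
  odd (divides q p) = ¬2∣1 (∣m+n∣m⇒∣n (subst (2 ∣_) (ℕₚ.+-comm 1 (m ℕ.+ m)) (divides q p)) (subst (2 ∣_) (cong (m ℕ.+_) (ℕₚ.+-identityʳ m)) (m∣m*n m)))

  det-conway-D₀ : det N (conwayMatrix N) ≡ Δ (scaling 3) * (ℤ.+ 3 * D₀)
  det-conway-D₀ = trans det-conway (cong (Δ (scaling 3) *_) Δ-shiftsum)

  D₀-unique : ∀ x → Δ (I+D) ≡ ℤ.+ 2 * x → D₀ ≡ x
  D₀-unique x p = cancelˡ {ℤ.+ 2} (λ ()) (trans (sym Δ-I+D) p)

  -- The residue a = N / p has additive order p, so 2^j a ≡ a exactly when p divides 2^j - 1, and
  -- the orbit of `a` has length `ord2 p`.
  det-even : (∃ λ p → Prime p × p ∣ N × 2 ∣ ord2 p) → det N (conwayMatrix N) ≡ 0ℤ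
  det-even (p , _ , divides a N≡a*p , even) = trans det-conway-D₀ (trans (cong (λ z → Δ (scaling 3) * (ℤ.+ 3 * z)) (D₀-unique 0ℤ vanishes)) (ℤₚ.*-zeroʳ (Δ (scaling 3))))
    where
    ord = ord2-isOrder p (λ 2∣p → odd (∣-trans 2∣p (divides a N≡a*p)))
    a≢0 : a ≢ 0
    a≢0 a≡0 = ℕₚ.1+n≢0 (trans N≡a*p (cong (ℕ._* p) a≡0))
    fwd : ∀ j → p ∣ ∣ 2 ℕ.^ j - 1 ∣ → 2 ℕ.^ j ℕ.* a ~ a
    fwd j (divides q X≡qp) = ∣⇒~ (divides q (trans (sym (∣m*x-x∣ (2 ℕ.^ j) a)) (trans (cong (ℕ._* a) X≡qp)
      (trans (ℕₚ.*-assoc q p a) (cong (q ℕ.*_) (trans (ℕₚ.*-comm p a) (sym N≡a*p)))))))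
    bwd : ∀ j → 2 ℕ.^ j ℕ.* a ~ a → p ∣ ∣ 2 ℕ.^ j - 1 ∣
    bwd j r = *-cancelʳ-∣ a {{ℕ.≢-nonZero a≢0}} (subst₂ _∣_ (trans N≡a*p (ℕₚ.*-comm a p)) (sym (∣m*x-x∣ (2 ℕ.^ j) a)) (~⇒∣ r))
    vanishes : Δ (I+D) ≡ ℤ.+ 2 * 0ℤ
    vanishes = even-orbit a (ord2 p) (IsOrder.positive ord) even (fwd (ord2 p) (IsOrder.period ord))
      (λ j j>0 j<k r → ℕₚ.<⇒≱ j<k (IsOrder.minimal ord j j>0 (bwd j r)))

  -- The orbit of 0 contributes a factor 2 to `Δ I+D`, the same factor that separates it from `D₀`;
  -- so 2^(1 + K) becomes 2^K.
  det-odd : OddOrders N → det N (conwayMatrix N) ≡ Δ (scaling 3) * (ℤ.+ 3 * ℤ.+ (2 ℕ.^ K N))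
  det-odd ords with odd-period N odd ords
  ... | zero  , k-odd , _  = ⊥-elim (k-odd (divides 0 refl))
  ... | suc κ′ , k-odd , p = trans det-conway-D₀ (cong (λ z → Δ (scaling 3) * (ℤ.+ 3 * z)) (D₀-unique (ℤ.+ (2 ℕ.^ K N)) (begin
    Δ (I+D)                        ≡⟨ odd-orbits k-odd ⟩
    ℤ.+ (2 ℕ.^ representatives)    ≡⟨ cong (λ z → ℤ.+ (2 ℕ.^ z)) (OrbitCount.representatives≡1+K m κ′ (∣⇒~ p) odd) ⟩
    ℤ.+ (2 ℕ.* 2 ℕ.^ K N)          ≡⟨ ℤₚ.pos-* 2 (2 ℕ.^ K N) ⟩
    ℤ.+ 2 * ℤ.+ (2 ℕ.^ K N)        ∎)))
    where
    open ≡-Reasoning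
    open Representatives κ′ (∣⇒~ p)

  Δ-scaling-2^ : ∀ k → Δ (scaling (2 ℕ.^ k)) ≡ Δ (scaling 2) ℤ.^ k
  Δ-scaling-2^ zero    = det-scaling-~1 1 ~-refl
  Δ-scaling-2^ (suc k) = trans (sym (det-scaling-* 2 (2 ℕ.^ k))) (cong (Δ (scaling 2) *_) (Δ-scaling-2^ k))

  -- 2 has odd order modulo N, so multiplication by 2 is an even permutation.
  sign-triangle≢-1 : OddOrders N → sign (triangle m) ≢ ℤ.-1ℤ
  sign-triangle≢-1 ords s≡-1 with odd-period N odd ords
  ... | k , k-odd , p = contra (begin
    1ℤ                       ≡⟨ sym (det-scaling-~1 (2 ℕ.^ k) (∣⇒~ p)) ⟩
    Δ (scaling (2 ℕ.^ k))    ≡⟨ Δ-scaling-2^ k ⟩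
    Δ (scaling 2) ℤ.^ k      ≡⟨ cong (ℤ._^ k) (trans (det-scaling 2 half 2*half~1) (trans (sign-double-map m) s≡-1)) ⟩
    ℤ.-1ℤ ℤ.^ k              ≡⟨ trans (-1^n k) (sign-odd k k-odd) ⟩
    ℤ.-1ℤ                    ∎)
    where
    open ≡-Reasoning
    contra : 1ℤ ≢ ℤ.-1ℤ
    contra ()

  -- Indexed by the predecessor of the modulus, so that an equation between moduli can be
  -- transported while `suc n` stays visibly non-zero.
  inversions₃ : ℕ → ℕ
  inversions₃ n = inversions (suc n) (λ i → (3 ℕ.* i) % suc n)

  Δ-scaling3₁ : ∀ t → N ≡ suc t ℕ.+ (t ℕ.+ t) → Δ (scaling 3) ≡ sign (triangle t)
  -- The inverse of 3 comes from 3 (2t + 1) = 2N + 1.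
  Δ-scaling3₁ t p = trans (det-scaling 3 (suc (t ℕ.+ t)) inverse)
    (trans (cong (sign ∘ inversions₃) (ℕₚ.suc-injective p)) (sign-triple-map₁ t))
    where
    eq : ∀ t → 3 ℕ.* (1 ℕ.+ (t ℕ.+ t)) ≡ 1 ℕ.+ 2 ℕ.* (1 ℕ.+ t ℕ.+ (t ℕ.+ t))
    eq = ℕ-Solver.solve-∀
    inverse : 3 ℕ.* suc (t ℕ.+ t) ~ 1
    inverse = ~-trans (≡⇒~ (trans (eq t) (cong (λ n → 1 ℕ.+ 2 ℕ.* n) (sym p)))) (~-+kN 1 2)

  Δ-scaling3₂ : ∀ t → N ≡ suc t ℕ.+ (suc t ℕ.+ t) → Δ (scaling 3) ≡ sign (triangle t)
  -- The inverse of 3 comes from 3 (t + 1) = N + 1.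
  Δ-scaling3₂ t p = trans (det-scaling 3 (suc t) inverse)
    (trans (cong (sign ∘ inversions₃) (ℕₚ.suc-injective p)) (sign-triple-map₂ t))
    where
    eq : ∀ t → 3 ℕ.* (1 ℕ.+ t) ≡ 1 ℕ.+ 1 ℕ.* (1 ℕ.+ t ℕ.+ (1 ℕ.+ t ℕ.+ t))
    eq = ℕ-Solver.solve-∀
    inverse : 3 ℕ.* suc t ~ 1
    inverse = ~-trans (≡⇒~ (trans (eq t) (cong (λ n → 1 ℕ.+ 1 ℕ.* n) (sym p)))) (~-+kN 1 1)

  det-odd₁ : ∀ t → N ≡ suc t ℕ.+ (t ℕ.+ t) → OddOrders N →
             det N (conwayMatrix N) ≡ sign (triangle t) * (ℤ.+ 3 * ℤ.+ (2 ℕ.^ K N))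
  det-odd₁ t p ords = trans (det-odd ords) (cong (_* (ℤ.+ 3 * ℤ.+ (2 ℕ.^ K N))) (Δ-scaling3₁ t p))

  det-odd₂ : ∀ t → N ≡ suc t ℕ.+ (suc t ℕ.+ t) → OddOrders N →
             det N (conwayMatrix N) ≡ sign (triangle t) * (ℤ.+ 3 * ℤ.+ (2 ℕ.^ K N))
  det-odd₂ t p ords = trans (det-odd ords) (cong (_* (ℤ.+ 3 * ℤ.+ (2 ℕ.^ K N))) (Δ-scaling3₂ t p))

no-odd-orders : ∀ {N} m → N ≡ suc (m ℕ.+ m) → sign (triangle m) ≡ ℤ.-1ℤ → ¬ OddOrders N
no-odd-orders m refl s ords = Determinant.sign-triangle≢-1 m ords s

-- The witnesses are (N - 1)/2 in the four impossible cases and N/3 rounded down in the other four,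
-- each written as r + 4s to suit `sign-triangle`. For r = 0, 1, 2, 3 the sign of `triangle r` is +,
-- -, -, +.
module Residues (N q : ℕ) where

  mod5 : N ≡ 5 ℕ.+ q ℕ.* 24 → ¬ OddOrders N
  mod5 p = no-odd-orders (2 ℕ.+ 4 ℕ.* (3 ℕ.* q)) (trans p (eq q)) (sign-triangle (3 ℕ.* q) 2)
    where eq : ∀ q → 5 ℕ.+ q ℕ.* 24 ≡ 1 ℕ.+ (2 ℕ.+ 4 ℕ.* (3 ℕ.* q) ℕ.+ (2 ℕ.+ 4 ℕ.* (3 ℕ.* q)))
          eq = ℕ-Solver.solve-∀

  mod19 : N ≡ 19 ℕ.+ q ℕ.* 24 → ¬ OddOrders N
  mod19 p = no-odd-orders (1 ℕ.+ 4 ℕ.* (2 ℕ.+ 3 ℕ.* q)) (trans p (eq q)) (sign-triangle (2 ℕ.+ 3 ℕ.* q) 1)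
    where eq : ∀ q → 19 ℕ.+ q ℕ.* 24 ≡ 1 ℕ.+ (1 ℕ.+ 4 ℕ.* (2 ℕ.+ 3 ℕ.* q) ℕ.+ (1 ℕ.+ 4 ℕ.* (2 ℕ.+ 3 ℕ.* q)))
          eq = ℕ-Solver.solve-∀

  mod11 : N ≡ 11 ℕ.+ q ℕ.* 24 → ¬ OddOrders N
  mod11 p = no-odd-orders (1 ℕ.+ 4 ℕ.* (1 ℕ.+ 3 ℕ.* q)) (trans p (eq q)) (sign-triangle (1 ℕ.+ 3 ℕ.* q) 1)
    where eq : ∀ q → 11 ℕ.+ q ℕ.* 24 ≡ 1 ℕ.+ (1 ℕ.+ 4 ℕ.* (1 ℕ.+ 3 ℕ.* q) ℕ.+ (1 ℕ.+ 4 ℕ.* (1 ℕ.+ 3 ℕ.* q)))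
          eq = ℕ-Solver.solve-∀

  mod13 : N ≡ 13 ℕ.+ q ℕ.* 24 → ¬ OddOrders N
  mod13 p = no-odd-orders (2 ℕ.+ 4 ℕ.* (1 ℕ.+ 3 ℕ.* q)) (trans p (eq q)) (sign-triangle (1 ℕ.+ 3 ℕ.* q) 2)
    where eq : ∀ q → 13 ℕ.+ q ℕ.* 24 ≡ 1 ℕ.+ (2 ℕ.+ 4 ℕ.* (1 ℕ.+ 3 ℕ.* q) ℕ.+ (2 ℕ.+ 4 ℕ.* (1 ℕ.+ 3 ℕ.* q)))
          eq = ℕ-Solver.solve-∀

  mod1 : N ≡ 1 ℕ.+ q ℕ.* 24 → ∃ λ t → N ≡ suc t ℕ.+ (t ℕ.+ t) × sign (triangle t) ≡ 1ℤ
  mod1 p = 4 ℕ.* (2 ℕ.* q) , trans p (eq q) , sign-triangle (2 ℕ.* q) 0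
    where eq : ∀ q → 1 ℕ.+ q ℕ.* 24 ≡ 1 ℕ.+ 4 ℕ.* (2 ℕ.* q) ℕ.+ (4 ℕ.* (2 ℕ.* q) ℕ.+ 4 ℕ.* (2 ℕ.* q))
          eq = ℕ-Solver.solve-∀

  mod7 : N ≡ 7 ℕ.+ q ℕ.* 24 → ∃ λ t → N ≡ suc t ℕ.+ (t ℕ.+ t) × sign (triangle t) ≡ ℤ.-1ℤ
  mod7 p = 2 ℕ.+ 4 ℕ.* (2 ℕ.* q) , trans p (eq q) , sign-triangle (2 ℕ.* q) 2
    where eq : ∀ q → 7 ℕ.+ q ℕ.* 24 ≡ 1 ℕ.+ (2 ℕ.+ 4 ℕ.* (2 ℕ.* q)) ℕ.+ (2 ℕ.+ 4 ℕ.* (2 ℕ.* q) ℕ.+ (2 ℕ.+ 4 ℕ.* (2 ℕ.* q)))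
          eq = ℕ-Solver.solve-∀

  mod23 : N ≡ 23 ℕ.+ q ℕ.* 24 → ∃ λ t → N ≡ suc t ℕ.+ (suc t ℕ.+ t) × sign (triangle t) ≡ 1ℤ
  mod23 p = 3 ℕ.+ 4 ℕ.* (1 ℕ.+ 2 ℕ.* q) , trans p (eq q) , sign-triangle (1 ℕ.+ 2 ℕ.* q) 3
    where eq : ∀ q → 23 ℕ.+ q ℕ.* 24 ≡ 1 ℕ.+ (3 ℕ.+ 4 ℕ.* (1 ℕ.+ 2 ℕ.* q)) ℕ.+ (1 ℕ.+ (3 ℕ.+ 4 ℕ.* (1 ℕ.+ 2 ℕ.* q)) ℕ.+ (3 ℕ.+ 4 ℕ.* (1 ℕ.+ 2 ℕ.* q)))
          eq = ℕ-Solver.solve-∀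

  mod17 : N ≡ 17 ℕ.+ q ℕ.* 24 → ∃ λ t → N ≡ suc t ℕ.+ (suc t ℕ.+ t) × sign (triangle t) ≡ ℤ.-1ℤ
  mod17 p = 1 ℕ.+ 4 ℕ.* (1 ℕ.+ 2 ℕ.* q) , trans p (eq q) , sign-triangle (1 ℕ.+ 2 ℕ.* q) 1
    where eq : ∀ q → 17 ℕ.+ q ℕ.* 24 ≡ 1 ℕ.+ (1 ℕ.+ 4 ℕ.* (1 ℕ.+ 2 ℕ.* q)) ℕ.+ (1 ℕ.+ (1 ℕ.+ 4 ℕ.* (1 ℕ.+ 2 ℕ.* q)) ℕ.+ (1 ℕ.+ 4 ℕ.* (1 ℕ.+ 2 ℕ.* q)))
          eq = ℕ-Solver.solve-∀

OddForm : ℕ → Set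
OddForm N = ∃ λ m → N ≡ suc (m ℕ.+ m)

value : ℕ → ℤ
value N = ℤ.+ 3 * ℤ.+ (2 ℕ.^ K N)

det-zero : ∀ {N} → OddForm N → (∃ λ p → Prime p × p ∣ N × 2 ∣ ord2 p) → det N (conwayMatrix N) ≡ 0ℤ
det-zero (m , refl) = Determinant.det-even m

det-signed₁ : ∀ {N σ} → OddForm N → (∃ λ t → N ≡ suc t ℕ.+ (t ℕ.+ t) × sign (triangle t) ≡ σ) → OddOrders N →
              det N (conwayMatrix N) ≡ σ * value N
det-signed₁ (m , refl) (t , p , refl) ords = Determinant.det-odd₁ m t p ords

det-signed₂ : ∀ {N σ} → OddForm N → (∃ λ t → N ≡ suc t ℕ.+ (suc t ℕ.+ t) × sign (triangle t) ≡ σ) → OddOrders N →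
              det N (conwayMatrix N) ≡ σ * value N
det-signed₂ (m , refl) (t , p , refl) ords = Determinant.det-odd₂ m t p ords

module Signs (N : ℕ) (form : OddForm N) (ords : OddOrders N) where

  decompose : ∀ {r} → N % 24 ≡ r → N ≡ r ℕ.+ N ℕ./ 24 ℕ.* 24
  decompose refl = m≡m%n+[m/n]*n N 24

  open Residues N (N ℕ./ 24)

  positive : (N % 24 ≡ 1 ⊎ N % 24 ≡ 23 ⊎ N % 24 ≡ 5 ⊎ N % 24 ≡ 19) → det N (conwayMatrix N) ≡ value N
  positive (inj₁ r)               = trans (det-signed₁ form (mod1 (decompose r)) ords) (ℤₚ.*-identityˡ (value N))
  positive (inj₂ (inj₁ r))        = trans (det-signed₂ form (mod23 (decompose r)) ords) (ℤₚ.*-identityˡ (value N))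
  positive (inj₂ (inj₂ (inj₁ r))) = ⊥-elim (mod5 (decompose r) ords)
  positive (inj₂ (inj₂ (inj₂ r))) = ⊥-elim (mod19 (decompose r) ords)

  negative : (N % 24 ≡ 7 ⊎ N % 24 ≡ 17 ⊎ N % 24 ≡ 11 ⊎ N % 24 ≡ 13) → det N (conwayMatrix N) ≡ - value N
  negative (inj₁ r)               = trans (det-signed₁ form (mod7 (decompose r)) ords) (ℤₚ.-1*i≡-i (value N))
  negative (inj₂ (inj₁ r))        = trans (det-signed₂ form (mod17 (decompose r)) ords) (ℤₚ.-1*i≡-i (value N))
  negative (inj₂ (inj₂ (inj₁ r))) = ⊥-elim (mod11 (decompose r) ords)
  negative (inj₂ (inj₂ (inj₂ r))) = ⊥-elim (mod13 (decompose r) ords)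

open import Data.Integer using (+_)

theorem3p2 : (N : ℕ) → 1 < N → ¬ (2 ∣ N) → ¬ (3 ∣ N) →
    ((∃ λ p → Prime p × p ∣ N × 2 ∣ ord2 p) → det N (conwayMatrix N) ≡ ℤ.0ℤ)
    × ((∀ p → Prime p → p ∣ N → ¬ (2 ∣ ord2 p)) →
    (N % 24 ≡ 1 ⊎ N % 24 ≡ 23 ⊎ N % 24 ≡ 5 ⊎ N % 24 ≡ 19) →
    det N (conwayMatrix N) ≡ + 3 ℤ.* + (2 ^ K N))
    × ((∀ p → Prime p → p ∣ N → ¬ (2 ∣ ord2 p)) →
    (N % 24 ≡ 7 ⊎ N % 24 ≡ 17 ⊎ N % 24 ≡ 11 ⊎ N % 24 ≡ 13) →
    det N (conwayMatrix N) ≡ - (+ 3 ℤ.* + (2 ^ K N)))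
theorem3p2 N _ odd _ = det-zero form , Signs.positive N form , Signs.negative N form
  where form = odd⇒1+m+m N odd
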